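{- Let $\Gamma^{(1)}=[u^2]\Gamma$ and $B^{(1)}=[u^2]B$. Then \begin{align*} \Gamma^{(1)}&=(wf_{(\bullet)}\tau_{\circ\circ,\bullet}+\tau_{\circ\circ,\epsilon})\,x\exp(xf_{(\circ)})+(w^2\tau_{\bullet\bullet,\bullet}+w^3f_{(\bullet)}\tau_{\bullet\bullet,\bullet\bullet})(\exp(xf_{(\circ)})-1)\\ &\quad+(wf_{(\bullet\bullet\circ)}\tau_{\epsilon,\epsilon}+wf_{(\bullet)}\tau_{\bullet\circ,\epsilon}+f_{(\bullet\circ)}\tau_{\circ,\epsilon})\,\phi_1(y)\,x\exp(xf_{(\circ)})\\ &\quad+(wf_{(\bullet\bullet)}\tau_{\epsilon,\epsilon}+wf_{(\bullet)}\tau_{\bullet,\epsilon})f_{(\bullet\circ)}\,\phi_2(y)\,x\exp(xf_{(\circ)})\\ &\quad+wf_{(\bullet)}\tau_{\epsilon,\epsilon}\Big(\sum_{n\ge3}\frac{x^n}{n!}\psi_{(3,1^{n-3})}f_{(\circ\circ\circ)}f_{(\circ)}^{n-3}+\sum_{n\ge4}\frac{x^n}{n!}\psi_{(2^2,1^{n-4})}f_{(\circ\circ)}^2f_{(\circ)}^{n-4}\Big)+B^{(1)}. \end{align*}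
   Context: A rooted dipole is a 2-cell embedding, in a closed orientable surface, of a connected loopless graph with exactly two vertices (multiple edges allowed), with a distinguished edge (root edge) and one of its endpoints (root vertex); the other vertex is the non-root vertex. For a dipole $D$, $n(D)$ is the number of edges, $m(D)$ of faces, $g(D)=\tfrac12(n(D)-m(D))$ the genus. For a partition $\lambda$, $\psi_\lambda$ is the number of rooted dipoles with face-degree sequence $2\lambda$. The root corner is the corner at the root vertex first met circulating counterclockwise around it from the root edge; the root face contains it. $\widehat{\mathcal D}$ is the set of rooted dipoles with an additional secondary edge different from the root edge; other edges are ordinary. Around the root vertex, Region 1 (resp. 2) consists of corners and edge-ends met rotating counterclockwise from the root edge to the secondary edge (resp. secondary to root edge); around the non-root vertex, Region 3 (resp. 4) consists of those met rotating counterclockwise from the root edge to the secondary edge (resp. secondary to root edge). An ordinary edge is an $a$-edge (ends in Regions 2,3), $b$-edge (1,3), $c$-edge (2,4) or $d$-edge (1,4); $\alpha(D),\beta(D),\gamma(D),\delta(D)$ count them. Root-vertex corners in Region 1 are labelled $\bullet$, in Region 2 labelled $\circ$. $R(D)$ is the word of labels of root-vertex corners on a counterclockwise boundary walk of the root face from the root corner; for a word $S$, $(S)$ is the multiset of its cyclic shifts; $\Lambda(D)$ is the multiset of cyclic binary strings read on the non-root faces. Indeterminates: $g_S$ (words, $\epsilon$ the empty word), $f_{(S)}$ (cyclic binary strings), $x,y,v,w,u$; $f_{\Lambda(D)}=\prod_{(S)\in\Lambda(D)}f_{(S)}$. Define \[ \Gamma=\sum_{D\in\widehat{\mathcal D}}\frac{x^{\alpha(D)+1}}{(\alpha(D)+1)!}\frac{y^{\beta(D)}}{\beta(D)!}\frac{v^{\gamma(D)+\delta(D)}}{(\gamma(D)+\delta(D))!}w^{\delta(D)}u^{2g(D)}g_{R(D)}f_{\Lambda(D)},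 \] and $B$ the same sum restricted to $\gamma(D)=\delta(D)=0$ (so without $v,w$). Define, over nonempty words $R=R_1\cdots R_{\ell(R)}$, \[ C''=\sum_{R}\Big(\sum_{2\le i\le\ell(R)} w^{\delta_{R_i,\bullet}}g_{R_1R_i\cdots R_{\ell(R)}}f_{(R_2\cdots R_i)}+w\,g_{R_1}f_{(R)}\Big)\frac{\partial}{\partial g_R}. \] For $i\ge1$, $\phi(v,x_1,\dots,x_i)=\sum_{n\ge i}h_{n-i}(x_1,\dots,x_i)\frac{v^n}{n!}$ ($h_j$ complete homogeneous symmetric polynomial), $\phi(v)=1$. $\phi_i(y)$ is $\phi(y,x_1,\dots,x_i)$ with all $x_j=f_{(\bullet)}$. For a word $S=S_1\cdots S_i$, $\phi_S(v)$ is $\phi(v,x_1,\dots,x_i)$ with $x_j=f_{(\circ)}$ if $S_j=\circ$ and $x_j=wf_{(\bullet)}$ if $S_j=\bullet$ ($\phi_\epsilon=1$). For words $R,S$, $\tau_{R,S}$ is the unique solution of $\big(\frac{\partial}{\partial v}-C''\big)\tau_{R,S}=g_{\bullet R}\phi_S(v)$ with $\tau_{R,S}|_{v=0}=0$. -}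

module Defs where

open import Data.Nat using (ℕ; zero; suc; _≡ᵇ_; _≤ᵇ_; _<ᵇ_) renaming (_+_ to _+ℕ_; _*_ to _*ℕ_; _∸_ to _∸ℕ_)
open import Data.Nat.Combinatorics using (_C_)
open import Data.Bool using (Bool; true; false; _∧_; _∨_; not; if_then_else_)
open import Data.List using (List; []; _∷_; _++_; map; concat; concatMap; length
                            ; upTo; replicate; take; drop; foldr)
open import Data.Integer as ℤ using (ℤ; +_)
open import Data.Product using (_×_; _,_; proj₁; proj₂)
open import Relation.Binary.PropositionalEquality using (_≡_)

filter : {A : Set} → (A → Bool) → List A → List A
filter P [] = []
filter P (x ∷ xs) = if P x then x ∷ filter P xs else filter P xs

any : {A : Set} → (A → Bool) → List A → Bool
any P [] = false
any P (x ∷ xs) = P x ∨ any P xs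

all : {A : Set} → (A → Bool) → List A → Bool
all P [] = true
all P (x ∷ xs) = P x ∧ all P xs

sum : List ℕ → ℕ
sum [] = 0
sum (x ∷ xs) = x +ℕ sum xs

removeOne : {A : Set} → (A → A → Bool) → A → List A → Bool × List A
removeOne eq x [] = false , []
removeOne eq x (y ∷ ys) with eq x y
... | true  = true , ys
... | false with removeOne eq x ys
...   | b , zs = b , y ∷ zs

bagEq : {A : Set} → (A → A → Bool) → List A → List A → Bool
bagEq eq [] ys = Data.List.null ys
  where import Data.List
bagEq eq (x ∷ xs) ys with removeOne eq x ys
... | true  , zs = bagEq eq xs zs
... | false , _  = false

oneTo : ℕ → List ℕ
oneTo n = map suc (upTo n)

nth : List ℕ → ℕ → ℕ
nth [] i = 0
nth (x ∷ xs) zero = x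
nth (x ∷ xs) (suc i) = nth xs i

pos : List ℕ → ℕ → ℕ
pos [] e = 0
pos (x ∷ xs) e = if x ≡ᵇ e then 0 else suc (pos xs e)

predMod : ℕ → ℕ → ℕ
predMod n zero = n ∸ℕ 1
predMod n (suc p) = p

insertAll : {A : Set} → A → List A → List (List A)
insertAll x [] = (x ∷ []) ∷ []
insertAll x (y ∷ ys) = (x ∷ y ∷ ys) ∷ map (y ∷_) (insertAll x ys)

perms : {A : Set} → List A → List (List A)
perms [] = [] ∷ []
perms (x ∷ xs) = concatMap (insertAll x) (perms xs)

data Label : Set where
  ● : Label   -- corner in Region 1
  ○ : Label   -- corner in Region 2

Word : Set
Word = List Label

labelEq : Label → Label → Bool
labelEq ● ● = true
labelEq ○ ○ = true
labelEq _ _ = false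

wordEq : Word → Word → Bool
wordEq [] [] = true
wordEq (a ∷ as) (b ∷ bs) = labelEq a b ∧ wordEq as bs
wordEq _ _ = false

rotations : Word → List Word
rotations S = map (λ i → drop i S ++ take i S) (upTo (length S))

cyclicEq : Word → Word → Bool
cyclicEq S T = (length S ≡ᵇ length T) ∧ any (wordEq T) (rotations S)

-- Polynomials with integer coefficients in the commuting indeterminates
-- w, g_S (S a word) and f_(S) (S a cyclic binary string, given by any
-- representative word).

data Var : Set where
  w : Var
  g : Word → Var
  f : Word → Var

varEq : Var → Var → Bool
varEq w w = true
varEq (g S) (g T) = wordEq S T
varEq (f S) (f T) = cyclicEq S T
varEq _ _ = false

Monomial : Set
Monomial = List Var

monoEq : Monomial → Monomial → Bool
monoEq = bagEq varEq

Poly : Set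
Poly = List (ℤ × Monomial)

coeff : Poly → Monomial → ℤ
coeff [] m = + 0
coeff ((c , m') ∷ p) m = (if monoEq m' m then c else + 0) ℤ.+ coeff p m

_≈P_ : Poly → Poly → Set
p ≈P q = ∀ (m : Monomial) → coeff p m ≡ coeff q m

0P 1P : Poly
0P = []
1P = (+ 1 , []) ∷ []

varP : Var → Poly
varP v = (+ 1 , v ∷ []) ∷ []

_+P_ : Poly → Poly → Poly
p +P q = p ++ q

negP : Poly → Poly
negP = map (λ t → ℤ.- proj₁ t , proj₂ t)

scaleP : ℤ → Poly → Poly
scaleP k = map (λ t → k ℤ.* proj₁ t , proj₂ t)

_*P_ : Poly → Poly → Poly
p *P q = concatMap (λ s → map (λ t → proj₁ s ℤ.* proj₁ t , proj₂ s ++ proj₂ t) q) p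

_^P_ : Poly → ℕ → Poly
p ^P zero = 1P
p ^P suc k = p *P (p ^P k)

sumP : List Poly → Poly
sumP = concat

sumTo : ℕ → (ℕ → Poly) → Poly
sumTo n F = sumP (map F (upTo (suc n)))

infixl 7 _*P_
infixl 6 _+P_

-- Formal power series in x, y, v whose coefficients are polynomials in
-- w, g_S, f_(S), written in exponential form:
--   s  =  Σ_{a,b,c} s a b c · x^a/a! · y^b/b! · v^c/c!

Series : Set
Series = ℕ → ℕ → ℕ → Poly

_≈S_ : Series → Series → Set
s ≈S t = ∀ a b c → s a b c ≈P t a b c

isZero : ℕ → Bool
isZero zero = true
isZero (suc _) = false

cst : Poly → Series
cst p a b c = if isZero a ∧ isZero b ∧ isZero c then p else 0P

1S : Series
1S = cst 1P

xS : Series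
xS a b c = if (a ≡ᵇ 1) ∧ isZero b ∧ isZero c then 1P else 0P

_⊕_ : Series → Series → Series
(s ⊕ t) a b c = s a b c +P t a b c

_⊖_ : Series → Series → Series
(s ⊖ t) a b c = s a b c +P negP (t a b c)

_⊗_ : Series → Series → Series
(s ⊗ t) a b c =
  sumTo a λ i → sumTo b λ j → sumTo c λ k →
    scaleP (+ ((a C i) *ℕ (b C j) *ℕ (c C k)))
           (s i j k *P t (a ∸ℕ i) (b ∸ℕ j) (c ∸ℕ k))

infixl 7 _⊗_
infixl 6 _⊕_ _⊖_

expX : Poly → Series
expX p a b c = if isZero b ∧ isZero c then p ^P a else 0P

-- Rooted dipoles.
-- A rooted dipole with n ≥ 1 edges is encoded as follows: the edges are
-- named 0,…,n-1 in counterclockwise order around the root vertex, starting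
-- with the root edge 0.  The dipole is then determined (up to
-- root-preserving isomorphism) by the counterclockwise cyclic order of the
-- edges around the non-root vertex, recorded as the list of edges met
-- counterclockwise around the non-root vertex starting with the root edge 0.
-- Every such list (0 followed by a permutation of 1,…,n-1) occurs exactly once.

Dipole : Set
Dipole = List ℕ

dipoles : ℕ → List Dipole
dipoles zero = []
dipoles (suc n) = map (0 ∷_) (perms (oneTo n))

nEdges : Dipole → ℕ
nEdges = length

-- Corner i (0 ≤ i < n) at the root vertex is the corner between edge i and
-- edge i+1 (mod n) counterclockwise; corner 0 is the root corner.
-- Walking counterclockwise along a face boundary (face on the left), one
-- arrives at the root vertex along edge e+1, leaves through corner e along
-- edge e, reaches the non-root vertex and leaves it along the clockwise
-- neighbour e' of e there, arriving back at the root vertex along e' and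
-- traversing corner e'-1 next.  This is the successor map on root corners:
nextCorner : Dipole → ℕ → ℕ
nextCorner D c = predMod (nEdges D) (nth D (predMod (nEdges D) (pos D c)))

orbitFrom : (ℕ → ℕ) → ℕ → ℕ → ℕ → List ℕ
orbitFrom F s zero x = []
orbitFrom F s (suc k) x = if x ≡ᵇ s then [] else x ∷ orbitFrom F s k (F x)

orbit : Dipole → ℕ → List ℕ
orbit D s = s ∷ orbitFrom (nextCorner D) s (nEdges D) (nextCorner D s)

-- the faces, each given by the cyclic sequence of its root-vertex corners
-- (listed from its smallest corner; every face has degree 2 · #corners)
faces : Dipole → List (List ℕ)
faces D = map (orbit D) (filter (λ c → all (λ x → c ≤ᵇ x) (orbit D c)) (upTo (nEdges D)))

nFaces : Dipole → ℕ
nFaces D = length (faces D)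

rootFace : Dipole → List ℕ
rootFace D = orbit D 0

nonRootFaces : Dipole → List (List ℕ)
nonRootFaces D = filter (λ F → not (any (_≡ᵇ 0) F)) (faces D)

-- ψ_λ : number of rooted dipoles with face-degree sequence 2λ
psi : List ℕ → ℕ
psi λs = length (filter (λ D → bagEq _≡ᵇ_ (map length (faces D)) λs) (dipoles (sum λs)))

-- Dipoles with a secondary edge s ∈ {1,…,n-1}

DipoleS : Set
DipoleS = Dipole × ℕ

dipolesS : ℕ → List DipoleS
dipolesS n = concatMap (λ D → map (D ,_) (oneTo (n ∸ℕ 1))) (dipoles n)

ordinary : DipoleS → List ℕ
ordinary (D , s) = filter (λ e → not (e ≡ᵇ s)) (oneTo (nEdges D ∸ℕ 1))

-- end of e at the root vertex lies in Region 1
inR1 : DipoleS → ℕ → Bool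
inR1 (D , s) e = e <ᵇ s

-- end of e at the non-root vertex lies in Region 3
inR3 : DipoleS → ℕ → Bool
inR3 (D , s) e = pos D e <ᵇ pos D s

count : (ℕ → Bool) → List ℕ → ℕ
count P xs = length (filter P xs)

αD βD γD δD : DipoleS → ℕ
αD Ds = count (λ e → not (inR1 Ds e) ∧ inR3 Ds e) (ordinary Ds)   -- Regions 2,3
βD Ds = count (λ e → inR1 Ds e ∧ inR3 Ds e) (ordinary Ds)
γD Ds = count (λ e → not (inR1 Ds e) ∧ not (inR3 Ds e)) (ordinary Ds) -- Regions 2,4
δD Ds = count (λ e → inR1 Ds e ∧ not (inR3 Ds e)) (ordinary Ds)   -- Regions 1,4

cornerLabel : DipoleS → ℕ → Label
cornerLabel (D , s) i = if i <ᵇ s then ● else ○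

RD : DipoleS → Word
RD (D , s) = map (cornerLabel (D , s)) (rootFace D)

ΛD : DipoleS → List Word
ΛD (D , s) = map (map (cornerLabel (D , s))) (nonRootFaces D)

weight : DipoleS → Monomial
weight Ds = replicate (δD Ds) w ++ (g (RD Ds) ∷ map f (ΛD Ds))

-- Γ and B.  [u^k]Γ as an exponential series in x, y, v:
-- its coefficient of x^a/a! y^b/b! v^c/c! is the sum of w^δ g_R f_Λ over
-- D ∈ D̂ with α+1 = a, β = b, γ+δ = c and 2g(D) = n(D) - m(D) = k.
-- Such D have n(D) = α+β+γ+δ+2 = a+b+c+1 edges.

GammaU : ℕ → Series
GammaU k a b c =
  map (λ Ds → + 1 , weight Ds)
    (filter (λ Ds → (suc (αD Ds) ≡ᵇ a) ∧ (βD Ds ≡ᵇ b) ∧ ((γD Ds +ℕ δD Ds) ≡ᵇ c)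
                    ∧ (nEdges (proj₁ Ds) ≡ᵇ nFaces (proj₁ Ds) +ℕ k))
            (dipolesS (a +ℕ b +ℕ c +ℕ 1)))

BU : ℕ → Series
BU k a b c =
  map (λ Ds → + 1 , weight Ds)
    (filter (λ Ds → (suc (αD Ds) ≡ᵇ a) ∧ (βD Ds ≡ᵇ b) ∧ ((γD Ds +ℕ δD Ds) ≡ᵇ c)
                    ∧ (γD Ds ≡ᵇ 0) ∧ (δD Ds ≡ᵇ 0)
                    ∧ (nEdges (proj₁ Ds) ≡ᵇ nFaces (proj₁ Ds) +ℕ k))
            (dipolesS (a +ℕ b +ℕ c +ℕ 1)))

Γ⁽¹⁾ B⁽¹⁾ : Series
Γ⁽¹⁾ = GammaU 2
B⁽¹⁾ = BU 2

wIf : Label → Monomial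
wIf ● = w ∷ []
wIf ○ = []

-- term for index i = j+1 (2 ≤ i ≤ ℓ(R)), R = r ∷ rs:
--   w^{δ_{R_i,●}} g_{R_1 R_i ⋯ R_ℓ} f_{(R_2 ⋯ R_i)}
C''term : Label → Word → ℕ → Poly
C''term r rs j with drop (j ∸ℕ 1) rs
... | [] = 0P
... | ri ∷ rest = (+ 1 , wIf ri ++ (g (r ∷ ri ∷ rest) ∷ f (take j rs) ∷ [])) ∷ []

C''g : Word → Poly
C''g [] = 0P
C''g (r ∷ rs) = sumP (map (C''term r rs) (oneTo (length rs)))
                +P ((+ 1 , w ∷ g (r ∷ []) ∷ f (r ∷ rs) ∷ []) ∷ [])

C''var : Var → Poly
C''var (g R) = C''g R
C''var _ = 0P

-- Leibniz rule on a monomial pre ++ rest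
C''mono : ℤ → Monomial → Monomial → Poly
C''mono c pre [] = 0P
C''mono c pre (v ∷ post) =
  map (λ t → c ℤ.* proj₁ t , pre ++ proj₂ t ++ post) (C''var v)
  +P C''mono c (pre ++ v ∷ []) post

C'' : Poly → Poly
C'' p = concatMap (λ t → C''mono (proj₁ t) [] (proj₂ t)) p

h : ℕ → List Poly → Poly
h zero xs = 1P
h (suc j) [] = 0P
h (suc j) (x ∷ xs) = sumTo (suc j) (λ k → (x ^P k) *P h (suc j ∸ℕ k) xs)

-- exponential coefficient [v^n/n!] φ(v, x_1,…,x_i) = h_{n-i}(x_1,…,x_i) (n ≥ i), else 0;
-- for i = 0 this gives φ(v) = 1.
phiCoeff : List Poly → ℕ → Poly
phiCoeff xs n = if length xs ≤ᵇ n then h (n ∸ℕ length xs) xs else 0P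

phiY : ℕ → Series
phiY i a b c = if isZero a ∧ isZero c then phiCoeff (replicate i (varP (f (● ∷ [])))) b else 0P

xOf : Label → Poly
xOf ○ = varP (f (○ ∷ []))
xOf ● = varP w *P varP (f (● ∷ []))

phiS : Word → Series
phiS S a b c = if isZero a ∧ isZero b then phiCoeff (map xOf S) c else 0P

-- τ_{R,S}: the unique series in v with (∂/∂v − C'') τ = g_{●R} φ_S(v) and
-- τ|_{v=0} = 0.  Writing τ = Σ_c τ_c v^c/c!, this equation says exactly
--   τ_0 = 0,   τ_{c+1} = C''(τ_c) + g_{●R} · [v^c/c!] φ_S(v).

tauCoeff : Word → Word → ℕ → Poly
tauCoeff R S zero = 0P
tauCoeff R S (suc c) = C'' (tauCoeff R S c) +P varP (g (● ∷ R)) *P phiCoeff (map xOf S) c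

τ : Word → Word → Series
τ R S a b c = if isZero a ∧ isZero b then tauCoeff R S c else 0P

fP : Word → Poly
fP S = varP (f S)

psiSeries : Series
psiSeries n b c =
  if isZero b ∧ isZero c then
    ((if 3 ≤ᵇ n then scaleP (+ psi (3 ∷ replicate (n ∸ℕ 3) 1))
                        (fP (○ ∷ ○ ∷ ○ ∷ []) *P (fP (○ ∷ []) ^P (n ∸ℕ 3)))
                else 0P)
     +P (if 4 ≤ᵇ n then scaleP (+ psi (2 ∷ 2 ∷ replicate (n ∸ℕ 4) 1))
                          ((fP (○ ∷ ○ ∷ []) ^P 2) *P (fP (○ ∷ []) ^P (n ∸ℕ 4)))
                  else 0P))
  else 0P

wP : Poly
wP = varP w

RHS : Series
RHS =
    (cst (wP *P fP (● ∷ [])) ⊗ τ (○ ∷ ○ ∷ []) (● ∷ []) ⊕ τ (○ ∷ ○ ∷ []) [])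
      ⊗ xS ⊗ expX (fP (○ ∷ []))
  ⊕ (cst (wP ^P 2) ⊗ τ (● ∷ ● ∷ []) (● ∷ [])
      ⊕ cst ((wP ^P 3) *P fP (● ∷ [])) ⊗ τ (● ∷ ● ∷ []) (● ∷ ● ∷ []))
      ⊗ (expX (fP (○ ∷ [])) ⊖ 1S)
  ⊕ (cst (wP *P fP (● ∷ ● ∷ ○ ∷ [])) ⊗ τ [] []
      ⊕ cst (wP *P fP (● ∷ [])) ⊗ τ (● ∷ ○ ∷ []) []
      ⊕ cst (fP (● ∷ ○ ∷ [])) ⊗ τ (○ ∷ []) [])
      ⊗ phiY 1 ⊗ xS ⊗ expX (fP (○ ∷ []))
  ⊕ (cst (wP *P fP (● ∷ ● ∷ [])) ⊗ τ [] []
      ⊕ cst (wP *P fP (● ∷ [])) ⊗ τ (● ∷ []) [])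
      ⊗ cst (fP (● ∷ ○ ∷ [])) ⊗ phiY 2 ⊗ xS ⊗ expX (fP (○ ∷ []))
  ⊕ cst (wP *P fP (● ∷ [])) ⊗ τ [] [] ⊗ psiSeries
  ⊕ B⁽¹⁾

{-# OPTIONS --safe #-}
module Submission where

open import Defs
open import Data.Bool using (Bool; true; false; _∧_; _∨_; not; if_then_else_; T)
open import Data.Bool.Properties using (∧-zeroʳ; ∧-identityʳ)
open import Data.Empty using (⊥; ⊥-elim)
open import Data.Unit using (⊤; tt)
open import Data.Nat using (ℕ; zero; suc; _+_; _*_; _∸_; _≤_; _<_; z≤n; s≤s; s≤s⁻¹; _≡ᵇ_; _<ᵇ_; _≤ᵇ_)
import Data.Nat.Properties as ℕₚ
open import Data.Nat.Combinatorics using (_C_; nCn≡1; nC1≡n)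
open import Data.Integer as ℤ using (ℤ; +_)
import Data.Integer.Properties as ℤₚ
open import Data.Integer.Solver using (module +-*-Solver)
open import Data.List using (List; []; _∷_; _++_; map; concat; concatMap; length; upTo; applyUpTo; replicate; take; drop)
import Data.List.Properties as Listₚ
open import Data.List.Relation.Binary.Permutation.Propositional as ↭ using (_↭_; prep; swap; ↭-refl; ↭-sym; ↭-trans; ↭-reflexive)
import Data.List.Relation.Binary.Permutation.Propositional.Properties as ↭ₚ
open import Data.List.Relation.Unary.All as All using (All; []; _∷_)
import Data.List.Relation.Unary.All.Properties as Allₚ
open import Data.List.Relation.Unary.AllPairs as AllPairs using ([]; _∷_)
open import Data.List.Relation.Unary.Unique.Propositional using (Unique)
import Data.List.Relation.Unary.Unique.Propositional.Properties as Uniqueₚ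
open import Data.List.Relation.Binary.Pointwise as Pointwise using (Pointwise; []; _∷_)
open import Data.Product using (∃-syntax; _×_; _,_; proj₁; proj₂)
open import Data.Sum using (_⊎_; inj₁; inj₂)
open import Function using (_∘_; id; case_of_)
open import Relation.Binary.PropositionalEquality using (_≡_; _≢_; refl; sym; trans; cong; cong₂; subst; subst₂; _≗_; module ≡-Reasoning)

-- Insert a new edge into a dipole so that at the non-root vertex it comes just before the root edge.
-- Every dipole arises exactly once in this way.  If the new edge falls into a corner of the root face
-- it cuts that face in two, which is what C″ records; otherwise it joins the root face to another
-- face and raises the genus.  Hence (∂/∂v − C″)Γ⁽¹⁾ is the contribution of joins of planar dipoles,
-- which are explicit, and Γ⁽¹⁾|_{v=0} = B⁽¹⁾.  Since C″ commutes with every f, with w, x and y, all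
-- terms of the formula but B⁽¹⁾ solve a recursion of the same kind, so it suffices to compare the
-- inhomogeneities, that is, to know C″B⁽¹⁾.  There the secondary edge is the last edge at the
-- non-root vertex and determines the corner following the root corner in the root face.  If there
-- are no b-edges, the root face has a single corner, and removing the secondary edge leaves an
-- arbitrary dipole of genus one, counted by ψ.  Otherwise the root face has several corners, and the
-- face permutation is a 3-cycle (0 p q) or a product (0 p)(q r) with q < p < r; by the same insertion
-- each of these occurs exactly once.

-- The last position at the non-root vertex lies in Region 4, so an insertion that keeps an old
-- secondary edge adds one c- or d-edge and leaves `α` and `β` unchanged. On exponential
-- coefficients this is the index shift performed by ∂/∂v. The new edge is a d-edge exactly when it
-- enters a black corner, hence the `w` in C″.
--
-- For each number of edges there is one planar dipole and all its faces have a single corner, so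
-- its joins are determined by counting black and white corners. They involve no `y`, while C″B⁽¹⁾
-- involves no `v`, and the formula separates accordingly. With X = w f_(●), one has 1 + X φ_●(v) =
-- exp(Xv) and φ_●(v) + X φ_●●(v) = v exp(Xv): these two combinations are the first line of the
-- formula. The remaining terms are the cuts of the root words ●●○, ●● and ● that occur in B⁽¹⁾;
-- `φ₁(y)` and `φ₂(y)` count the black faces left over.
--
-- The obstacle is that polynomials are unnormalised lists whose letters are compared up to
-- rotation. Identities are therefore tested against symmetric functionals, on which C″ acts by its
-- transpose `∂`, and inductions have to treat all functionals at once.

variable
  A B : Set

-- Finite sums

∑ : List A → (A → ℤ) → ℤ
∑ [] φ = + 0
∑ (x ∷ xs) φ = φ x ℤ.+ ∑ xs φ

interchange : ∀ a b c d → (a ℤ.+ b) ℤ.+ (c ℤ.+ d) ≡ (a ℤ.+ c) ℤ.+ (b ℤ.+ d)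
interchange = solve 4 (λ a b c d → (a :+ b) :+ (c :+ d) := (a :+ c) :+ (b :+ d)) refl
  where open +-*-Solver

rotate₃ : ∀ a b c → a ℤ.+ (b ℤ.+ c) ≡ b ℤ.+ (a ℤ.+ c)
rotate₃ = solve 3 (λ a b c → a :+ (b :+ c) := b :+ (a :+ c)) refl
  where open +-*-Solver

*-exchange : ∀ a b c → a ℤ.* (b ℤ.* c) ≡ b ℤ.* (a ℤ.* c)
*-exchange = solve 3 (λ a b c → a :* (b :* c) := b :* (a :* c)) refl
  where open +-*-Solver

∑-cong : (xs : List A) {φ ψ : A → ℤ} → φ ≗ ψ → ∑ xs φ ≡ ∑ xs ψ
∑-cong [] e = refl
∑-cong (x ∷ xs) e = cong₂ ℤ._+_ (e x) (∑-cong xs e)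

∑-cong-All : {xs : List A} {φ ψ : A → ℤ} → All (λ x → φ x ≡ ψ x) xs → ∑ xs φ ≡ ∑ xs ψ
∑-cong-All [] = refl
∑-cong-All (e ∷ es) = cong₂ ℤ._+_ e (∑-cong-All es)

∑-zero : (xs : List A) → ∑ xs (λ _ → + 0) ≡ + 0
∑-zero [] = refl
∑-zero (x ∷ xs) = trans (ℤₚ.+-identityˡ _) (∑-zero xs)

∑-zero-All : {xs : List A} {φ : A → ℤ} → All (λ x → φ x ≡ + 0) xs → ∑ xs φ ≡ + 0
∑-zero-All {xs = xs} es = trans (∑-cong-All es) (∑-zero xs)

∑-++ : (xs ys : List A) {φ : A → ℤ} → ∑ (xs ++ ys) φ ≡ ∑ xs φ ℤ.+ ∑ ys φ
∑-++ [] ys = sym (ℤₚ.+-identityˡ _)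
∑-++ (x ∷ xs) ys {φ} = trans (cong (ℤ._+_ (φ x)) (∑-++ xs ys)) (sym (ℤₚ.+-assoc (φ x) (∑ xs φ) (∑ ys φ)))

∑-map : (k : A → B) (xs : List A) {φ : B → ℤ} → ∑ (map k xs) φ ≡ ∑ xs (φ ∘ k)
∑-map k [] = refl
∑-map k (x ∷ xs) {φ} = cong (ℤ._+_ (φ (k x))) (∑-map k xs)

∑-concatMap : (k : A → List B) (xs : List A) {φ : B → ℤ} → ∑ (concatMap k xs) φ ≡ ∑ xs (λ x → ∑ (k x) φ)
∑-concatMap k [] = refl
∑-concatMap k (x ∷ xs) {φ} = trans (∑-++ (k x) (concatMap k xs)) (cong (ℤ._+_ (∑ (k x) φ)) (∑-concatMap k xs))

∑-+ : (xs : List A) {φ ψ : A → ℤ} → ∑ xs (λ x → φ x ℤ.+ ψ x) ≡ ∑ xs φ ℤ.+ ∑ xs ψ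
∑-+ [] = refl
∑-+ (x ∷ xs) {φ} {ψ} = trans (cong (ℤ._+_ (φ x ℤ.+ ψ x)) (∑-+ xs)) (interchange (φ x) (ψ x) (∑ xs φ) (∑ xs ψ))

∑-*ˡ : (k : ℤ) (xs : List A) {φ : A → ℤ} → ∑ xs (λ x → k ℤ.* φ x) ≡ k ℤ.* ∑ xs φ
∑-*ˡ k [] = sym (ℤₚ.*-zeroʳ k)
∑-*ˡ k (x ∷ xs) {φ} = trans (cong (ℤ._+_ (k ℤ.* φ x)) (∑-*ˡ k xs)) (sym (ℤₚ.*-distribˡ-+ k (φ x) (∑ xs φ)))

∑-swap : (xs : List A) (ys : List B) {φ : A → B → ℤ} →
         ∑ xs (λ x → ∑ ys (φ x)) ≡ ∑ ys (λ y → ∑ xs (λ x → φ x y))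
∑-swap [] ys = sym (∑-zero ys)
∑-swap (x ∷ xs) ys {φ} = trans (cong (ℤ._+_ (∑ ys (φ x))) (∑-swap xs ys)) (sym (∑-+ ys))

∑-↭ : {xs ys : List A} {φ : A → ℤ} → xs ↭ ys → ∑ xs φ ≡ ∑ ys φ
∑-↭ ↭.refl = refl
∑-↭ {φ = φ} (prep x p) = cong (ℤ._+_ (φ x)) (∑-↭ p)
∑-↭ {ys = _ ∷ _ ∷ ys} {φ} (swap x y p) = trans (cong (λ z → φ x ℤ.+ (φ y ℤ.+ z)) (∑-↭ p)) (rotate₃ (φ x) (φ y) (∑ ys φ))
∑-↭ (↭.trans p q) = trans (∑-↭ p) (∑-↭ q)

∑-filter : (P : A → Bool) (xs : List A) {φ : A → ℤ} →
           ∑ (filter P xs) φ ≡ ∑ xs (λ x → if P x then φ x else + 0)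
∑-filter P [] = refl
∑-filter P (x ∷ xs) {φ} with P x
... | true  = cong (ℤ._+_ (φ x)) (∑-filter P xs)
... | false = trans (∑-filter P xs) (sym (ℤₚ.+-identityˡ _))

∑-if-const : (xs : List A) (P : A → Bool) (k : ℤ) →
             ∑ xs (λ x → if P x then k else + 0) ≡ + length (filter P xs) ℤ.* k
∑-if-const [] P k = sym (ℤₚ.*-zeroˡ k)
∑-if-const (x ∷ xs) P k with P x
... | true  = trans (cong (λ z → k ℤ.+ z) (∑-if-const xs P k)) (sym (ℤₚ.suc-* (+ length (filter P xs)) k))
... | false = trans (ℤₚ.+-identityˡ _) (∑-if-const xs P k)

∑-upTo-suc : ∀ n (φ : ℕ → ℤ) → ∑ (upTo (suc n)) φ ≡ φ 0 ℤ.+ ∑ (upTo n) (φ ∘ suc)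
∑-upTo-suc n φ = cong (λ z → φ 0 ℤ.+ z) (trans (cong (λ l → ∑ l φ) (sym (Listₚ.map-upTo suc n))) (∑-map suc (upTo n)))

-- Monomial functionals

Functional : Set
Functional = Monomial → ℤ

-- `monoEq` ignores the order of the letters and the starting point of the word in an `f`. Rotation
-- is required for the leading letter only, because `perm` brings any letter to the front.
record Respects (L : Functional) : Set where
  field
    perm : ∀ {m m'} → m ↭ m' → L m ≡ L m'
    rot  : ∀ u v m → L (f (u ++ v) ∷ m) ≡ L (f (v ++ u) ∷ m)
open Respects

⟦_⟧ : Poly → Functional → ℤ
⟦ p ⟧ L = ∑ p (λ t → proj₁ t ℤ.* L (proj₂ t))

-- Finer than ≈P, since reading off a coefficient respects these symmetries; unlike ≈P it is visibly a
-- congruence for products and for C″.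
infix 4 _≋_
record _≋_ (p q : Poly) : Set where
  constructor functionally
  field
    eval : ∀ L → Respects L → ⟦ p ⟧ L ≡ ⟦ q ⟧ L
open _≋_

≋-refl : ∀ {p} → p ≋ p
eval ≋-refl L r = refl

≋-sym : ∀ {p q} → p ≋ q → q ≋ p
eval (≋-sym e) L r = sym (eval e L r)

≋-trans : ∀ {p q s} → p ≋ q → q ≋ s → p ≋ s
eval (≋-trans e e') L r = trans (eval e L r) (eval e' L r)

≋-reflexive : ∀ {p q} → p ≡ q → p ≋ q
≋-reflexive refl = ≋-refl

⟦⟧-cong : ∀ p {L L'} → L ≗ L' → ⟦ p ⟧ L ≡ ⟦ p ⟧ L'
⟦⟧-cong p e = ∑-cong p (λ t → cong (λ z → proj₁ t ℤ.* z) (e (proj₂ t)))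

⟦+⟧ : ∀ p q {L} → ⟦ p +P q ⟧ L ≡ ⟦ p ⟧ L ℤ.+ ⟦ q ⟧ L
⟦+⟧ p q = ∑-++ p q

⟦neg⟧ : ∀ p {L} → ⟦ negP p ⟧ L ≡ ℤ.- ⟦ p ⟧ L
⟦neg⟧ [] = refl
⟦neg⟧ ((c , m) ∷ p) {L} = trans (cong₂ ℤ._+_ (sym (ℤₚ.neg-distribˡ-* c (L m))) (⟦neg⟧ p))
  (sym (ℤₚ.neg-distrib-+ (c ℤ.* L m) (⟦ p ⟧ L)))

⟦scale⟧ : ∀ k p {L} → ⟦ scaleP k p ⟧ L ≡ k ℤ.* ⟦ p ⟧ L
⟦scale⟧ k p {L} = trans (∑-map _ p) (trans (∑-cong p (λ t → ℤₚ.*-assoc k (proj₁ t) (L (proj₂ t)))) (∑-*ˡ k p))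

⟦*⟧ : ∀ p q {L} → ⟦ p *P q ⟧ L ≡ ⟦ p ⟧ (λ m → ⟦ q ⟧ (λ m' → L (m ++ m')))
⟦*⟧ p q {L} = trans (∑-concatMap _ p) (∑-cong p (λ s → trans (∑-map _ q)
  (trans (∑-cong q (λ t → ℤₚ.*-assoc (proj₁ s) (proj₁ t) _)) (∑-*ˡ (proj₁ s) q))))

⟦⟧-*-functional : ∀ p k {L} → ⟦ p ⟧ (λ m → k ℤ.* L m) ≡ k ℤ.* ⟦ p ⟧ L
⟦⟧-*-functional p k {L} = trans (∑-cong p (λ t → *-exchange (proj₁ t) k (L (proj₂ t)))) (∑-*ˡ k p)

⟦⟧-swap : ∀ p q {φ : Monomial → Monomial → ℤ} →
          ⟦ p ⟧ (λ m → ⟦ q ⟧ (φ m)) ≡ ⟦ q ⟧ (λ m' → ⟦ p ⟧ (λ m → φ m m'))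
⟦⟧-swap p q {φ} = trans (∑-cong p (λ t → sym (⟦⟧-*-functional q (proj₁ t)))) (trans (∑-swap p q)
  (∑-cong q (λ t → ∑-*ˡ (proj₁ t) p)))

Respects-prefix : ∀ {L} → Respects L → ∀ m₀ → Respects (λ m → L (m₀ ++ m))
perm (Respects-prefix r m₀) p = perm r (↭ₚ.++⁺ˡ m₀ p)
rot (Respects-prefix r m₀) u v m =
  trans (perm r (↭ₚ.shift _ m₀ m)) (trans (rot r u v (m₀ ++ m)) (perm r (↭-sym (↭ₚ.shift _ m₀ m))))

Respects-⟦⟧ : ∀ {φ : Monomial → Functional} q → (∀ m' → Respects (λ m → φ m m')) → Respects (λ m → ⟦ q ⟧ (φ m))
perm (Respects-⟦⟧ q r) p = ⟦⟧-cong q (λ m' → perm (r m') p)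
rot (Respects-⟦⟧ q r) u v m = ⟦⟧-cong q (λ m' → rot (r m') u v m)

Respects-suffix : ∀ {L} → Respects L → ∀ m₀ → Respects (λ m → L (m ++ m₀))
perm (Respects-suffix r m₀) p = perm r (↭ₚ.++⁺ʳ m₀ p)
rot (Respects-suffix r m₀) u v m = rot r u v (m ++ m₀)

+P-cong : ∀ {p p' q q'} → p ≋ p' → q ≋ q' → (p +P q) ≋ (p' +P q')
eval (+P-cong {p} {p'} {q} {q'} e e') L r = trans (⟦+⟧ p q)
  (trans (cong₂ ℤ._+_ (eval e L r) (eval e' L r)) (sym (⟦+⟧ p' q')))

*P-cong : ∀ {p p' q q'} → p ≋ p' → q ≋ q' → (p *P q) ≋ (p' *P q')
eval (*P-cong {p} {p'} {q} {q'} e e') L r = trans (⟦*⟧ p q)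
  (trans (⟦⟧-cong p (λ m → eval e' _ (Respects-prefix r m)))
  (trans (eval e _ (Respects-⟦⟧ q' (λ m' → Respects-suffix r m'))) (sym (⟦*⟧ p' q'))))

scaleP-cong : ∀ k {p q} → p ≋ q → scaleP k p ≋ scaleP k q
eval (scaleP-cong k {p} {q} e) L r = trans (⟦scale⟧ k p) (trans (cong (k ℤ.*_) (eval e L r)) (sym (⟦scale⟧ k q)))

*P-comm : ∀ p q → (p *P q) ≋ (q *P p)
eval (*P-comm p q) L r = trans (⟦*⟧ p q) (trans (⟦⟧-swap p q)
  (trans (⟦⟧-cong q (λ m' → ⟦⟧-cong p (λ m → perm r (↭ₚ.++-comm m m')))) (sym (⟦*⟧ q p))))

*P-assoc : ∀ p q s → ((p *P q) *P s) ≋ (p *P (q *P s))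
eval (*P-assoc p q s) L r = trans (⟦*⟧ (p *P q) s) (trans (⟦*⟧ p q) (trans
  (⟦⟧-cong p (λ m → trans (⟦⟧-cong q (λ m' → ⟦⟧-cong s (λ m'' → cong L (Listₚ.++-assoc m m' m'')))) (sym (⟦*⟧ q s))))
  (sym (⟦*⟧ p (q *P s)))))

*P-distribʳ : ∀ p q s → ((p +P q) *P s) ≋ (p *P s +P q *P s)
eval (*P-distribʳ p q s) L r = trans (⟦*⟧ (p +P q) s) (trans (⟦+⟧ p q) (sym
  (trans (⟦+⟧ (p *P s) (q *P s)) (cong₂ ℤ._+_ (⟦*⟧ p s) (⟦*⟧ q s)))))

*P-distribˡ : ∀ p q s → (p *P (q +P s)) ≋ (p *P q +P p *P s)
*P-distribˡ p q s = ≋-trans (*P-comm p _) (≋-trans (*P-distribʳ q s p) (+P-cong (*P-comm q p) (*P-comm s p)))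

*P-zeroʳ : ∀ p → (p *P 0P) ≋ 0P
*P-zeroʳ p = *P-comm p 0P

*P-scale : ∀ k p q → (p *P scaleP k q) ≋ scaleP k (p *P q)
eval (*P-scale k p q) L r = trans (⟦*⟧ p (scaleP k q)) (trans (⟦⟧-cong p (λ m → ⟦scale⟧ k q))
  (trans (⟦⟧-*-functional p k) (trans (cong (k ℤ.*_) (sym (⟦*⟧ p q))) (sym (⟦scale⟧ k (p *P q))))))

scale-*P : ∀ k p q → (scaleP k p *P q) ≋ scaleP k (p *P q)
scale-*P k p q = ≋-trans (*P-comm (scaleP k p) q) (≋-trans (*P-scale k q p) (scaleP-cong k (*P-comm q p)))

mono : Monomial → Poly
mono m = (+ 1 , m) ∷ []

⟦mono⟧ : ∀ m {L} → ⟦ mono m ⟧ L ≡ L m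
⟦mono⟧ m {L} = trans (ℤₚ.+-identityʳ _) (ℤₚ.*-identityˡ (L m))

⟦mono*⟧ : ∀ m q {L} → ⟦ mono m *P q ⟧ L ≡ ⟦ q ⟧ (λ m' → L (m ++ m'))
⟦mono*⟧ m q {L} = trans (⟦*⟧ (mono m) q) (⟦mono⟧ m {λ m₁ → ⟦ q ⟧ (λ m' → L (m₁ ++ m'))})

*P-identityˡ : ∀ p → (1P *P p) ≋ p
eval (*P-identityˡ p) L r = ⟦mono*⟧ [] p

*P-identityʳ : ∀ p → (p *P 1P) ≋ p
*P-identityʳ p = ≋-trans (*P-comm p 1P) (*P-identityˡ p)

-- Equality of coefficients

labelEq-refl : ∀ a → labelEq a a ≡ true
labelEq-refl ● = refl
labelEq-refl ○ = refl

labelEq-sound : ∀ a b → labelEq a b ≡ true → a ≡ b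
labelEq-sound ● ● _ = refl
labelEq-sound ○ ○ _ = refl

∧-true : ∀ {a b} → a ∧ b ≡ true → a ≡ true × b ≡ true
∧-true {true} {true} _ = refl , refl

wordEq-refl : ∀ S → wordEq S S ≡ true
wordEq-refl [] = refl
wordEq-refl (a ∷ S) rewrite labelEq-refl a = wordEq-refl S

wordEq-sound : ∀ S U → wordEq S U ≡ true → S ≡ U
wordEq-sound [] [] _ = refl
wordEq-sound (a ∷ S) (b ∷ U) e with ∧-true {labelEq a b} e
... | e₁ , e₂ = cong₂ _∷_ (labelEq-sound a b e₁) (wordEq-sound S U e₂)

≡ᵇ-refl : ∀ n → (n ≡ᵇ n) ≡ true
≡ᵇ-refl zero = refl
≡ᵇ-refl (suc n) = ≡ᵇ-refl n

≡ᵇ-sound : ∀ m n → (m ≡ᵇ n) ≡ true → m ≡ n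
≡ᵇ-sound zero zero _ = refl
≡ᵇ-sound (suc m) (suc n) e = cong suc (≡ᵇ-sound m n e)

≢⇒≡ᵇ : ∀ {m n} → m ≢ n → (m ≡ᵇ n) ≡ false
≢⇒≡ᵇ {m} {n} m≢n with m ≡ᵇ n in e
... | true  = ⊥-elim (m≢n (≡ᵇ-sound m n e))
... | false = refl

-- Rotation of words and the relation decided by `cyclicEq`.

Rotation : List A → List A → Set
Rotation xs ys = ∃[ u ] ∃[ v ] (xs ≡ u ++ v × ys ≡ v ++ u)

-- `cyclicEq` rejects the empty word even against itself, since `rotations []` is empty; hence the
-- demand for a first letter.
record Conjugate (S U : Word) : Set where
  constructor conjugate
  field
    {letter} : Label
    {rest} : Word
    nonempty : S ≡ letter ∷ rest
    rotation : Rotation S U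

++-split : (a b c d : List A) → a ++ b ≡ c ++ d →
           (∃[ t ] (a ≡ c ++ t × d ≡ t ++ b)) ⊎ (∃[ t ] (c ≡ a ++ t × b ≡ t ++ d))
++-split a b [] d e = inj₁ (a , refl , sym e)
++-split [] b (x ∷ c) d e = inj₂ (x ∷ c , refl , e)
++-split (x ∷ a) b (y ∷ c) d e with Listₚ.∷-injective e
... | refl , e' with ++-split a b c d e'
... | inj₁ (t , p , q) = inj₁ (t , cong (x ∷_) p , q)
... | inj₂ (t , p , q) = inj₂ (t , cong (x ∷_) p , q)

Rotation-sym : {xs ys : List A} → Rotation xs ys → Rotation ys xs
Rotation-sym (u , v , p , q) = v , u , q , p

-- The middle word is cut at two places; which cut comes first decides how the three pieces
-- recombine.
Rotation-trans : {xs ys zs : List A} → Rotation xs ys → Rotation ys zs → Rotation xs zs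
Rotation-trans (u , v , refl , e) (u' , v' , e' , refl) with ++-split v u u' v' (trans (sym e) e')
... | inj₁ (t , refl , refl) = u ++ u' , t , sym (Listₚ.++-assoc u u' t) , Listₚ.++-assoc t u u'
... | inj₂ (t , refl , refl) = t , v' ++ v , Listₚ.++-assoc t v' v , sym (Listₚ.++-assoc v' v t)

Rotation-nonempty : ∀ {a : A} {xs ys} → Rotation (a ∷ xs) ys → ∃[ b ] ∃[ zs ] ys ≡ b ∷ zs
Rotation-nonempty {a = a} {xs} ([] , v , refl , refl) = a , xs ++ [] , refl
Rotation-nonempty (x ∷ u , [] , refl , refl) = x , u , refl
Rotation-nonempty (x ∷ u , y ∷ v , refl , refl) = y , v ++ x ∷ u , refl

Conjugate-sym : ∀ {S U} → Conjugate S U → Conjugate U S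
Conjugate-sym (conjugate refl r) with Rotation-nonempty r
... | _ , _ , e = conjugate e (Rotation-sym r)

Conjugate-trans : ∀ {S U W} → Conjugate S U → Conjugate U W → Conjugate S W
Conjugate-trans (conjugate e r) (conjugate _ r') = conjugate e (Rotation-trans r r')

any-map-true : ∀ (P : B → Bool) (k : A → B) xs → any P (map k xs) ≡ true → ∃[ x ] (P (k x) ≡ true)
any-map-true P k (x ∷ xs) e with P (k x) in eq
... | true  = x , eq
... | false = any-map-true P k xs e

any-upTo : ∀ (P : ℕ → Bool) n i → i < n → P i ≡ true → any P (upTo n) ≡ true
any-upTo P n i i<n e = go id n i i<n e
  where
  go : ∀ (k : ℕ → ℕ) n i → i < n → P (k i) ≡ true → any P (applyUpTo k n) ≡ true
  go k (suc n) zero _ e rewrite e = refl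
  go k (suc n) (suc i) i<n e with P (k 0)
  ... | true  = refl
  ... | false = go (k ∘ suc) n i (s≤s⁻¹ i<n) e

any-map : ∀ (P : B → Bool) (k : A → B) xs → any P (map k xs) ≡ any (P ∘ k) xs
any-map P k [] = refl
any-map P k (x ∷ xs) = cong (P (k x) ∨_) (any-map P k xs)

take-++-length : (u v : List A) → take (length u) (u ++ v) ≡ u
take-++-length [] v = refl
take-++-length (x ∷ u) v = cong (x ∷_) (take-++-length u v)

drop-++-length : (u v : List A) → drop (length u) (u ++ v) ≡ v
drop-++-length [] v = refl
drop-++-length (x ∷ u) v = drop-++-length u v

cyclicEq-sound : ∀ S U → cyclicEq S U ≡ true → Conjugate S U
cyclicEq-sound [] U e with ∧-true {length {A = Label} [] ≡ᵇ length U} e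
... | _ , ()
cyclicEq-sound (a ∷ S) U e with any-map-true (wordEq U) (λ i → drop i (a ∷ S) ++ take i (a ∷ S)) (upTo (length (a ∷ S)))
                                  (proj₂ (∧-true {length (a ∷ S) ≡ᵇ length U} e))
... | i , e' = conjugate refl (take i (a ∷ S) , drop i (a ∷ S) , sym (Listₚ.take++drop≡id i (a ∷ S)) ,
  wordEq-sound U _ e')

private
  any-rotations : ∀ u a v → any (wordEq (a ∷ v ++ u)) (rotations (u ++ a ∷ v)) ≡ true
  any-rotations u a v = trans (any-map (wordEq (a ∷ v ++ u)) _ (upTo (length (u ++ a ∷ v))))
    (any-upTo _ (length (u ++ a ∷ v)) (length u) lt here)
    where
    lt : length u < length (u ++ a ∷ v)
    lt = subst (length u <_) (sym (Listₚ.length-++ u)) (ℕₚ.m<m+n (length u) (s≤s z≤n))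
    here : wordEq (a ∷ v ++ u) (drop (length u) (u ++ a ∷ v) ++ take (length u) (u ++ a ∷ v)) ≡ true
    here rewrite take-++-length u (a ∷ v) | drop-++-length u (a ∷ v) = wordEq-refl (a ∷ v ++ u)

private
  cyclicEq-swap : ∀ u a v → cyclicEq (u ++ a ∷ v) (a ∷ v ++ u) ≡ true
  cyclicEq-swap u a v
    rewrite any-rotations u a v
          | Listₚ.length-++ u {a ∷ v} | Listₚ.length-++ (a ∷ v) {u} | ℕₚ.+-comm (length u) (length (a ∷ v))
          | ≡ᵇ-refl (length v + length u) = refl

cyclicEq-complete : ∀ {S U} → Conjugate S U → cyclicEq S U ≡ true
cyclicEq-complete (conjugate ne (u , a ∷ v , refl , refl)) = cyclicEq-swap u a v
cyclicEq-complete (conjugate {a} {S} ne (u , [] , refl , refl))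
  with trans (sym ne) (Listₚ.++-identityʳ u)
... | refl = subst₂ (λ S' U → cyclicEq S' U ≡ true) (sym (Listₚ.++-identityʳ (a ∷ S)))
  (Listₚ.++-identityʳ (a ∷ S)) (cyclicEq-swap [] a S)

Bool-ext : ∀ {a b} → (a ≡ true → b ≡ true) → (b ≡ true → a ≡ true) → a ≡ b
Bool-ext {true} {b} p q = sym (p refl)
Bool-ext {false} {true} p q = q refl
Bool-ext {false} {false} p q = refl

-- `varEq` is not reflexive at `f []`, so two letters that match a common third one are compared as
-- tests. In this form a greedy matching can exchange them.
varEq-left : ∀ x y z → varEq x z ≡ true → varEq y z ≡ true → varEq x ≗ varEq y
varEq-left w w w _ _ t = refl
varEq-left (g S) (g U) (g W) p q t with wordEq-sound S W p | wordEq-sound U W q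
... | refl | refl = refl
varEq-left (f S) (f U) (f W) p q w = refl
varEq-left (f S) (f U) (f W) p q (g _) = refl
varEq-left (f S) (f U) (f W) p q (f V) = Bool-ext
  (λ r → cyclicEq-complete (Conjugate-trans U∼S (cyclicEq-sound S V r)))
  (λ r → cyclicEq-complete (Conjugate-trans (Conjugate-sym U∼S) (cyclicEq-sound U V r)))
  where
  U∼S : Conjugate U S
  U∼S = Conjugate-trans (cyclicEq-sound U W q) (Conjugate-sym (cyclicEq-sound S W p))

rotate-letter : ∀ u v t → varEq (f (u ++ v)) t ≡ varEq (f (v ++ u)) t
rotate-letter u v w = refl
rotate-letter u v (g _) = refl
rotate-letter [] v (f V) rewrite Listₚ.++-identityʳ v = refl
rotate-letter (a ∷ u) v (f V) = Bool-ext
  (λ r → cyclicEq-complete (Conjugate-trans (Conjugate-sym r₀) (cyclicEq-sound _ V r)))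
  (λ r → cyclicEq-complete (Conjugate-trans r₀ (cyclicEq-sound _ V r)))
  where
  r₀ : Conjugate (a ∷ u ++ v) (v ++ a ∷ u)
  r₀ = conjugate refl (a ∷ u , v , refl , refl)

-- Independence of `monoEq` from the order of the letters.

removeOne-cong : ∀ {x y} → varEq x ≗ varEq y → ∀ m → removeOne varEq x m ≡ removeOne varEq y m
removeOne-cong e [] = refl
removeOne-cong {x} {y} e (z ∷ m) with varEq x z | varEq y z | e z
... | true  | true  | refl = refl
... | false | false | refl with removeOne varEq x m | removeOne varEq y m | removeOne-cong {x} {y} e m
... | _ | _ | refl = refl

thenRemove : Var → Bool × Monomial → Bool × Monomial
thenRemove y (true , m) = removeOne varEq y m
thenRemove y (false , m) = false , []

-- After a failure the remaining list carries no meaning: `removeOne` then returns the whole list,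
-- `thenRemove` the empty one.
Agree : Bool × Monomial → Bool × Monomial → Set
Agree (true , m) (true , m') = m ≡ m'
Agree (false , _) (false , _) = ⊤
Agree _ _ = ⊥

private
  cons : Var → Bool × Monomial → Bool × Monomial
  cons z (b , m) = b , z ∷ m

  cons-removeOne : ∀ x z m → varEq x z ≡ false → removeOne varEq x (z ∷ m) ≡ cons z (removeOne varEq x m)
  cons-removeOne x z m e rewrite e = refl

  hit-removeOne : ∀ x z m → varEq x z ≡ true → removeOne varEq x (z ∷ m) ≡ (true , m)
  hit-removeOne x z m e rewrite e = refl

  Agree-sym : ∀ p q → Agree p q → Agree q p
  Agree-sym (true , _) (true , _) refl = refl
  Agree-sym (false , _) (false , _) _ = tt

  Agree-refl : ∀ p → Agree p p
  Agree-refl (true , _) = refl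
  Agree-refl (false , _) = tt

  cons-thenRemove : ∀ y z p → varEq y z ≡ false → Agree (thenRemove y (cons z p)) (cons z (thenRemove y p))
  cons-thenRemove y z (true , m) e rewrite cons-removeOne y z m e = Agree-refl (cons z (removeOne varEq y m))
  cons-thenRemove y z (false , m) e = tt

  Agree-cons : ∀ z p q → Agree p q → Agree (cons z p) (cons z q)
  Agree-cons z (true , _) (true , _) refl = refl
  Agree-cons z (false , _) (false , _) _ = tt

  Agree-trans : ∀ p q s → Agree p q → Agree q s → Agree p s
  Agree-trans (true , _) (true , _) (true , _) refl refl = refl
  Agree-trans (false , _) (false , _) (false , _) _ _ = tt

  mixed : ∀ x y z m → varEq x z ≡ true → varEq y z ≡ false →
           Agree (thenRemove y (removeOne varEq x (z ∷ m))) (thenRemove x (removeOne varEq y (z ∷ m)))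
  mixed x y z m e e' rewrite hit-removeOne x z m e | cons-removeOne y z m e' with removeOne varEq y m
  ... | true , m' rewrite hit-removeOne x z m' e = refl
  ... | false , m' = tt

-- The critical case is a letter `z` matched by both `x` and `y`. Whichever comes first takes `z`,
-- and by `varEq-left` the other then removes from `m` what its rival would have removed.
removeOne-comm : ∀ x y m → Agree (thenRemove y (removeOne varEq x m)) (thenRemove x (removeOne varEq y m))
removeOne-comm x y [] = tt
removeOne-comm x y (z ∷ m) = go (varEq x z) (varEq y z) refl refl
  where
  goal : Set
  goal = Agree (thenRemove y (removeOne varEq x (z ∷ m))) (thenRemove x (removeOne varEq y (z ∷ m)))
  go : ∀ b b' → varEq x z ≡ b → varEq y z ≡ b' → goal
  go true true e e' rewrite hit-removeOne x z m e | hit-removeOne y z m e'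
    | removeOne-cong {x} {y} (varEq-left x y z e e') m = Agree-refl (removeOne varEq y m)
  go true false e e' = mixed x y z m e e'
  go false true e e' = Agree-sym (thenRemove x (removeOne varEq y (z ∷ m))) (thenRemove y (removeOne varEq x (z ∷ m)))
    (mixed y x z m e' e)
  go false false e e' rewrite cons-removeOne x z m e | cons-removeOne y z m e' =
    Agree-trans (thenRemove y (cons z (removeOne varEq x m))) (cons z (thenRemove y (removeOne varEq x m)))
                (thenRemove x (cons z (removeOne varEq y m)))
      (cons-thenRemove y z (removeOne varEq x m) e')
      (Agree-trans (cons z (thenRemove y (removeOne varEq x m))) (cons z (thenRemove x (removeOne varEq y m)))
                   (thenRemove x (cons z (removeOne varEq y m)))
        (Agree-cons z (thenRemove y (removeOne varEq x m)) (thenRemove x (removeOne varEq y m)) (removeOne-comm x y m))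
        (Agree-sym (thenRemove x (cons z (removeOne varEq y m))) (cons z (thenRemove x (removeOne varEq y m)))
          (cons-thenRemove x z (removeOne varEq y m) e)))

matchRest : Monomial → Bool × Monomial → Bool
matchRest m (true , k) = monoEq m k
matchRest m (false , _) = false

monoEq-∷ : ∀ x m k → monoEq (x ∷ m) k ≡ matchRest m (removeOne varEq x k)
monoEq-∷ x m k with removeOne varEq x k
... | true , _ = refl
... | false , _ = refl

monoEq-∷∷ : ∀ x y m k → monoEq (x ∷ y ∷ m) k ≡ matchRest m (thenRemove y (removeOne varEq x k))
monoEq-∷∷ x y m k with removeOne varEq x k
... | true , k' = monoEq-∷ y m k'
... | false , _ = refl

matchRest-Agree : ∀ m p q → Agree p q → matchRest m p ≡ matchRest m q
matchRest-Agree m (true , _) (true , _) refl = refl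
matchRest-Agree m (false , _) (false , _) _ = refl

matchRest-cong : ∀ {m m'} → (∀ k → monoEq m k ≡ monoEq m' k) → ∀ p → matchRest m p ≡ matchRest m' p
matchRest-cong e (true , k) = e k
matchRest-cong e (false , _) = refl

-- Two consecutive greedy removals commute, so adjacent letters may be exchanged.
monoEq-↭ : ∀ {m m'} → m ↭ m' → ∀ k → monoEq m k ≡ monoEq m' k
monoEq-↭ ↭.refl k = refl
monoEq-↭ (prep {xs} {ys} x p) k = trans (monoEq-∷ x xs k)
  (trans (matchRest-cong (monoEq-↭ p) (removeOne varEq x k)) (sym (monoEq-∷ x ys k)))
monoEq-↭ (swap {xs} {ys} x y p) k = trans (monoEq-∷∷ x y xs k)
  (trans (matchRest-cong (monoEq-↭ p) (thenRemove y (removeOne varEq x k)))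
  (trans (matchRest-Agree ys _ _ (removeOne-comm x y k)) (sym (monoEq-∷∷ y x ys k))))
monoEq-↭ (↭.trans p q) k = trans (monoEq-↭ p k) (monoEq-↭ q k)

monoEq-rotate : ∀ u v m k → monoEq (f (u ++ v) ∷ m) k ≡ monoEq (f (v ++ u) ∷ m) k
monoEq-rotate u v m k = trans (monoEq-∷ (f (u ++ v)) m k)
  (trans (cong (matchRest m) (removeOne-cong (rotate-letter u v) k)) (sym (monoEq-∷ (f (v ++ u)) m k)))

coefficientAt : Monomial → Functional
coefficientAt k m = if monoEq m k then + 1 else + 0

coefficientAt-Respects : ∀ k → Respects (coefficientAt k)
perm (coefficientAt-Respects k) p rewrite monoEq-↭ p k = refl
rot (coefficientAt-Respects k) u v m rewrite monoEq-rotate u v m k = refl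

coeff-⟦⟧ : ∀ p k → coeff p k ≡ ⟦ p ⟧ (coefficientAt k)
coeff-⟦⟧ [] k = refl
coeff-⟦⟧ ((c , m) ∷ p) k = cong₂ ℤ._+_ (indicator (monoEq m k)) (coeff-⟦⟧ p k)
  where
  indicator : ∀ b → (if b then c else + 0) ≡ c ℤ.* (if b then + 1 else + 0)
  indicator true = sym (ℤₚ.*-identityʳ c)
  indicator false = sym (ℤₚ.*-zeroʳ c)

≋⇒≈P : ∀ {p q} → p ≋ q → p ≈P q
≋⇒≈P {p} {q} e k = trans (coeff-⟦⟧ p k)
  (trans (eval e (coefficientAt k) (coefficientAt-Respects k)) (sym (coeff-⟦⟧ q k)))

-- The derivation C″

-- The transpose of `C''` under evaluation, as `⟦C''⟧` shows. On this side the compatibility of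
-- `C''` with `≋` reduces to `∂-Respects`.
∂ : Functional → Functional
∂ L [] = + 0
∂ L (v ∷ m) = ⟦ C''var v ⟧ (λ t → L (t ++ m)) ℤ.+ ∂ (λ m' → L (v ∷ m')) m

∂-cong : ∀ {L L'} → L ≗ L' → ∂ L ≗ ∂ L'
∂-cong e [] = refl
∂-cong e (v ∷ m) = cong₂ ℤ._+_ (⟦⟧-cong (C''var v) (λ t → e (t ++ m))) (∂-cong (λ m' → e (v ∷ m')) m)

⟦C''mono⟧ : ∀ c pre m {L} → ⟦ C''mono c pre m ⟧ L ≡ c ℤ.* ∂ (λ m' → L (pre ++ m')) m
⟦C''mono⟧ c pre [] = sym (ℤₚ.*-zeroʳ c)
⟦C''mono⟧ c pre (v ∷ m) {L} = trans (⟦+⟧ (map _ (C''var v)) (C''mono c (pre ++ v ∷ []) m))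
  (trans (cong₂ ℤ._+_ head tail) (sym (ℤₚ.*-distribˡ-+ c (⟦ C''var v ⟧ (λ t → L (pre ++ t ++ m))) _)))
  where
  head : ⟦ map (λ t → c ℤ.* proj₁ t , pre ++ proj₂ t ++ m) (C''var v) ⟧ L ≡ c ℤ.* ⟦ C''var v ⟧ (λ t → L (pre ++ t ++ m))
  head = trans (∑-map _ (C''var v)) (trans (∑-cong (C''var v)
    (λ t → ℤₚ.*-assoc c (proj₁ t) (L (pre ++ proj₂ t ++ m)))) (∑-*ˡ c (C''var v)))
  tail : ⟦ C''mono c (pre ++ v ∷ []) m ⟧ L ≡ c ℤ.* ∂ (λ m' → L (pre ++ v ∷ m')) m
  tail = trans (⟦C''mono⟧ c (pre ++ v ∷ []) m) (cong (c ℤ.*_)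
    (∂-cong (λ m' → cong L (Listₚ.++-assoc pre (v ∷ []) m')) m))

⟦C''⟧ : ∀ p {L} → ⟦ C'' p ⟧ L ≡ ⟦ p ⟧ (∂ L)
⟦C''⟧ p = trans (∑-concatMap _ p) (∑-cong p (λ t → ⟦C''mono⟧ (proj₁ t) [] (proj₂ t)))

∂-↭ : ∀ {L} → Respects L → ∀ {m m'} → m ↭ m' → ∂ L m ≡ ∂ L m'
∂-↭ r ↭.refl = refl
∂-↭ r (prep x p) = cong₂ ℤ._+_ (⟦⟧-cong (C''var x) (λ t → perm r (↭ₚ.++⁺ˡ t p))) (∂-↭ (Respects-prefix r (x ∷ [])) p)
∂-↭ {L} r (swap {xs} {ys} x y p) = trans (rotate₃ dx dy (∂ _ xs))
  (cong₂ ℤ._+_ (⟦⟧-cong (C''var y) (λ t → perm r (↭-trans (prep x (↭ₚ.++⁺ˡ t p)) (↭-sym (↭ₚ.shift x t ys)))))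
  (cong₂ ℤ._+_ (⟦⟧-cong (C''var x) (λ t → perm r (↭-trans (↭ₚ.shift y t xs) (prep y (↭ₚ.++⁺ˡ t p)))))
  (trans (∂-↭ (Respects-prefix r (x ∷ y ∷ [])) p) (∂-cong (λ m' → perm r (swap x y ↭-refl)) ys))))
  where
  dx dy : ℤ
  dx = ⟦ C''var x ⟧ (λ t → L (t ++ y ∷ xs))
  dy = ⟦ C''var y ⟧ (λ t → L (x ∷ t ++ xs))
∂-↭ r (↭.trans p q) = trans (∂-↭ r p) (∂-↭ r q)

∂-Respects : ∀ {L} → Respects L → Respects (∂ L)
perm (∂-Respects r) = ∂-↭ r
-- The leading letter is an `f`, which the derivation kills, so the rotation is passed on to the
-- derivatives of the other letters.
rot (∂-Respects r) u v m = cong (λ z → + 0 ℤ.+ z) (∂-cong (rot r u v) m)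

C''-cong : ∀ {p q} → p ≋ q → C'' p ≋ C'' q
eval (C''-cong {p} {q} e) L r = trans (⟦C''⟧ p) (trans (eval e (∂ L) (∂-Respects r)) (sym (⟦C''⟧ q)))

C''-+ : ∀ p q → C'' (p +P q) ≋ (C'' p +P C'' q)
eval (C''-+ p q) L r = trans (⟦C''⟧ (p +P q)) (trans (⟦+⟧ p q)
  (sym (trans (⟦+⟧ (C'' p) (C'' q)) (cong₂ ℤ._+_ (⟦C''⟧ p) (⟦C''⟧ q)))))

C''-scale : ∀ k p → C'' (scaleP k p) ≋ scaleP k (C'' p)
eval (C''-scale k p) L r = trans (⟦C''⟧ (scaleP k p)) (trans (⟦scale⟧ k p)
  (sym (trans (⟦scale⟧ k (C'' p)) (cong (k ℤ.*_) (⟦C''⟧ p)))))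

-- Phrased as commutation of `C''` with multiplication by `p`, so that sums, products and powers of
-- constants need no product rule.
Constant : Poly → Set
Constant p = ∀ t → C'' (p *P t) ≋ (p *P C'' t)

Constant-letter : ∀ v → C''var v ≡ [] → Constant (varP v)
eval (Constant-letter v e t) L r = trans (⟦C''⟧ (varP v *P t)) (trans (⟦mono*⟧ (v ∷ []) t)
  (trans (⟦⟧-cong t (λ m → trans (cong (λ p → ⟦ p ⟧ (λ t' → L (t' ++ m)) ℤ.+ ∂ (λ m' → L (v ∷ m')) m) e)
                                 (ℤₚ.+-identityˡ _)))
  (trans (sym (⟦C''⟧ t)) (sym (⟦mono*⟧ (v ∷ []) (C'' t))))))

Constant-0 : Constant 0P
Constant-0 t = ≋-refl

Constant-1 : Constant 1P
Constant-1 t = ≋-trans (C''-cong (*P-identityˡ t)) (≋-sym (*P-identityˡ (C'' t)))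

Constant-+ : ∀ {p q} → Constant p → Constant q → Constant (p +P q)
Constant-+ {p} {q} cp cq t = ≋-trans (C''-cong (*P-distribʳ p q t)) (≋-trans (C''-+ (p *P t) (q *P t))
  (≋-trans (+P-cong (cp t) (cq t)) (≋-sym (*P-distribʳ p q (C'' t)))))

Constant-* : ∀ {p q} → Constant p → Constant q → Constant (p *P q)
Constant-* {p} {q} cp cq t = ≋-trans (C''-cong (*P-assoc p q t)) (≋-trans (cp (q *P t))
  (≋-trans (*P-cong (≋-refl {p}) (cq t)) (≋-sym (*P-assoc p q (C'' t)))))

Constant-^ : ∀ {p} → Constant p → ∀ n → Constant (p ^P n)
Constant-^ cp zero = Constant-1
Constant-^ {p} cp (suc n) = Constant-* {p} cp (Constant-^ cp n)

Constant-scale : ∀ {p} k → Constant p → Constant (scaleP k p)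
Constant-scale {p} k cp t = ≋-trans (C''-cong (scale-*P k p t)) (≋-trans (C''-scale k (p *P t))
  (≋-trans (scaleP-cong k (cp t)) (≋-sym (scale-*P k p (C'' t)))))

Constant-f : ∀ S → Constant (fP S)
Constant-f S = Constant-letter (f S) refl

Constant-w : Constant wP
Constant-w = Constant-letter w refl

-- u c is the coefficient of v^c/c! in the solution of (∂/∂v − C″) u = j, u|_{v=0} = 0.
record Solves (u j : ℕ → Poly) : Set where
  constructor solves
  field
    at-zero    : u 0 ≋ 0P
    recurrence : ∀ c → u (suc c) ≋ (C'' (u c) +P j c)
open Solves

Solves-τ : ∀ R S → Solves (tauCoeff R S) (λ c → varP (g (● ∷ R)) *P phiCoeff (map xOf S) c)
Solves-τ R S = solves ≋-refl (λ c → ≋-refl)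

+P-interchange : ∀ a b c d → ((a +P b) +P (c +P d)) ≋ ((a +P c) +P (b +P d))
eval (+P-interchange a b c d) L r = trans (⟦+⟧ (a +P b) (c +P d)) (trans (cong₂ ℤ._+_ (⟦+⟧ a b) (⟦+⟧ c d))
  (trans (interchange (⟦ a ⟧ L) (⟦ b ⟧ L) (⟦ c ⟧ L) (⟦ d ⟧ L))
  (sym (trans (⟦+⟧ (a +P c) (b +P d)) (cong₂ ℤ._+_ (⟦+⟧ a c) (⟦+⟧ b d))))))

Solves-+ : ∀ {u u' j j'} → Solves u j → Solves u' j' → Solves (λ c → u c +P u' c) (λ c → j c +P j' c)
at-zero (Solves-+ s s') = +P-cong (at-zero s) (at-zero s')
recurrence (Solves-+ {u} {u'} {j} {j'} s s') c = ≋-trans (+P-cong (recurrence s c) (recurrence s' c))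
  (≋-trans (+P-interchange (C'' (u c)) (j c) (C'' (u' c)) (j' c))
  (+P-cong (≋-sym (C''-+ (u c) (u' c))) (≋-refl {j c +P j' c})))

Solves-*ˡ : ∀ {u j} p → Constant p → Solves u j → Solves (λ c → p *P u c) (λ c → p *P j c)
at-zero (Solves-*ˡ p cp s) = ≋-trans (*P-cong (≋-refl {p}) (at-zero s)) (*P-zeroʳ p)
recurrence (Solves-*ˡ {u} {j} p cp s) c = ≋-trans (*P-cong (≋-refl {p}) (recurrence s c))
  (≋-trans (*P-distribˡ p (C'' (u c)) (j c)) (+P-cong (≋-sym (cp (u c))) (≋-refl {p *P j c})))

Solves-cong : ∀ {u u' j j'} → (∀ c → u c ≋ u' c) → (∀ c → j c ≋ j' c) → Solves u j → Solves u' j'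
at-zero (Solves-cong e e' s) = ≋-trans (≋-sym (e 0)) (at-zero s)
recurrence (Solves-cong e e' s) c = ≋-trans (≋-sym (e (suc c)))
  (≋-trans (recurrence s c) (+P-cong (C''-cong (e c)) (e' c)))

Solves-*ʳ : ∀ {u j} p → Constant p → Solves u j → Solves (λ c → u c *P p) (λ c → j c *P p)
Solves-*ʳ {u} {j} p cp s = Solves-cong (λ c → *P-comm p (u c)) (λ c → *P-comm p (j c)) (Solves-*ˡ p cp s)

Solves-scale : ∀ {u j} k → Solves u j → Solves (λ c → scaleP k (u c)) (λ c → scaleP k (j c))
at-zero (Solves-scale k s) = scaleP-cong k (at-zero s)
recurrence (Solves-scale {u} {j} k s) c = ≋-trans (scaleP-cong k (recurrence s c))
  (≋-trans (scale-+ k (C'' (u c)) (j c)) (+P-cong (≋-sym (C''-scale k (u c))) (≋-refl {scaleP k (j c)})))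
  where
  scale-+ : ∀ k p q → scaleP k (p +P q) ≋ (scaleP k p +P scaleP k q)
  scale-+ k p q = ≋-reflexive (Listₚ.map-++ _ p q)

-- C″ on the letter g_R, as a sum over the positions in R

Split : Set → Set
Split A = List A × A × List A

prepend : A → Split A → Split A
prepend x (us , c , vs) = x ∷ us , c , vs

splits : List A → List (Split A)
splits [] = []
splits (x ∷ xs) = ([] , x , xs) ∷ map (prepend x) (splits xs)

∑-splits : (xs : List A) {φ : A → ℤ} → ∑ (splits xs) (λ (us , c , vs) → φ c) ≡ ∑ xs φ
∑-splits [] = refl
∑-splits (x ∷ xs) {φ} = cong (ℤ._+_ (φ x)) (trans (∑-map (prepend x) (splits xs)) (∑-splits xs))

splits-++ : (xs : List A) → All (λ (us , c , vs) → us ++ c ∷ vs ≡ xs) (splits xs)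
splits-++ [] = []
splits-++ (x ∷ xs) = refl ∷ Allₚ.map⁺ (All.map (cong (x ∷_)) (splits-++ xs))

∑-splits-map : (k : A → B) (xs : List A) {φ : Split B → ℤ} →
               ∑ (splits (map k xs)) φ ≡ ∑ (splits xs) (λ (us , c , vs) → φ (map k us , k c , map k vs))
∑-splits-map k [] = refl
∑-splits-map k (x ∷ xs) {φ} = cong (ℤ._+_ (φ ([] , k x , map k xs))) (trans (∑-map _ (splits (map k xs)))
  (trans (∑-splits-map k xs) (sym (∑-map _ (splits xs)))))

-- The value 0 at an empty remainder matches the `0P` clause of `C''term`.
atDrop : (List A → A → List A → ℤ) → List A → List A → ℤ
atDrop φ us [] = + 0
atDrop φ us (c ∷ vs) = φ us c vs

∑-take-drop : (xs : List A) (φ : List A → A → List A → ℤ) →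
              ∑ (upTo (length xs)) (λ j → atDrop φ (take j xs) (drop j xs)) ≡ ∑ (splits xs)
                (λ (us , c , vs) → φ us c vs)
∑-take-drop [] φ = refl
∑-take-drop (x ∷ xs) φ = trans (∑-upTo-suc (length xs) (λ j → atDrop φ (take j (x ∷ xs)) (drop j (x ∷ xs))))
  (cong (ℤ._+_ (φ [] x xs))
  (trans (trans (∑-cong (upTo (length xs)) (λ j → shift-head (take j xs) (drop j xs)))
    (∑-take-drop xs (λ us → φ (x ∷ us))))
         (sym (∑-map _ (splits xs)))))
  where
  shift-head : ∀ us vs → atDrop φ (x ∷ us) vs ≡ atDrop (λ us → φ (x ∷ us)) us vs
  shift-head us [] = refl
  shift-head us (_ ∷ _) = refl

take-suc-drop : ∀ j (xs : List A) c vs → drop j xs ≡ c ∷ vs → take (suc j) xs ≡ take j xs ++ c ∷ []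
take-suc-drop zero (x ∷ xs) c vs refl = refl
take-suc-drop (suc j) (x ∷ xs) c vs e = cong (x ∷_) (take-suc-drop j xs c vs e)

-- Here `r` is the label of the root corner and `c` that of the corner receiving an edge. The root
-- face keeps `r`, one half of `c` and `vs`; `us` and the other half of `c` bound the new face;
-- `wIf c` records a new d-edge.
cutMonomial : Label → Word → Label → Word → Monomial
cutMonomial r us c vs = wIf c ++ (g (r ∷ c ∷ vs) ∷ f (us ++ c ∷ []) ∷ [])

⟦C''term⟧ : ∀ r rs j {K} → ⟦ C''term r rs (suc j) ⟧ K ≡ atDrop (λ us c vs → K (cutMonomial r us c vs)) (take j rs)
  (drop j rs)
⟦C''term⟧ r rs j {K} with drop j rs in e
... | [] = refl
... | c ∷ vs = trans (⟦mono⟧ (wIf c ++ (g (r ∷ c ∷ vs) ∷ f (take (suc j) rs) ∷ [])) {K})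
  (cong (λ S → K (wIf c ++ (g (r ∷ c ∷ vs) ∷ f S ∷ []))) (take-suc-drop j rs c vs e))

-- The splits of `rs` are the cuts at corners other than the root corner; the separate last term is
-- the cut at the root corner itself.
⟦C''g⟧ : ∀ r rs {K} → ⟦ C''g (r ∷ rs) ⟧ K ≡
         ∑ (splits rs) (λ (us , c , vs) → K (cutMonomial r us c vs)) ℤ.+ K (w ∷ g (r ∷ []) ∷ f (r ∷ rs) ∷ [])
⟦C''g⟧ r rs {K} = trans (⟦+⟧ (sumP (map (C''term r rs) (oneTo (length rs)))) (mono last))
  (cong₂ ℤ._+_
    (trans (∑-concatMap (C''term r rs) (oneTo (length rs)))
    (trans (∑-map suc (upTo (length rs)))
    (trans (∑-cong (upTo (length rs)) (λ j → ⟦C''term⟧ r rs j)) (∑-take-drop rs _))))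
    (⟦mono⟧ last {K}))
  where
  last : Monomial
  last = w ∷ g (r ∷ []) ∷ f (r ∷ rs) ∷ []

∂-f : ∀ {L} Λ → ∂ L (map f Λ) ≡ + 0
∂-f [] = refl
∂-f (S ∷ Λ) = trans (ℤₚ.+-identityˡ _) (∂-f Λ)

∂-weight : ∀ {L} n R Λ → ∂ L (replicate n w ++ (g R ∷ map f Λ)) ≡ ⟦ C''g R ⟧ (λ t → L (replicate n w ++ (t ++ map f Λ)))
∂-weight {L} zero R Λ = trans (cong (λ z → ⟦ C''g R ⟧ (λ t → L (t ++ map f Λ)) ℤ.+ z) (∂-f Λ)) (ℤₚ.+-identityʳ _)
∂-weight (suc n) R Λ = trans (ℤₚ.+-identityˡ _) (∂-weight n R Λ)

-- Insertion of an edge at the last position around the non-root vertex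

-- When add c inserts an edge, the old edges are renumbered by punchIn (suc c) and the old corners by
-- punchIn c, corner c being split into c and suc c.
punchIn : ℕ → ℕ → ℕ
punchIn zero k = suc k
punchIn (suc c) zero = zero
punchIn (suc c) (suc k) = suc (punchIn c k)

punchIn-≡ᵇ : ∀ c x y → (punchIn c x ≡ᵇ punchIn c y) ≡ (x ≡ᵇ y)
punchIn-≡ᵇ zero x y = refl
punchIn-≡ᵇ (suc c) zero zero = refl
punchIn-≡ᵇ (suc c) zero (suc y) = refl
punchIn-≡ᵇ (suc c) (suc x) zero = refl
punchIn-≡ᵇ (suc c) (suc x) (suc y) = punchIn-≡ᵇ c x y

punchIn-<ᵇ : ∀ c x y → (punchIn c x <ᵇ punchIn c y) ≡ (x <ᵇ y)
punchIn-<ᵇ zero x y = refl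
punchIn-<ᵇ (suc c) zero zero = refl
punchIn-<ᵇ (suc c) zero (suc y) = refl
punchIn-<ᵇ (suc c) (suc x) zero = refl
punchIn-<ᵇ (suc c) (suc x) (suc y) = punchIn-<ᵇ c x y

punchIn-≢ᵇ : ∀ c x → (punchIn c x ≡ᵇ c) ≡ false
punchIn-≢ᵇ zero x = refl
punchIn-≢ᵇ (suc c) zero = refl
punchIn-≢ᵇ (suc c) (suc x) = punchIn-≢ᵇ c x

punchIn-≥ : ∀ {c k} → c ≤ k → punchIn c k ≡ suc k
punchIn-≥ {zero} _ = refl
punchIn-≥ {suc c} {suc k} (s≤s le) = cong suc (punchIn-≥ le)

punchIn-< : ∀ {c k} → k < c → punchIn c k ≡ k
punchIn-< {suc c} {zero} _ = refl
punchIn-< {suc c} {suc k} (s≤s lt) = cong suc (punchIn-< lt)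

punchIn-suc-self : ∀ c → punchIn (suc c) c ≡ c
punchIn-suc-self c = punchIn-< (ℕₚ.n<1+n c)

punchIn-self : ∀ c → punchIn c c ≡ suc c
punchIn-self c = punchIn-≥ ℕₚ.≤-refl

punchIn-suc-≢ : ∀ c k → k ≢ c → punchIn (suc c) k ≡ punchIn c k
punchIn-suc-≢ zero zero ne = ⊥-elim (ne refl)
punchIn-suc-≢ zero (suc k) ne = refl
punchIn-suc-≢ (suc c) zero ne = refl
punchIn-suc-≢ (suc c) (suc k) ne = cong suc (punchIn-suc-≢ c k (ne ∘ cong suc))

upTo-suc : ∀ m → upTo (suc m) ≡ 0 ∷ map suc (upTo m)
upTo-suc m = cong (0 ∷_) (sym (Listₚ.map-upTo suc m))

map-punchIn-suc : ∀ c xs → map (punchIn (suc c)) (map suc xs) ≡ map suc (map (punchIn c) xs)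
map-punchIn-suc c xs = trans (sym (Listₚ.map-∘ xs)) (Listₚ.map-∘ xs)

upTo-punchIn : ∀ {m c} → c ≤ m → c ∷ map (punchIn c) (upTo m) ↭ upTo (suc m)
upTo-punchIn {m} {zero} _ = ↭-reflexive (sym (upTo-suc m))
upTo-punchIn {suc m} {suc c} (s≤s le) =
  ↭-trans (↭-reflexive (cong (λ l → suc c ∷ map (punchIn (suc c)) l) (upTo-suc m)))
  (↭-trans (swap (suc c) 0 (↭-reflexive (map-punchIn-suc c (upTo m))))
  (↭-trans (prep 0 (↭ₚ.map⁺ suc (upTo-punchIn le))) (↭-reflexive (sym (upTo-suc (suc m))))))

oneTo-punchIn : ∀ {m c} → c ≤ m → suc c ∷ map (punchIn (suc c)) (oneTo m) ↭ oneTo (suc m)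
oneTo-punchIn {m} {c} le = ↭-trans (prep (suc c) (↭-reflexive (map-punchIn-suc c (upTo m))))
  (↭ₚ.map⁺ suc (upTo-punchIn le))

-- An edge entering corner `c` of the root vertex becomes edge `suc c` there; standing last in the
-- list, it cyclically precedes the root edge at the other vertex.
add : ℕ → Dipole → Dipole
add c D = map (punchIn (suc c)) D ++ suc c ∷ []

-- dips m lists the dipoles with m + 1 edges.
dips : ℕ → List Dipole
dips zero = (0 ∷ []) ∷ []
dips (suc m) = concatMap (λ D → map (λ c → add c D) (upTo (suc m))) (dips m)

∑-insertAll-last : ∀ (x c : A) q (φ : List A → ℤ) →
  ∑ (insertAll x (q ++ c ∷ [])) φ ≡ ∑ (insertAll x q) (λ q' → φ (q' ++ c ∷ [])) ℤ.+ φ ((q ++ c ∷ []) ++ x ∷ [])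
∑-insertAll-last x c [] φ = cong₂ ℤ._+_ (sym (ℤₚ.+-identityʳ (φ (x ∷ c ∷ [])))) (ℤₚ.+-identityʳ (φ (c ∷ x ∷ [])))
∑-insertAll-last x c (y ∷ q) φ = trans (cong (ℤ._+_ (φ (x ∷ y ∷ q ++ c ∷ [])))
    (trans (∑-map (y ∷_) (insertAll x (q ++ c ∷ [])))
    (trans (∑-insertAll-last x c q (φ ∘ (y ∷_))) (cong (λ z → z ℤ.+ φ (y ∷ (q ++ c ∷ []) ++ x ∷ []))
      (sym (∑-map (y ∷_) (insertAll x q)))))))
  (sym (ℤₚ.+-assoc (φ (x ∷ y ∷ q ++ c ∷ [])) _ (φ (y ∷ (q ++ c ∷ []) ++ x ∷ []))))

-- perms grows a permutation by inserting the first element; here it is split by its last entry instead.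
∑-perms-last : ∀ (x : A) xs (φ : List A → ℤ) →
  ∑ (perms (x ∷ xs)) φ ≡ ∑ (splits (x ∷ xs)) (λ (us , c , vs) → ∑ (perms (us ++ vs)) (λ q → φ (q ++ c ∷ [])))
∑-perms-last x [] φ = sym (ℤₚ.+-identityʳ _)
∑-perms-last {A = A} x (y ∷ ys) φ = begin
    ∑ (perms (x ∷ xs)) φ
  ≡⟨ ∑-concatMap (insertAll x) (perms xs) ⟩
    ∑ (perms xs) (λ p → ∑ (insertAll x p) φ)
  ≡⟨ ∑-perms-last y ys (λ p → ∑ (insertAll x p) φ) ⟩
    ∑ S (λ (us , c , vs) → ∑ (perms (us ++ vs)) (λ q → ∑ (insertAll x (q ++ c ∷ [])) φ))
  ≡⟨ ∑-cong S (λ (us , c , vs) → trans (∑-cong (perms (us ++ vs)) (λ q → ∑-insertAll-last x c q φ))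
    (∑-+ (perms (us ++ vs)))) ⟩
    ∑ S (λ s → inner s ℤ.+ outer s)
  ≡⟨ ∑-+ S {inner} {outer} ⟩
    ∑ S inner ℤ.+ ∑ S outer
  ≡⟨ cong (λ z → ∑ S inner ℤ.+ z) (sym (∑-perms-last y ys (λ p → φ (p ++ x ∷ [])))) ⟩
    ∑ S inner ℤ.+ ∑ (perms xs) (λ q → φ (q ++ x ∷ []))
  ≡⟨ ℤₚ.+-comm (∑ S inner) _ ⟩
    ∑ (perms xs) (λ q → φ (q ++ x ∷ [])) ℤ.+ ∑ S inner
  ≡⟨ cong (λ z → ∑ (perms xs) (λ q → φ (q ++ x ∷ [])) ℤ.+ z)
       (trans (∑-cong S (λ (us , c , vs) → sym (∑-concatMap (insertAll x) (perms (us ++ vs)))))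
         (sym (∑-map (prepend x) S {last}))) ⟩
    ∑ (splits (x ∷ xs)) (λ (us , c , vs) → ∑ (perms (us ++ vs)) (λ q → φ (q ++ c ∷ []))) ∎
  where
  open ≡-Reasoning
  xs : List A
  xs = y ∷ ys
  S : List (Split A)
  S = splits xs
  inner outer last : Split A → ℤ
  last (us , c , vs) = ∑ (perms (us ++ vs)) (λ q → φ (q ++ c ∷ []))
  inner (us , c , vs) = ∑ (perms (us ++ vs)) (λ q → ∑ (insertAll x q) (λ q' → φ (q' ++ c ∷ [])))
  outer (us , c , vs) = ∑ (perms (us ++ vs)) (λ q → φ ((q ++ c ∷ []) ++ x ∷ []))

insertAll-map : ∀ (k : A → B) x ys → insertAll (k x) (map k ys) ≡ map (map k) (insertAll x ys)
insertAll-map k x [] = refl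
insertAll-map k x (y ∷ ys) = cong ((k x ∷ k y ∷ map k ys) ∷_) (trans (cong (map (k y ∷_)) (insertAll-map k x ys))
  (trans (sym (Listₚ.map-∘ (insertAll x ys))) (Listₚ.map-∘ (insertAll x ys))))

∑-perms-map : ∀ (k : A → B) xs (φ : List B → ℤ) → ∑ (perms (map k xs)) φ ≡ ∑ (perms xs) (φ ∘ map k)
∑-perms-map k [] φ = refl
∑-perms-map k (x ∷ xs) φ = trans (∑-concatMap (insertAll (k x)) (perms (map k xs)))
  (trans (∑-perms-map k xs (λ p → ∑ (insertAll (k x) p) φ))
  (trans (∑-cong (perms xs) (λ p → trans (cong (λ l → ∑ l φ) (insertAll-map k x p)) (∑-map (map k) (insertAll x p))))
         (sym (∑-concatMap (insertAll x) (perms xs)))))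

-- Removing `c` from an initial segment leaves the image of `punchIn c`, which identifies the
-- remaining edges with those of a smaller dipole.
∑-splits-upTo : ∀ m (k : ℕ → A) (φ : List A → A → ℤ) →
  ∑ (splits (map k (upTo (suc m)))) (λ (us , c , vs) → φ (us ++ vs) c) ≡
  ∑ (upTo (suc m)) (λ c → φ (map (k ∘ punchIn c) (upTo m)) (k c))
∑-splits-upTo zero k φ = refl
∑-splits-upTo (suc m) k φ = begin
    ∑ (splits (map k (upTo (suc (suc m))))) Φ
  ≡⟨ cong (λ l → ∑ (splits (map k l)) Φ) (upTo-suc (suc m)) ⟩
    φ ks (k 0) ℤ.+ ∑ (map (prepend (k 0)) (splits ks)) Φ
  ≡⟨ cong (λ z → φ ks (k 0) ℤ.+ z) (∑-map (prepend (k 0)) (splits ks) {Φ}) ⟩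
    φ ks (k 0) ℤ.+ ∑ (splits ks) (λ (us , c , vs) → φ (k 0 ∷ us ++ vs) c)
  ≡⟨ cong₂ (λ l z → φ l (k 0) ℤ.+ z) ks≡ (cong (λ l → ∑ (splits l) (λ (us , c , vs) → φ (k 0 ∷ us ++ vs) c)) ks≡) ⟩
    φ (map (k ∘ suc) (upTo (suc m))) (k 0) ℤ.+ ∑ (splits (map (k ∘ suc) (upTo (suc m))))
      (λ (us , c , vs) → φ (k 0 ∷ us ++ vs) c)
  ≡⟨ cong (ℤ._+_ (φ (map (k ∘ suc) (upTo (suc m))) (k 0))) (∑-splits-upTo m (k ∘ suc) (λ l → φ (k 0 ∷ l))) ⟩
    φ (map (k ∘ suc) (upTo (suc m))) (k 0) ℤ.+ ∑ (upTo (suc m))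
      (λ c → φ (k 0 ∷ map (k ∘ suc ∘ punchIn c) (upTo m)) (k (suc c)))
  ≡⟨ cong (ℤ._+_ (φ (map (k ∘ suc) (upTo (suc m))) (k 0)))
    (∑-cong (upTo (suc m)) (λ c → cong (λ l → φ l (k (suc c))) (tail≡ c))) ⟩
    φ (map (k ∘ suc) (upTo (suc m))) (k 0) ℤ.+ ∑ (upTo (suc m))
      (λ c → φ (map (k ∘ punchIn (suc c)) (upTo (suc m))) (k (suc c)))
  ≡⟨ sym (∑-upTo-suc (suc m) (λ c → φ (map (k ∘ punchIn c) (upTo (suc m))) (k c))) ⟩
    ∑ (upTo (suc (suc m))) (λ c → φ (map (k ∘ punchIn c) (upTo (suc m))) (k c)) ∎
  where
  open ≡-Reasoning
  Φ : Split _ → ℤ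
  Φ (us , c , vs) = φ (us ++ vs) c
  ks = map k (map suc (upTo (suc m)))
  ks≡ : ks ≡ map (k ∘ suc) (upTo (suc m))
  ks≡ = sym (Listₚ.map-∘ (upTo (suc m)))
  tail≡ : ∀ c → k 0 ∷ map (k ∘ suc ∘ punchIn c) (upTo m) ≡ map (k ∘ punchIn (suc c)) (upTo (suc m))
  tail≡ c = trans (cong (k 0 ∷_) (Listₚ.map-∘ (upTo m))) (sym (cong (map (k ∘ punchIn (suc c))) (upTo-suc m)))

-- Deleting the last entry and closing the gap inverts `add`. The two lists are ordered differently,
-- so the bijection is expressed through arbitrary sums.
∑-dipoles : ∀ m (φ : Dipole → ℤ) → ∑ (dipoles (suc m)) φ ≡ ∑ (dips m) φ
∑-dipoles zero φ = refl
∑-dipoles (suc m) φ = begin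
    ∑ (map (0 ∷_) (perms (oneTo (suc m)))) φ
  ≡⟨ ∑-map (0 ∷_) (perms (oneTo (suc m))) ⟩
    ∑ (perms (oneTo (suc m))) (φ ∘ (0 ∷_))
  ≡⟨ ∑-perms-last 1 (map suc (applyUpTo suc m)) (φ ∘ (0 ∷_)) ⟩
    ∑ (splits (oneTo (suc m))) (λ (us , c , vs) → ∑ (perms (us ++ vs)) (λ q → φ (0 ∷ q ++ c ∷ [])))
  ≡⟨ ∑-splits-upTo m suc (λ l c → ∑ (perms l) (λ q → φ (0 ∷ q ++ c ∷ []))) ⟩
    ∑ (upTo (suc m)) (λ c → ∑ (perms (map (suc ∘ punchIn c) (upTo m))) (λ q → φ (0 ∷ q ++ suc c ∷ [])))
  ≡⟨ ∑-cong (upTo (suc m)) (λ c → trans (cong (λ l → ∑ (perms l) (λ q → φ (0 ∷ q ++ suc c ∷ [])))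
    (Listₚ.map-∘ (upTo m)))
       (trans (∑-perms-map (punchIn (suc c)) (oneTo m) (λ q → φ (0 ∷ q ++ suc c ∷ [])))
         (sym (∑-map (0 ∷_) (perms (oneTo m)))))) ⟩
    ∑ (upTo (suc m)) (λ c → ∑ (dipoles (suc m)) (λ D → φ (add c D)))
  ≡⟨ ∑-swap (upTo (suc m)) (dipoles (suc m)) {λ c D → φ (add c D)} ⟩
    ∑ (dipoles (suc m)) (λ D → ∑ (upTo (suc m)) (λ c → φ (add c D)))
  ≡⟨ ∑-dipoles m (λ D → ∑ (upTo (suc m)) (λ c → φ (add c D))) ⟩
    ∑ (dips m) (λ D → ∑ (upTo (suc m)) (λ c → φ (add c D)))
  ≡⟨ ∑-cong (dips m) (λ D → sym (∑-map (λ c → add c D) (upTo (suc m)) {φ})) ⟩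
    ∑ (dips m) (λ D → ∑ (map (λ c → add c D) (upTo (suc m))) φ)
  ≡⟨ sym (∑-concatMap _ (dips m)) ⟩
    ∑ (dips (suc m)) φ ∎
  where open ≡-Reasoning

∑-dips-suc : ∀ m (φ : Dipole → ℤ) → ∑ (dips (suc m)) φ ≡ ∑ (dips m) (λ D → ∑ (upTo (suc m)) (λ c → φ (add c D)))
∑-dips-suc m φ = trans (∑-concatMap _ (dips m)) (∑-cong (dips m) (λ D → ∑-map (λ c → add c D) (upTo (suc m)) {φ}))

-- `pos` of an absent edge is the length `suc m`, so `within` says that every edge up to `m` occurs;
-- with the length fixed, `D` is then a permutation.
record WellFormed (m : ℕ) (D : Dipole) : Set where
  field
    {tail} : List ℕ
    starts : D ≡ 0 ∷ tail
    size   : length tail ≡ m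
    within : ∀ e → e ≤ m → pos D e ≤ m

pos-map : ∀ {k : ℕ → ℕ} → (∀ x y → (k x ≡ᵇ k y) ≡ (x ≡ᵇ y)) → ∀ D e → pos (map k D) (k e) ≡ pos D e
pos-map inj [] e = refl
pos-map inj (x ∷ D) e rewrite inj x e with x ≡ᵇ e
... | true = refl
... | false = cong suc (pos-map inj D e)

pos-++ : ∀ D E e → pos D e < length D → pos (D ++ E) e ≡ pos D e
pos-++ (x ∷ D) E e lt with x ≡ᵇ e
... | true = refl
... | false = cong suc (pos-++ D E e (s≤s⁻¹ lt))

pos-add-new : ∀ c D → pos (add c D) (suc c) ≡ length D
pos-add-new c [] rewrite ≡ᵇ-refl c = refl
pos-add-new c (x ∷ D) rewrite punchIn-≢ᵇ (suc c) x = cong suc (pos-add-new c D)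

nth-map-++ : ∀ {k : ℕ → ℕ} D E i → i < length D → nth (map k D ++ E) i ≡ k (nth D i)
nth-map-++ (x ∷ D) E zero lt = refl
nth-map-++ (x ∷ D) E (suc i) lt = nth-map-++ D E i (s≤s⁻¹ lt)

nth-last : ∀ (k : ℕ → ℕ) D x → nth (map k D ++ x ∷ []) (length D) ≡ x
nth-last k [] x = refl
nth-last k (_ ∷ D) x = nth-last k D x

length-add : ∀ c D → length (add c D) ≡ suc (length D)
length-add c [] = refl
length-add c (x ∷ D) = cong suc (length-add c D)

-- Corner `e` precedes edge `suc e`, so `punchIn (suc c)` on edges becomes `punchIn c` on corners.
-- Before edge 0 the predecessor wraps around to corner `m`, which is renumbered because `c ≤ m`.
predMod-punchIn : ∀ {m c} e → c ≤ m → predMod (suc (suc m)) (punchIn (suc c) e) ≡ punchIn c (predMod (suc m) e)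
predMod-punchIn zero le = sym (punchIn-≥ le)
predMod-punchIn (suc e) le = refl

module _ {m : ℕ} {D : Dipole} (wf : WellFormed m D) where
  open WellFormed wf

  edges : nEdges D ≡ suc m
  edges = trans (cong length starts) (cong suc size)

  pos-add-old : ∀ c e → e ≤ m → pos (add c D) (punchIn (suc c) e) ≡ pos D e
  pos-add-old c e le = trans (pos-++ (map (punchIn (suc c)) D) _ _
      (subst₂ _<_ (sym same) (sym (trans (Listₚ.length-map _ D) edges)) (s≤s (within e le)))) same
    where
    same : pos (map (punchIn (suc c)) D) (punchIn (suc c) e) ≡ pos D e
    same = pos-map (punchIn-≡ᵇ (suc c)) D e

  pos-add-last : ∀ c → pos (add c D) (suc c) ≡ suc m
  pos-add-last c = trans (pos-add-new c D) edges

  nEdges-add : ∀ c → nEdges (add c D) ≡ suc (suc m)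
  nEdges-add c = trans (length-add c D) (cong suc edges)

  pos-root : pos D 0 ≡ 0
  pos-root = cong (λ l → pos l 0) starts

  nextCorner-root : nextCorner D 0 ≡ predMod (suc m) (nth D m)
  nextCorner-root rewrite edges | pos-root = refl

  -- At the non-root vertex the root edge is now preceded by the new edge `suc c`, and the corner
  -- before that edge is `c`.
  next-add-root : ∀ c → nextCorner (add c D) 0 ≡ c
  next-add-root c rewrite nEdges-add c | pos-add-old c 0 z≤n | pos-root =
    cong (predMod (suc (suc m))) (trans (cong (nth (add c D)) (sym edges)) (nth-last (punchIn (suc c)) D (suc c)))

  -- The new edge is preceded by the formerly last edge, which used to precede the root edge; so
  -- `suc c` inherits the successor of the root corner.
  next-add-new : ∀ {c} → c ≤ m → nextCorner (add c D) (suc c) ≡ punchIn c (nextCorner D 0)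
  next-add-new {c} le rewrite nextCorner-root | nEdges-add c | pos-add-last c =
    trans (cong (predMod (suc (suc m))) (nth-map-++ D _ m (subst (m <_) (sym edges) ℕₚ.≤-refl)))
      (predMod-punchIn (nth D m) le)

  private
    pos-suc : ∀ k → ∃[ i ] pos D (suc k) ≡ suc i
    pos-suc k = pos tail (suc k) , cong (λ l → pos l (suc k)) starts

  -- Corner `c` is left along edge `c` but entered along the edge after it. When the new edge splits
  -- it, departures stay at `c` and arrivals move to `suc c`: hence `punchIn (suc c)` on the source
  -- and `punchIn c` on the target.
  next-add-old : ∀ {c} k → c ≤ m → k ≢ 0 → k ≤ m → nextCorner (add c D) (punchIn (suc c) k) ≡ punchIn c (nextCorner D k)
  next-add-old zero le k≢0 k≤m = ⊥-elim (k≢0 refl)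
  next-add-old {c} (suc k) le k≢0 k≤m with pos-suc k
  ... | i , e rewrite nEdges-add c | pos-add-old c (suc k) k≤m | edges | e =
    trans (cong (predMod (suc (suc m))) (nth-map-++ D _ i
      (subst (i <_) (sym edges) (ℕₚ.m≤n⇒m≤1+n (subst (_≤ m) e (within (suc k) k≤m))))))
          (predMod-punchIn (nth D i) le)

unpunch : ∀ c e → e ≡ c ⊎ ∃[ k ] e ≡ punchIn c k
unpunch zero zero = inj₁ refl
unpunch zero (suc e) = inj₂ (e , refl)
unpunch (suc c) zero = inj₂ (0 , refl)
unpunch (suc c) (suc e) with unpunch c e
... | inj₁ p = inj₁ (cong suc p)
... | inj₂ (k , p) = inj₂ (suc k , cong suc p)

punchIn-≤⁻¹ : ∀ {c k m} → c ≤ m → punchIn (suc c) k ≤ suc m → k ≤ m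
punchIn-≤⁻¹ {c} {zero} _ _ = z≤n
punchIn-≤⁻¹ {zero} {suc k} _ (s≤s le) = le
punchIn-≤⁻¹ {suc c} {suc k} {suc m} (s≤s p) (s≤s q) = s≤s (punchIn-≤⁻¹ p q)

WellFormed-add : ∀ {m D c} → c ≤ m → WellFormed m D → WellFormed (suc m) (add c D)
WellFormed-add {m} {D} {c} le wf = record
  { starts = cong (λ l → map (punchIn (suc c)) l ++ suc c ∷ []) (WellFormed.starts wf)
  ; size = trans (length-add c (WellFormed.tail wf)) (cong suc (WellFormed.size wf))
  ; within = within' }
  where
  within' : ∀ e → e ≤ suc m → pos (add c D) e ≤ suc m
  within' e e≤ with unpunch (suc c) e
  ... | inj₁ refl = ℕₚ.≤-reflexive (pos-add-last wf c)
  ... | inj₂ (k , refl) rewrite pos-add-old wf c k (punchIn-≤⁻¹ le e≤) = ℕₚ.m≤n⇒m≤1+n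
    (WellFormed.within wf k (punchIn-≤⁻¹ le e≤))

All-dips : (P : ℕ → Dipole → Set) → P 0 (0 ∷ []) → (∀ {m D c} → c ≤ m → P m D → P (suc m) (add c D)) →
           ∀ m → All (P m) (dips m)
All-dips P base next zero = base ∷ []
All-dips P base next (suc m) = Allₚ.concat⁺ (Allₚ.map⁺ (All.map
  (λ p → Allₚ.map⁺ (All.map (λ c<1+m → next (s≤s⁻¹ c<1+m) p) (Allₚ.all-upTo (suc m)))) (All-dips P base next m)))

WellFormed-dips : ∀ m → All (WellFormed m) (dips m)
WellFormed-dips = All-dips WellFormed (record { starts = refl ; size = refl ; within = λ { zero z≤n → z≤n } })
  WellFormed-add

-- Cycles of the face permutation

Chain : (ℕ → ℕ) → ℕ → List ℕ → ℕ → Set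
Chain F x [] y = F x ≡ y
Chain F x (z ∷ zs) y = F x ≡ z × Chain F z zs y

-- Empty cycles are excluded so that the number of faces is bounded by the number of corners, as in
-- `length-concat`.
Cycle : (ℕ → ℕ) → List ℕ → Set
Cycle F [] = ⊥
Cycle F (x ∷ xs) = Chain F x xs x

Chain-split : ∀ {F} x us {c vs y} → Chain F x (us ++ c ∷ vs) y → Chain F x us c × Chain F c vs y
Chain-split x [] (e , ch) = e , ch
Chain-split x (u ∷ us) (e , ch) with Chain-split u us ch
... | p , q = (e , p) , q

Chain-join : ∀ {F} x us {c vs y} → Chain F x us c → Chain F c vs y → Chain F x (us ++ c ∷ vs) y
Chain-join x [] e ch = e , ch
Chain-join x (u ∷ us) (e , p) q = e , Chain-join u us p q

Cycle-rotate : ∀ {F} us {c vs} → Cycle F (us ++ c ∷ vs) → Cycle F (c ∷ vs ++ us)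
Cycle-rotate [] {c} {vs} ch rewrite Listₚ.++-identityʳ vs = ch
Cycle-rotate (u ∷ us) {c} {vs} ch with Chain-split u us ch
... | p , q = Chain-join c vs q p

-- The root face has corners 0 ∷ xs and the cycles os are the other faces.
record Structure (m : ℕ) (D : Dipole) (xs : List ℕ) (os : List (List ℕ)) : Set where
  field
    wellFormed : WellFormed m D
    root   : Chain (nextCorner D) 0 xs 0
    cycles : All (Cycle (nextCorner D)) os
    cover  : 0 ∷ xs ++ concat os ↭ upTo (suc m)
open Structure

Unique-resp-↭ : {xs ys : List A} → xs ↭ ys → Unique xs → Unique ys
Unique-resp-↭ ↭.refl u = u
Unique-resp-↭ (prep x p) (a ∷ u) = ↭ₚ.All-resp-↭ p a ∷ Unique-resp-↭ p u
Unique-resp-↭ (swap x y p) ((x≢y ∷ a) ∷ b ∷ u) =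
  ((x≢y ∘ sym) ∷ ↭ₚ.All-resp-↭ p b) ∷ ↭ₚ.All-resp-↭ p a ∷ Unique-resp-↭ p u
Unique-resp-↭ (↭.trans p q) u = Unique-resp-↭ q (Unique-resp-↭ p u)

concat-↭ : {xss yss : List (List A)} → xss ↭ yss → concat xss ↭ concat yss
concat-↭ ↭.refl = ↭-refl
concat-↭ (prep x p) = ↭ₚ.++⁺ˡ x (concat-↭ p)
concat-↭ (swap {xss} x y p) = ↭-trans (↭ₚ.shifts x y {concat xss}) (↭ₚ.++⁺ˡ y (↭ₚ.++⁺ˡ x (concat-↭ p)))
concat-↭ (↭.trans p q) = ↭-trans (concat-↭ p) (concat-↭ q)

Structure-↭ : ∀ {m D xs os os'} → os ↭ os' → Structure m D xs os → Structure m D xs os'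
Structure-↭ {xs = xs} p s = record
  { wellFormed = wellFormed s ; root = root s ; cycles = ↭ₚ.All-resp-↭ p (cycles s)
  ; cover = ↭-trans (prep 0 (↭ₚ.++⁺ˡ xs (↭-sym (concat-↭ p)))) (cover s) }

-- Away from 0 the successor is inherited, and away from `c` the two renumberings agree, so chains
-- through such corners are simply transported.
record Ordinary (c m z : ℕ) : Set where
  constructor ordinaryCorner
  field
    nonzero : z ≢ 0
    other   : z ≢ c
    bounded : z ≤ m

cover-ordinary : ∀ {c m rest} → 0 ∷ c ∷ rest ↭ upTo (suc m) → c ≢ 0 × c ≤ m × All (Ordinary c m) rest
cover-ordinary {c} {m} p with Unique-resp-↭ (↭-sym p) (Uniqueₚ.upTo⁺ (suc m)) | ↭ₚ.All-resp-↭ (↭-sym p)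
  (Allₚ.all-upTo (suc m))
... | (0≢c ∷ a) ∷ b ∷ u | _ ∷ c< ∷ bd = 0≢c ∘ sym , s≤s⁻¹ c< ,
  All.zipWith (λ { (p , q , r) → ordinaryCorner (p ∘ sym) (q ∘ sym) (s≤s⁻¹ r) }) (a , All.zip (b , bd))

cover-add : ∀ {c m rest} → c ≢ 0 → c ≤ m → 0 ∷ c ∷ rest ↭ upTo (suc m) →
            0 ∷ c ∷ suc c ∷ map (punchIn c) rest ↭ upTo (suc (suc m))
cover-add {c} {m} {rest} c≢0 c≤m p = ↭-trans
  (swap 0 c (↭-reflexive (cong (_∷ map (punchIn c) rest) (sym (punchIn-self c)))))
  (↭-trans (prep c (↭-trans (↭-reflexive (cong (_∷ map (punchIn c) (c ∷ rest)) (sym (punchIn-< (ℕₚ.n≢0⇒n>0 c≢0)))))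
                            (↭ₚ.map⁺ (punchIn c) p)))
           (upTo-punchIn (ℕₚ.m≤n⇒m≤1+n c≤m)))

module _ {m D} (wf : WellFormed m D) {c} (c≤m : c ≤ m) where

  Chain-add : ∀ x zs {y} → x ≢ 0 → x ≤ m → All (Ordinary c m) zs → Chain (nextCorner D) x zs y →
              Chain (nextCorner (add c D)) (punchIn (suc c) x) (map (punchIn c) zs) (punchIn c y)
  Chain-add x [] x≢0 x≤m [] e = trans (next-add-old wf x c≤m x≢0 x≤m) (cong (punchIn c) e)
  Chain-add x (z ∷ zs) x≢0 x≤m (ordinaryCorner nz oth bd ∷ os) (e , ch) =
    trans (next-add-old wf x c≤m x≢0 x≤m) (cong (punchIn c) e) ,
    subst (λ z' → Chain (nextCorner (add c D)) z' (map (punchIn c) zs) _) (punchIn-suc-≢ c z oth)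
      (Chain-add z zs nz bd os ch)

  Chain-add-new : ∀ zs {y} → All (Ordinary c m) zs → Chain (nextCorner D) 0 zs y →
                  Chain (nextCorner (add c D)) (suc c) (map (punchIn c) zs) (punchIn c y)
  Chain-add-new [] [] e = trans (next-add-new wf c≤m) (cong (punchIn c) e)
  Chain-add-new (z ∷ zs) (ordinaryCorner nz oth bd ∷ os) (e , ch) =
    trans (next-add-new wf c≤m) (cong (punchIn c) e) ,
    subst (λ z' → Chain (nextCorner (add c D)) z' (map (punchIn c) zs) _) (punchIn-suc-≢ c z oth)
      (Chain-add z zs nz bd os ch)

  Cycle-add : ∀ zs → All (Ordinary c m) zs → Cycle (nextCorner D) zs → Cycle (nextCorner (add c D)) (map (punchIn c) zs)
  Cycle-add (z ∷ zs) (ordinaryCorner nz oth bd ∷ os) ch =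
    subst (λ z' → Chain (nextCorner (add c D)) z' (map (punchIn c) zs) (punchIn c z)) (punchIn-suc-≢ c z oth)
      (Chain-add z zs nz bd os ch)

  Cycles-add : ∀ os → All (Ordinary c m) (concat os) → All (Cycle (nextCorner D)) os →
               All (Cycle (nextCorner (add c D))) (map (map (punchIn c)) os)
  Cycles-add [] _ [] = []
  Cycles-add (o ∷ os) a (cy ∷ cs) with Allₚ.++⁻ o a
  ... | a₁ , a₂ = Cycle-add o a₁ cy ∷ Cycles-add os a₂ cs

-- The root corner becomes its own successor, and the new corner 1 takes its former place in the
-- cycle.
Structure-cut-root : ∀ {m D xs os} → Structure m D xs os →
                     Structure (suc m) (add 0 D) [] ((1 ∷ map suc xs) ∷ map (map suc) os)
Structure-cut-root {m} {D} {xs} {os} s = record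
  { wellFormed = WellFormed-add z≤n (wellFormed s)
  ; root = next-add-root (wellFormed s) 0
  ; cycles = Chain-add-new (wellFormed s) z≤n xs (proj₁ ordinary') (root s) ∷ Cycles-add (wellFormed s) z≤n os
    (proj₂ ordinary') (cycles s)
  ; cover = ↭-trans (prep 0 (↭-reflexive (cong (1 ∷_) (trans (cong (map suc xs ++_) (Listₚ.concat-map os))
    (sym (Listₚ.map-++ suc xs (concat os)))))))
             (↭-trans (prep 0 (↭ₚ.map⁺ suc (cover s))) (↭-reflexive (sym (upTo-suc (suc m))))) }
  where
  ordinary' : All (Ordinary 0 m) xs × All (Ordinary 0 m) (concat os)
  ordinary' with Unique-resp-↭ (↭-sym (cover s)) (Uniqueₚ.upTo⁺ (suc m)) | ↭ₚ.All-resp-↭ (↭-sym (cover s))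
    (Allₚ.all-upTo (suc m))
  ... | a ∷ _ | _ ∷ b = Allₚ.++⁻ xs (All.zipWith (λ { (p , r) → ordinaryCorner (p ∘ sym) (p ∘ sym) (s≤s⁻¹ r) }) (a , b))

-- The root corner now leads to `c`, which continues into `vs` as before. The former successor of
-- the root corner is reached from `suc c`, and the old arrival at `c` after `us` closes that cycle
-- at `suc c`.
Structure-cut : ∀ {m D c} us vs {os} → Structure m D (us ++ c ∷ vs) os →
                Structure (suc m) (add c D) (c ∷ map (punchIn c) vs)
                  ((suc c ∷ map (punchIn c) us) ∷ map (map (punchIn c)) os)
Structure-cut {m} {D} {c} us vs {os} s = record
  { wellFormed = WellFormed-add c≤m wf
  ; root = next-add-root wf c , subst₂ (λ x y → Chain (nextCorner (add c D)) x (map (punchIn c) vs) y)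
    (punchIn-suc-self c) (punchIn-< (ℕₚ.n≢0⇒n>0 c≢0))
             (Chain-add wf c≤m c vs c≢0 c≤m ordVs (proj₂ chains))
  ; cycles = subst (Chain (nextCorner (add c D)) (suc c) (map (punchIn c) us)) (punchIn-self c)
    (Chain-add-new wf c≤m us ordUs (proj₁ chains))
             ∷ Cycles-add wf c≤m os ordOs (cycles s)
  ; cover = ↭-trans (prep 0 (prep c rearranged)) (cover-add c≢0 c≤m cover') }
  where
  wf = wellFormed s
  cover' : 0 ∷ c ∷ us ++ vs ++ concat os ↭ upTo (suc m)
  cover' = ↭-trans (prep 0 (↭-trans (↭-sym (↭ₚ.shift c us (vs ++ concat os)))
    (↭-reflexive (sym (Listₚ.++-assoc us (c ∷ vs) (concat os)))))) (cover s)
  facts = cover-ordinary cover'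
  c≢0 = proj₁ facts
  c≤m = proj₁ (proj₂ facts)
  ordUs = proj₁ (Allₚ.++⁻ us (proj₂ (proj₂ facts)))
  ordRest = proj₂ (Allₚ.++⁻ us (proj₂ (proj₂ facts)))
  ordVs = proj₁ (Allₚ.++⁻ vs ordRest)
  ordOs = proj₂ (Allₚ.++⁻ vs ordRest)
  chains = Chain-split 0 us (root s)
  ρ = punchIn c
  rearranged : map ρ vs ++ (suc c ∷ map ρ us) ++ concat (map (map ρ) os) ↭ suc c ∷ map ρ (us ++ vs ++ concat os)
  rearranged = ↭-trans (↭ₚ.shift (suc c) (map ρ vs) _) (prep (suc c) (↭-trans (↭ₚ.shifts (map ρ vs) (map ρ us))
    (↭-reflexive (trans (cong (λ l → map ρ us ++ map ρ vs ++ l) (Listₚ.concat-map os))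
      (sym (trans (Listₚ.map-++ ρ us _) (cong (map ρ us ++_) (Listₚ.map-++ ρ vs (concat os)))))))))

-- The face of `c` is entered from the root corner at `c`; where it used to close it arrives at
-- `suc c`, which continues along the old root face.
Structure-join : ∀ {m D c xs ys os} → Structure m D xs ((c ∷ ys) ∷ os) →
                 Structure (suc m) (add c D) (c ∷ map (punchIn c) ys ++ suc c ∷ map (punchIn c) xs)
                   (map (map (punchIn c)) os)
Structure-join {m} {D} {c} {xs} {ys} {os} s = record
  { wellFormed = WellFormed-add c≤m wf
  ; root = next-add-root wf c , Chain-join c (map ρ ys)
      (subst₂ (λ x y → Chain (nextCorner (add c D)) x (map ρ ys) y) (punchIn-suc-self c) (punchIn-self c)
        (Chain-add wf c≤m c ys c≢0 c≤m ordYs (All.head (cycles s))))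
      (subst (Chain (nextCorner (add c D)) (suc c) (map ρ xs)) (punchIn-< (ℕₚ.n≢0⇒n>0 c≢0))
        (Chain-add-new wf c≤m xs ordXs (root s)))
  ; cycles = Cycles-add wf c≤m os ordOs (All.tail (cycles s))
  ; cover = ↭-trans (prep 0 (prep c rearranged)) (cover-add c≢0 c≤m cover') }
  where
  wf = wellFormed s
  cover' : 0 ∷ c ∷ xs ++ ys ++ concat os ↭ upTo (suc m)
  cover' = ↭-trans (prep 0 (↭-sym (↭ₚ.shift c xs (ys ++ concat os)))) (cover s)
  facts = cover-ordinary cover'
  c≢0 = proj₁ facts
  c≤m = proj₁ (proj₂ facts)
  ordXs = proj₁ (Allₚ.++⁻ xs (proj₂ (proj₂ facts)))
  ordRest = proj₂ (Allₚ.++⁻ xs (proj₂ (proj₂ facts)))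
  ordYs = proj₁ (Allₚ.++⁻ ys ordRest)
  ordOs = proj₂ (Allₚ.++⁻ ys ordRest)
  ρ = punchIn c
  rearranged : (map ρ ys ++ suc c ∷ map ρ xs) ++ concat (map (map ρ) os) ↭ suc c ∷ map ρ (xs ++ ys ++ concat os)
  rearranged = ↭-trans (↭-reflexive (Listₚ.++-assoc (map ρ ys) (suc c ∷ map ρ xs) _))
    (↭-trans (↭ₚ.shift (suc c) (map ρ ys) _) (prep (suc c) (↭-trans (↭ₚ.shifts (map ρ ys) (map ρ xs))
    (↭-reflexive (trans (cong (λ l → map ρ xs ++ map ρ ys ++ l) (Listₚ.concat-map os))
      (sym (trans (Listₚ.map-++ ρ xs _) (cong (map ρ xs ++_) (Listₚ.map-++ ρ ys (concat os))))))))))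

Structure-rotate : ∀ {m D xs} us {c vs os} → Structure m D xs ((us ++ c ∷ vs) ∷ os) → Structure m D xs
  ((c ∷ vs ++ us) ∷ os)
Structure-rotate {xs = xs} us {c} {vs} {os} s = record
  { wellFormed = wellFormed s ; root = root s
  ; cycles = Cycle-rotate us (All.head (cycles s)) ∷ All.tail (cycles s)
  ; cover = ↭-trans (prep 0 (↭ₚ.++⁺ˡ xs (↭ₚ.++⁺ʳ (concat os) (↭ₚ.++-comm (c ∷ vs) us)))) (cover s) }

-- The faces computed by following orbits are the cycles of any such structure.

orbitFrom-Chain : ∀ {F s} x zs k → Chain F x zs s → All (_≢ s) zs → length zs ≤ k → orbitFrom F s k (F x) ≡ zs
orbitFrom-Chain x [] zero e _ _ = refl
orbitFrom-Chain {F} {s} x [] (suc k) e _ _ rewrite e | ≡ᵇ-refl s = refl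
orbitFrom-Chain {F} {s} x (z ∷ zs) (suc k) (e , ch) (z≢s ∷ ne) (s≤s le)
  rewrite e | ≢⇒≡ᵇ z≢s = cong (z ∷_) (orbitFrom-Chain z zs k ch ne le)

orbit-Cycle : ∀ {D s zs} → Cycle (nextCorner D) (s ∷ zs) → Unique (s ∷ zs) → length zs ≤ nEdges D → orbit D s ≡ s ∷ zs
orbit-Cycle {D} {s} {zs} cy (a ∷ _) le = cong (s ∷_) (orbitFrom-Chain s zs (nEdges D) cy (All.map (_∘ sym) a) le)

filter-++ : (P : A → Bool) (xs ys : List A) → filter P (xs ++ ys) ≡ filter P xs ++ filter P ys
filter-++ P [] ys = refl
filter-++ P (x ∷ xs) ys with P x
... | true = cong (x ∷_) (filter-++ P xs ys)
... | false = filter-++ P xs ys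

filter-↭ : (P : A → Bool) {xs ys : List A} → xs ↭ ys → filter P xs ↭ filter P ys
filter-↭ P ↭.refl = ↭-refl
filter-↭ P (prep x p) with P x
... | true = prep x (filter-↭ P p)
... | false = filter-↭ P p
filter-↭ P (swap x y p) with P x | P y
... | true | true = swap x y (filter-↭ P p)
... | true | false = prep x (filter-↭ P p)
... | false | true = prep y (filter-↭ P p)
... | false | false = filter-↭ P p
filter-↭ P (↭.trans p q) = ↭-trans (filter-↭ P p) (filter-↭ P q)

filter-none : (P : A → Bool) {xs : List A} → All (λ x → P x ≡ false) xs → filter P xs ≡ []
filter-none P [] = refl
filter-none P (e ∷ es) rewrite e = filter-none P es

filter-all : (P : A → Bool) {xs : List A} → All (λ x → P x ≡ true) xs → filter P xs ≡ xs
filter-all P [] = refl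
filter-all P {x ∷ xs} (e ∷ es) rewrite e = cong (x ∷_) (filter-all P es)

≤ᵇ-true : ∀ {m n} → m ≤ n → (m ≤ᵇ n) ≡ true
≤ᵇ-true {m} {n} le with m ≤ᵇ n | ℕₚ.≤⇒≤ᵇ le
... | true | _ = refl

≤ᵇ-sound : ∀ m n → (m ≤ᵇ n) ≡ true → m ≤ n
≤ᵇ-sound m n e = ℕₚ.≤ᵇ⇒≤ m n (subst T (sym e) tt)

all-≤ᵇ : ∀ {c xs} → All (c ≤_) xs → all (λ x → c ≤ᵇ x) xs ≡ true
all-≤ᵇ [] = refl
all-≤ᵇ (le ∷ les) rewrite ≤ᵇ-true le = all-≤ᵇ les

all-≤ᵇ-sound : ∀ c xs → all (λ x → c ≤ᵇ x) xs ≡ true → All (c ≤_) xs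
all-≤ᵇ-sound c [] e = []
all-≤ᵇ-sound c (x ∷ xs) e with ∧-true {c ≤ᵇ x} e
... | e₁ , e₂ = ≤ᵇ-sound c x e₁ ∷ all-≤ᵇ-sound c xs e₂

minimum : ∀ x xs → ∃[ u ] ∃[ μ ] ∃[ v ] (x ∷ xs ≡ u ++ μ ∷ v × All (μ ≤_) (x ∷ xs))
minimum x [] = [] , x , [] , refl , (ℕₚ.≤-refl ∷ [])
minimum x (y ∷ ys) with minimum y ys
... | u , μ , v , e , a with ℕₚ.≤-total μ x
... | inj₁ μ≤x = x ∷ u , μ , v , cong (x ∷_) e , (μ≤x ∷ a)
... | inj₂ x≤μ = [] , x , y ∷ ys , refl , (ℕₚ.≤-refl ∷ All.map (ℕₚ.≤-trans x≤μ) a)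

every-split : (xs : List A) → All (λ x → ∃[ us ] ∃[ vs ] us ++ x ∷ vs ≡ xs) xs
every-split [] = []
every-split (x ∷ xs) = ([] , xs , refl) ∷ All.map (λ { (us , vs , e) → x ∷ us , vs , cong (x ∷_) e }) (every-split xs)

isLeast : Dipole → ℕ → Bool
isLeast D c = all (λ x → c ≤ᵇ x) (orbit D c)

module _ {D : Dipole} where

  orbit-split : ∀ us c vs → Cycle (nextCorner D) (us ++ c ∷ vs) → Unique (us ++ c ∷ vs) → length (us ++ c ∷ vs) ≤
    nEdges D →
                orbit D c ≡ c ∷ vs ++ us
  orbit-split us c vs cy u le = orbit-Cycle {D} (Cycle-rotate us cy) (Unique-resp-↭ (↭ₚ.++-comm us (c ∷ vs)) u)
    (ℕₚ.≤-trans (ℕₚ.n≤1+n _) (subst (_≤ nEdges D) (↭ₚ.↭-length (↭ₚ.++-comm us (c ∷ vs))) le))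

  -- A corner that is least in its orbit is at most `μ`, because the orbit is the whole cycle; by
  -- minimality it equals `μ`. So `faces` picks each cycle exactly once.
  faceOf-least : ∀ u μ v → All (μ ≤_) (u ++ μ ∷ v) → Cycle (nextCorner D) (u ++ μ ∷ v) → Unique (u ++ μ ∷ v) →
                 length (u ++ μ ∷ v) ≤ nEdges D → map (orbit D) (filter (isLeast D) (u ++ μ ∷ v)) ≡ (μ ∷ v ++ u) ∷ []
  faceOf-least u μ v a cy uq le =
    trans (cong (map (orbit D)) picked) (cong (_∷ []) (orbit-split u μ v cy uq le))
    where
    o = u ++ μ ∷ v
    least⇒μ : All (λ y → isLeast D y ≡ true → y ≤ μ) o
    least⇒μ = All.map (λ { {y} (us , vs , e) t → back y us vs e t }) (every-split o)
      where
      back : ∀ y us vs → us ++ y ∷ vs ≡ o → isLeast D y ≡ true → y ≤ μ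
      back y us vs e t = All.head (proj₂ (Allₚ.++⁻ u (↭ₚ.All-resp-↭
        (↭-trans (↭ₚ.++-comm (y ∷ vs) us) (↭-reflexive e))
        (subst (All (y ≤_)) (orbit-split us y vs (subst (Cycle (nextCorner D)) (sym e) cy)
          (subst Unique (sym e) uq) (subst (λ l → length l ≤ nEdges D) (sym e) le))
          (all-≤ᵇ-sound y (orbit D y) t)))))
    others : All (λ y → μ ≢ y) (v ++ u)
    others = AllPairs.head (Unique-resp-↭ (↭ₚ.++-comm u (μ ∷ v)) uq)
    notLeast : ∀ {y} → (isLeast D y ≡ true → y ≤ μ) × μ ≤ y × μ ≢ y → isLeast D y ≡ false
    notLeast {y} (p , q , r) with isLeast D y
    ... | true = ⊥-elim (r (ℕₚ.≤-antisym q (p refl)))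
    ... | false = refl
    rest : All (λ y → isLeast D y ≡ false) (v ++ u)
    rest = All.zipWith notLeast (drop-μ least⇒μ , All.zip (drop-μ a , others))
      where
      drop-μ : ∀ {P : ℕ → Set} → All P o → All P (v ++ u)
      drop-μ al = All.tail (↭ₚ.All-resp-↭ (↭ₚ.++-comm u (μ ∷ v)) al)
    least-μ : isLeast D μ ≡ true
    least-μ = all-≤ᵇ (subst (All (μ ≤_)) (sym (orbit-split u μ v cy uq le)) (↭ₚ.All-resp-↭ (↭ₚ.++-comm u (μ ∷ v)) a))
    picked : filter (isLeast D) o ≡ μ ∷ []
    picked rewrite filter-++ (isLeast D) u (μ ∷ v) | filter-none (isLeast D) (proj₂ (Allₚ.++⁻ v rest)) | least-μ
      | filter-none (isLeast D) (proj₁ (Allₚ.++⁻ v rest)) = refl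

  faceOf : ∀ o → Cycle (nextCorner D) o → Unique o → length o ≤ nEdges D →
           ∃[ o' ] (Rotation o o' × map (orbit D) (filter (isLeast D) o) ≡ o' ∷ [])
  faceOf (x ∷ xs) cy uq le with minimum x xs
  ... | u , μ , v , e , a = μ ∷ v ++ u , (u , μ ∷ v , e , refl) ,
    trans (cong (λ o → map (orbit D) (filter (isLeast D) o)) e)
      (faceOf-least u μ v (subst (All (μ ≤_)) e a) (subst (Cycle (nextCorner D)) e cy) (subst Unique e uq)
        (subst (λ o → length o ≤ nEdges D) e le))

  facesOf : ∀ K → All (Cycle (nextCorner D)) K → Unique (concat K) → length (concat K) ≤ nEdges D →
            ∃[ K' ] (Pointwise Rotation K K' × map (orbit D) (filter (isLeast D) (concat K)) ≡ K')
  facesOf [] _ _ _ = [] , [] , refl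
  facesOf (o ∷ K) (cy ∷ cs) uq le
    with faceOf o cy (proj₁ parts) (ℕₚ.≤-trans (ℕₚ.m≤m+n _ _) le') | facesOf K cs (proj₂ parts)
      (ℕₚ.≤-trans (ℕₚ.m≤n+m _ (length o)) le')
    where
    parts : Unique o × Unique (concat K)
    parts = go o uq
      where
      go : ∀ xs {ys : List ℕ} → Unique (xs ++ ys) → Unique xs × Unique ys
      go [] u = [] , u
      go (x ∷ xs) (a ∷ u) with go xs u
      ... | p , q = (proj₁ (Allₚ.++⁻ xs a) ∷ p) , q
    le' : length o + length (concat K) ≤ nEdges D
    le' = subst (_≤ nEdges D) (Listₚ.length-++ o) le
  ... | o' , r , e | K' , rs , es = o' ∷ K' , r ∷ rs ,
    trans (cong (map (orbit D)) (filter-++ (isLeast D) o (concat K)))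
      (trans (Listₚ.map-++ (orbit D) (filter (isLeast D) o) _) (cong₂ _++_ e es))

module _ {m D xs os} (s : Structure m D xs os) where

  private
    uq : Unique (0 ∷ xs ++ concat os)
    uq = Unique-resp-↭ (↭-sym (cover s)) (Uniqueₚ.upTo⁺ (suc m))
    size≡ : length (0 ∷ xs ++ concat os) ≡ nEdges D
    size≡ = trans (↭ₚ.↭-length (cover s)) (trans (Listₚ.length-upTo (suc m)) (sym (edges (wellFormed s))))

  -- `faces` starts each face at its least corner and orders the faces by it; a structure remembers
  -- neither, hence rotation and permutation.
  faces-↭ : ∃[ K' ] (Pointwise Rotation ((0 ∷ xs) ∷ os) K' × faces D ↭ K')
  faces-↭ with facesOf {D} ((0 ∷ xs) ∷ os) (root s ∷ cycles s) uq (ℕₚ.≤-reflexive size≡)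
  ... | K' , r , e = K' , r , ↭-trans (↭ₚ.map⁺ (orbit D) (filter-↭ (isLeast D)
      (↭-trans (↭-reflexive (cong upTo (edges (wellFormed s)))) (↭-sym (cover s))))) (↭-reflexive e)

  rootFace-≡ : rootFace D ≡ 0 ∷ xs
  rootFace-≡ = orbit-Cycle {D} (root s) (unique-prefix (0 ∷ xs) uq)
    (ℕₚ.≤-trans (ℕₚ.n≤1+n _) (ℕₚ.≤-trans (ℕₚ.≤-trans (ℕₚ.m≤m+n _ _)
      (ℕₚ.≤-reflexive (sym (Listₚ.length-++ (0 ∷ xs))))) (ℕₚ.≤-reflexive size≡)))
    where
    unique-prefix : ∀ (us : List ℕ) {vs} → Unique (us ++ vs) → Unique us
    unique-prefix [] u = []
    unique-prefix (x ∷ us) (a ∷ u) = proj₁ (Allₚ.++⁻ us a) ∷ unique-prefix us u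

  nFaces-≡ : nFaces D ≡ suc (length os)
  nFaces-≡ with faces-↭
  ... | K' , r , p = trans (↭ₚ.↭-length p) (sym (Pointwise.Pointwise-length r))

  nonRootFaces-↭ : ∃[ os' ] (Pointwise Rotation os os' × nonRootFaces D ↭ os')
  nonRootFaces-↭ with faces-↭
  ... | r' ∷ os' , (rot₀ ∷ rots) , p = os' , rots ,
    ↭-trans (filter-↭ _ p) (↭-reflexive (trans (drop-root (has-zero rot₀))
      (filter-all _ (no-zeros rots (All.map (_∘ sym) (proj₂ (Allₚ.++⁻ xs (AllPairs.head uq))))))))
    where
    nonRoot : List ℕ → Bool
    nonRoot F = not (any (_≡ᵇ 0) F)
    any-++-zero : ∀ us {vs} → any (_≡ᵇ 0) (us ++ 0 ∷ vs) ≡ true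
    any-++-zero [] = refl
    any-++-zero (zero ∷ us) = refl
    any-++-zero (suc _ ∷ us) = any-++-zero us
    has-zero : ∀ {r' xs} → Rotation (0 ∷ xs) r' → any (_≡ᵇ 0) r' ≡ true
    has-zero ([] , v , refl , refl) = refl
    has-zero (_ ∷ u , v , refl , refl) = any-++-zero v
    drop-root : any (_≡ᵇ 0) r' ≡ true → filter nonRoot (r' ∷ os') ≡ filter nonRoot os'
    drop-root e rewrite e = refl
    no-zero : ∀ {o} → All (_≢ 0) o → nonRoot o ≡ true
    no-zero [] = refl
    no-zero (ne ∷ nes) rewrite ≢⇒≡ᵇ ne = no-zero nes
    no-zeros : ∀ {os os'} → Pointwise Rotation os os' → All (_≢ 0) (concat os) → All (λ o → nonRoot o ≡ true) os'
    no-zeros [] _ = []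
    no-zeros {o ∷ os} ((u , v , refl , refl) ∷ rs) a with Allₚ.++⁻ o a
    ... | a₁ , a₂ = no-zero (↭ₚ.All-resp-↭ (↭ₚ.++-comm u v) a₁) ∷ no-zeros rs a₂

  face-lengths : map length (faces D) ↭ suc (length xs) ∷ map length os
  face-lengths with faces-↭
  ... | K' , r , p = ↭-trans (↭ₚ.map⁺ length p) (↭-reflexive (sym (lengths r)))
    where
    lengths : ∀ {K K' : List (List ℕ)} → Pointwise Rotation K K' → map length K ≡ map length K'
    lengths [] = refl
    lengths ((u , v , refl , refl) ∷ rs) = cong₂ _∷_ (↭ₚ.↭-length (↭ₚ.++-comm u v)) (lengths rs)

-- Region counts and labels after an insertion

label : ℕ → ℕ → Label
label s k = if k <ᵇ s then ● else ○

count-↭ : (P : ℕ → Bool) {xs ys : List ℕ} → xs ↭ ys → count P xs ≡ count P ys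
count-↭ P p = ↭ₚ.↭-length (filter-↭ P p)

count-map : (P : ℕ → Bool) (k : ℕ → ℕ) (xs : List ℕ) → count P (map k xs) ≡ count (P ∘ k) xs
count-map P k [] = refl
count-map P k (x ∷ xs) with P (k x)
... | true = cong suc (count-map P k xs)
... | false = count-map P k xs

filter-cong : {P Q : A → Bool} {xs : List A} → All (λ x → P x ≡ Q x) xs → filter P xs ≡ filter Q xs
filter-cong [] = refl
filter-cong {Q = Q} {x ∷ xs} (e ∷ es) rewrite e with Q x
... | true = cong (x ∷_) (filter-cong es)
... | false = filter-cong es

filter-map : (P : ℕ → Bool) (k : ℕ → ℕ) (xs : List ℕ) → filter P (map k xs) ≡ map k (filter (P ∘ k) xs)
filter-map P k [] = refl
filter-map P k (x ∷ xs) with P (k x)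
... | true = cong (k x ∷_) (filter-map P k xs)
... | false = filter-map P k xs

All-filter : {P : ℕ → Bool} {Q : ℕ → Set} {xs : List ℕ} → All Q xs → All Q (filter P xs)
All-filter [] = []
All-filter {P} {xs = x ∷ xs} (q ∷ qs) with P x
... | true = q ∷ All-filter qs
... | false = All-filter qs

oneTo-≤ : ∀ m → All (_≤ m) (oneTo m)
oneTo-≤ m = Allₚ.map⁺ (Allₚ.all-upTo m)

upTo-≤ : ∀ m → All (_≤ m) (upTo (suc m))
upTo-≤ m = All.map s≤s⁻¹ (Allₚ.all-upTo (suc m))

punchIn-self-≢ᵇ : ∀ c s → (c ≡ᵇ punchIn c s) ≡ false
punchIn-self-≢ᵇ zero s = refl
punchIn-self-≢ᵇ (suc c) zero = refl
punchIn-self-≢ᵇ (suc c) (suc s) = punchIn-self-≢ᵇ c s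

self-<ᵇ-punchIn : ∀ c s → (suc c <ᵇ punchIn (suc c) s) ≡ (c <ᵇ s)
self-<ᵇ-punchIn c zero = refl
self-<ᵇ-punchIn zero (suc s) = refl
self-<ᵇ-punchIn (suc c) (suc s) = self-<ᵇ-punchIn c s

<ᵇ-punchIn-suc : ∀ c s → (c <ᵇ punchIn (suc c) s) ≡ (c <ᵇ s)
<ᵇ-punchIn-suc zero zero = refl
<ᵇ-punchIn-suc zero (suc s) = refl
<ᵇ-punchIn-suc (suc c) zero = refl
<ᵇ-punchIn-suc (suc c) (suc s) = <ᵇ-punchIn-suc c s

punchIn-<ᵇ-punchIn-suc : ∀ c k s → (punchIn c k <ᵇ punchIn (suc c) s) ≡ (k <ᵇ s)
punchIn-<ᵇ-punchIn-suc zero k zero = refl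
punchIn-<ᵇ-punchIn-suc zero k (suc s) = refl
punchIn-<ᵇ-punchIn-suc (suc c) zero zero = refl
punchIn-<ᵇ-punchIn-suc (suc c) zero (suc s) = refl
punchIn-<ᵇ-punchIn-suc (suc c) (suc k) zero = refl
punchIn-<ᵇ-punchIn-suc (suc c) (suc k) (suc s) = punchIn-<ᵇ-punchIn-suc c k s

punchIn-<ᵇ-self : ∀ c k → (punchIn c k <ᵇ c) ≡ (k <ᵇ c)
punchIn-<ᵇ-self zero k = refl
punchIn-<ᵇ-self (suc c) zero = refl
punchIn-<ᵇ-self (suc c) (suc k) = punchIn-<ᵇ-self c k

label-old : ∀ c s k → label (punchIn (suc c) s) (punchIn c k) ≡ label s k
label-old c s k rewrite punchIn-<ᵇ-punchIn-suc c k s = refl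

label-split : ∀ c s → label (punchIn (suc c) s) c ≡ label s c
label-split c s rewrite <ᵇ-punchIn-suc c s = refl

label-new : ∀ c s → label (punchIn (suc c) s) (suc c) ≡ label s c
label-new c s rewrite self-<ᵇ-punchIn c s = refl

<ᵇ-true : ∀ {m n} → m < n → (m <ᵇ n) ≡ true
<ᵇ-true {zero} {suc n} _ = refl
<ᵇ-true {suc m} {suc n} (s≤s lt) = <ᵇ-true lt

<ᵇ-false : ∀ {m n} → n ≤ m → (m <ᵇ n) ≡ false
<ᵇ-false {m} {zero} _ = refl
<ᵇ-false {suc m} {suc n} (s≤s le) = <ᵇ-false le

label-● : ∀ {s k} → k < s → label s k ≡ ●
label-● lt rewrite <ᵇ-true lt = refl

label-○ : ∀ {s k} → s ≤ k → label s k ≡ ○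
label-○ le rewrite <ᵇ-false le = refl

module _ {m D} (wf : WellFormed m D) {c} (c≤m : c ≤ m) where

  private
    edges' : nEdges (add c D) ∸ 1 ≡ suc m
    edges' = cong (_∸ 1) (nEdges-add wf c)
    edges₀ : nEdges D ∸ 1 ≡ m
    edges₀ = cong (_∸ 1) (edges wf)

  ordinary-add : ∀ s → ordinary (add c D , punchIn (suc c) s) ↭ suc c ∷ map (punchIn (suc c)) (ordinary (D , s))
  ordinary-add s rewrite edges' | edges₀ = ↭-trans (filter-↭ keep (↭-sym (oneTo-punchIn c≤m))) (↭-reflexive step)
    where
    keep : ℕ → Bool
    keep e = not (e ≡ᵇ punchIn (suc c) s)
    step : filter keep (suc c ∷ map (punchIn (suc c)) (oneTo m)) ≡ suc c ∷ map (punchIn (suc c))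
      (filter (λ e → not (e ≡ᵇ s)) (oneTo m))
    step rewrite punchIn-self-≢ᵇ (suc c) s = cong (suc c ∷_) (trans (filter-map keep (punchIn (suc c)) (oneTo m))
      (cong (map (punchIn (suc c))) (filter-cong (All.map (λ {e} _ → cong not (punchIn-≡ᵇ (suc c) e s)) (oneTo-≤ m)))))

  ordinary-add-new : ordinary (add c D , suc c) ↭ map (punchIn (suc c)) (oneTo m)
  ordinary-add-new rewrite edges' = ↭-trans (filter-↭ keep (↭-sym (oneTo-punchIn c≤m))) (↭-reflexive step)
    where
    keep : ℕ → Bool
    keep e = not (e ≡ᵇ suc c)
    step : filter keep (suc c ∷ map (punchIn (suc c)) (oneTo m)) ≡ map (punchIn (suc c)) (oneTo m)
    step rewrite ≡ᵇ-refl c = filter-all keep (Allₚ.map⁺ (All.map (λ {e} _ → cong not (punchIn-≢ᵇ (suc c) e))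
      (oneTo-≤ m)))

  ordinary-≤ : ∀ s → All (_≤ m) (ordinary (D , s))
  ordinary-≤ s rewrite edges₀ = All-filter (oneTo-≤ m)

  count-ordinary-add : ∀ s (P Q : ℕ → Bool) → (∀ e → e ≤ m → P (punchIn (suc c) e) ≡ Q e) →
    count P (ordinary (add c D , punchIn (suc c) s)) ≡ (if P (suc c) then suc (count Q (ordinary (D , s))) else
      count Q (ordinary (D , s)))
  count-ordinary-add s P Q e = trans (count-↭ P (ordinary-add s)) step
    where
    rest : count P (map (punchIn (suc c)) (ordinary (D , s))) ≡ count Q (ordinary (D , s))
    rest = trans (count-map P (punchIn (suc c)) (ordinary (D , s)))
      (cong length (filter-cong (All.map (λ {x} → e x) (ordinary-≤ s))))
    step : count P (suc c ∷ map (punchIn (suc c)) (ordinary (D , s))) ≡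
      (if P (suc c) then suc (count Q (ordinary (D , s))) else count Q (ordinary (D , s)))
    step with P (suc c)
    ... | true = cong suc rest
    ... | false = rest

  module _ {s} (s≤m : s ≤ m) where

    private
      R1 : ∀ e → inR1 (add c D , punchIn (suc c) s) (punchIn (suc c) e) ≡ inR1 (D , s) e
      R1 e = punchIn-<ᵇ (suc c) e s
      R3 : ∀ e → e ≤ m → inR3 (add c D , punchIn (suc c) s) (punchIn (suc c) e) ≡ inR3 (D , s) e
      R3 e le = cong₂ _<ᵇ_ (pos-add-old wf c e le) (pos-add-old wf c s s≤m)
      R1-new : inR1 (add c D , punchIn (suc c) s) (suc c) ≡ (c <ᵇ s)
      R1-new = self-<ᵇ-punchIn c s
      -- The new edge comes after the secondary edge at the non-root vertex, so it ends in Region 4.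
      R3-new : inR3 (add c D , punchIn (suc c) s) (suc c) ≡ false
      R3-new = trans (cong₂ _<ᵇ_ (pos-add-last wf c) (pos-add-old wf c s s≤m))
                     (<ᵇ-false (ℕₚ.m≤n⇒m≤1+n (WellFormed.within wf s s≤m)))

    α-add : αD (add c D , punchIn (suc c) s) ≡ αD (D , s)
    α-add = trans (count-ordinary-add s _ (λ e → not (inR1 (D , s) e) ∧ inR3 (D , s) e)
      (λ e le → cong₂ (λ p q → not p ∧ q) (R1 e) (R3 e le)))
      (cong (λ b → if b then suc (αD (D , s)) else αD (D , s))
        (trans (cong₂ (λ p q → not p ∧ q) R1-new R3-new) (∧-zeroʳ (not (c <ᵇ s)))))

    β-add : βD (add c D , punchIn (suc c) s) ≡ βD (D , s)
    β-add = trans (count-ordinary-add s _ (λ e → inR1 (D , s) e ∧ inR3 (D , s) e) (λ e le → cong₂ _∧_ (R1 e) (R3 e le)))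
      (cong (λ b → if b then suc (βD (D , s)) else βD (D , s)) (trans (cong₂ _∧_ R1-new R3-new) (∧-zeroʳ (c <ᵇ s))))

    -- Given its end in Region 4, the new edge is a d-edge or a c-edge according to whether the
    -- corner it enters is black or white.
    γ-add : γD (add c D , punchIn (suc c) s) ≡ (if c <ᵇ s then γD (D , s) else suc (γD (D , s)))
    γ-add = trans (count-ordinary-add s _ (λ e → not (inR1 (D , s) e) ∧ not (inR3 (D , s) e))
      (λ e le → cong₂ (λ p q → not p ∧ not q) (R1 e) (R3 e le)))
      (trans (cong (λ b → if b then suc (γD (D , s)) else γD (D , s))
        (trans (cong₂ (λ p q → not p ∧ not q) R1-new R3-new) (∧-identityʳ (not (c <ᵇ s))))) (flip-if (c <ᵇ s)))
      where
      flip-if : ∀ b {x y : ℕ} → (if not b then x else y) ≡ (if b then y else x)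
      flip-if true = refl
      flip-if false = refl

    δ-add : δD (add c D , punchIn (suc c) s) ≡ (if c <ᵇ s then suc (δD (D , s)) else δD (D , s))
    δ-add = trans (count-ordinary-add s _ (λ e → inR1 (D , s) e ∧ not (inR3 (D , s) e))
      (λ e le → cong₂ (λ p q → p ∧ not q) (R1 e) (R3 e le)))
      (cong (λ b → if b then suc (δD (D , s)) else δD (D , s))
        (trans (cong₂ (λ p q → p ∧ not q) R1-new R3-new) (∧-identityʳ (c <ᵇ s))))

    γ+δ-add : γD (add c D , punchIn (suc c) s) + δD (add c D , punchIn (suc c) s) ≡ suc (γD (D , s) + δD (D , s))
    γ+δ-add rewrite γ-add | δ-add with c <ᵇ s
    ... | true = ℕₚ.+-suc _ _
    ... | false = refl

  count-ordinary-add-new : ∀ (P Q : ℕ → Bool) → (∀ e → e ≤ m → P (punchIn (suc c) e) ≡ Q e) →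
    count P (ordinary (add c D , suc c)) ≡ count Q (oneTo m)
  count-ordinary-add-new P Q e = trans (count-↭ P ordinary-add-new) (trans (count-map P (punchIn (suc c)) (oneTo m))
    (cong length (filter-cong (All.map (λ {x} → e x) (oneTo-≤ m)))))

  private
    R1ₙ : ∀ e → inR1 (add c D , suc c) (punchIn (suc c) e) ≡ (e <ᵇ suc c)
    R1ₙ e = punchIn-<ᵇ-self (suc c) e
    R3ₙ : ∀ e → e ≤ m → inR3 (add c D , suc c) (punchIn (suc c) e) ≡ true
    R3ₙ e le = trans (cong₂ _<ᵇ_ (pos-add-old wf c e le) (pos-add-last wf c))
      (<ᵇ-true (s≤s (WellFormed.within wf e le)))

  count-below : ∀ c m → c ≤ m → count (_<ᵇ suc c) (oneTo m) ≡ c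
  count-below c m le = trans (count-map _ suc (upTo m)) (go c m le)
    where
    go : ∀ c m → c ≤ m → count (_<ᵇ c) (upTo m) ≡ c
    go zero m _ = cong length (filter-none _ (All.map (λ _ → refl) (Allₚ.all-upTo m)))
    go (suc c) (suc m) (s≤s le) rewrite sym (Listₚ.map-upTo suc m) = cong suc
      (trans (count-map _ suc (upTo m)) (go c m le))

  count-not : ∀ (P : ℕ → Bool) xs → count P xs + count (not ∘ P) xs ≡ length xs
  count-not P [] = refl
  count-not P (x ∷ xs) with P x
  ... | true = cong suc (count-not P xs)
  ... | false = trans (ℕₚ.+-suc _ _) (cong suc (count-not P xs))

  -- When the last edge is the secondary one, every ordinary edge ends in Region 3. Those numbered 1
  -- to `c` are then the b-edges and all others are a-edges.
  α-add-new : αD (add c D , suc c) ≡ m ∸ c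
  α-add-new = trans (count-ordinary-add-new _ (λ e → not (e <ᵇ suc c))
    (λ e le → trans (cong₂ (λ p q → not p ∧ q) (R1ₙ e) (R3ₙ e le)) (∧-identityʳ _)))
    (trans (sym (ℕₚ.m+n∸m≡n c (count (λ e → not (e <ᵇ suc c)) (oneTo m))))
    (cong (_∸ c) (trans (cong (_+ count (λ e → not (e <ᵇ suc c)) (oneTo m)) (sym (count-below c m c≤m)))
      (trans (count-not (_<ᵇ suc c) (oneTo m)) (trans (Listₚ.length-map suc (upTo m)) (Listₚ.length-upTo m))))))

  β-add-new : βD (add c D , suc c) ≡ c
  β-add-new = trans (count-ordinary-add-new _ (_<ᵇ suc c)
    (λ e le → trans (cong₂ _∧_ (R1ₙ e) (R3ₙ e le)) (∧-identityʳ _))) (count-below c m c≤m)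

  γ-add-new : γD (add c D , suc c) ≡ 0
  γ-add-new = trans (count-ordinary-add-new _ (λ _ → false)
    (λ e le → trans (cong₂ (λ p q → not p ∧ not q) (R1ₙ e) (R3ₙ e le)) (∧-zeroʳ _)))
    (cong length (filter-none (λ _ → false) (All.map (λ _ → refl) (oneTo-≤ m))))

  δ-add-new : δD (add c D , suc c) ≡ 0
  δ-add-new = trans (count-ordinary-add-new _ (λ _ → false)
    (λ e le → trans (cong₂ (λ p q → p ∧ not q) (R1ₙ e) (R3ₙ e le)) (∧-zeroʳ _)))
    (cong length (filter-none (λ _ → false) (All.map (λ _ → refl) (oneTo-≤ m))))

faceWeight : ℕ → ℕ → List ℕ → List (List ℕ) → Monomial
faceWeight δ s xs os = replicate δ w ++ (g (map (label s) (0 ∷ xs)) ∷ map f (map (map (label s)) os))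

rotate-letters : ∀ {L} → Respects L → ∀ (l : ℕ → Label) {os os'} → Pointwise Rotation os os' →
                 L (map f (map (map l) os)) ≡ L (map f (map (map l) os'))
rotate-letters r l [] = refl
rotate-letters {L} r l {o ∷ os} {o' ∷ os'} ((u , v , refl , refl) ∷ rs) = begin
    L (f (map l (u ++ v)) ∷ map f (map (map l) os))
  ≡⟨ cong (λ S → L (f S ∷ map f (map (map l) os))) (Listₚ.map-++ l u v) ⟩
    L (f (map l u ++ map l v) ∷ map f (map (map l) os))
  ≡⟨ rot r (map l u) (map l v) _ ⟩
    L (f (map l v ++ map l u) ∷ map f (map (map l) os))
  ≡⟨ cong (λ S → L (f S ∷ map f (map (map l) os))) (sym (Listₚ.map-++ l v u)) ⟩
    L (f (map l (v ++ u)) ∷ map f (map (map l) os))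
  ≡⟨ rotate-letters (Respects-prefix r (f (map l (v ++ u)) ∷ [])) l rs ⟩
    L (f (map l (v ++ u)) ∷ map f (map (map l) os')) ∎
  where open ≡-Reasoning

bareWeight : DipoleS → Monomial
bareWeight Ds = g (RD Ds) ∷ map f (ΛD Ds)

bareWeight-Structure : ∀ {L} → Respects L → ∀ {m D xs os} → Structure m D xs os → ∀ s →
                       L (bareWeight (D , s)) ≡ L (faceWeight 0 s xs os)
bareWeight-Structure {L} r {m} {D} {xs} {os} st s with nonRootFaces-↭ st
... | os' , rots , p = begin
    L (g (map (label s) (rootFace D)) ∷ map f (map (map (label s)) (nonRootFaces D)))
  ≡⟨ cong (λ l → L (g (map (label s) l) ∷ map f (map (map (label s)) (nonRootFaces D)))) (rootFace-≡ st) ⟩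
    L (g (map (label s) (0 ∷ xs)) ∷ map f (map (map (label s)) (nonRootFaces D)))
  ≡⟨ perm r (prep _ (↭ₚ.map⁺ f (↭ₚ.map⁺ (map (label s)) p))) ⟩
    L (g (map (label s) (0 ∷ xs)) ∷ map f (map (map (label s)) os'))
  ≡⟨ sym (rotate-letters (Respects-prefix r (g (map (label s) (0 ∷ xs)) ∷ [])) (label s) rots) ⟩
    L (faceWeight 0 s xs os) ∎
  where open ≡-Reasoning

weight-Structure : ∀ {L} → Respects L → ∀ {m D xs os} → Structure m D xs os → ∀ s →
                   L (weight (D , s)) ≡ L (faceWeight (δD (D , s)) s xs os)
weight-Structure r {D = D} st s = bareWeight-Structure (Respects-prefix r (replicate (δD (D , s)) w)) st s

-- The recursion in the number of c- and d-edges

-- Here `k` is twice the genus.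
hasExcess : ℕ → Dipole → Bool
hasExcess k D = nEdges D ≡ᵇ nFaces D + k

selects : (k a b c : ℕ) → DipoleS → Bool
selects k a b c Ds = (suc (αD Ds) ≡ᵇ a) ∧ (βD Ds ≡ᵇ b) ∧ ((γD Ds + δD Ds) ≡ᵇ c) ∧ hasExcess k (proj₁ Ds)

[_]_ : Bool → ℤ → ℤ
[ b ] z = if b then z else + 0

⟦GammaU⟧ : ∀ k a b c {m} → a + b + c ≡ m → ∀ L →
           ⟦ GammaU k a b c ⟧ L ≡ ∑ (dips m) (λ D → ∑ (oneTo m) (λ s → [ selects k a b c (D , s) ] L (weight (D , s))))
⟦GammaU⟧ k a b c {m} refl L = begin
    ⟦ GammaU k a b c ⟧ L
  ≡⟨ ∑-map (λ Ds → + 1 , weight Ds) (filter P (dipolesS (m + 1))) ⟩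
    ∑ (filter P (dipolesS (m + 1))) (λ Ds → + 1 ℤ.* L (weight Ds))
  ≡⟨ ∑-cong (filter P (dipolesS (m + 1))) (λ Ds → ℤₚ.*-identityˡ (L (weight Ds))) ⟩
    ∑ (filter P (dipolesS (m + 1))) (L ∘ weight)
  ≡⟨ ∑-filter P (dipolesS (m + 1)) ⟩
    ∑ (dipolesS (m + 1)) φ
  ≡⟨ cong (λ n → ∑ (dipolesS n) φ) (ℕₚ.+-comm m 1) ⟩
    ∑ (dipolesS (suc m)) φ
  ≡⟨ ∑-concatMap (λ D → map (D ,_) (oneTo m)) (dipoles (suc m)) ⟩
    ∑ (dipoles (suc m)) (λ D → ∑ (map (D ,_) (oneTo m)) φ)
  ≡⟨ ∑-dipoles m _ ⟩
    ∑ (dips m) (λ D → ∑ (map (D ,_) (oneTo m)) φ)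
  ≡⟨ ∑-cong (dips m) (λ D → ∑-map (D ,_) (oneTo m)) ⟩
    ∑ (dips m) (λ D → ∑ (oneTo m) (λ s → φ (D , s))) ∎
  where
  open ≡-Reasoning
  P : DipoleS → Bool
  P = selects k a b c
  φ : DipoleS → ℤ
  φ Ds = [ P Ds ] L (weight Ds)

∑-[] : (xs : List A) (b : Bool) {φ : A → ℤ} → ∑ xs (λ x → [ b ] φ x) ≡ [ b ] ∑ xs φ
∑-[] xs true = refl
∑-[] xs false = ∑-zero xs

labels-old : ∀ c s xs → map (label (punchIn (suc c) s)) (map (punchIn c) xs) ≡ map (label s) xs
labels-old c s xs = trans (sym (Listₚ.map-∘ xs)) (Listₚ.map-cong (label-old c s) xs)

labels-old² : ∀ c s os → map (map (label (punchIn (suc c) s))) (map (map (punchIn c)) os) ≡ map (map (label s)) os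
labels-old² c s os = trans (sym (Listₚ.map-∘ os)) (Listₚ.map-cong (labels-old c s) os)

-- The new face is listed from its new corner `suc c`, whereas `C''` writes that label last: one
-- rotation. Besides, the `w` of a new d-edge is joined to those already present.
cut-monomial : ∀ {L} → Respects L → ∀ b δ G (U : Word) Λ → let l = if b then ● else ○ in
  L (replicate (if b then suc δ else δ) w ++ (G ∷ f (l ∷ U) ∷ Λ)) ≡ L
    (replicate δ w ++ ((wIf l ++ (G ∷ f (U ++ l ∷ []) ∷ [])) ++ Λ))
cut-monomial r true δ G U Λ =
  trans (perm r (↭-sym (↭ₚ.shift w (replicate δ w) _)))
        (rotated (Respects-prefix (Respects-prefix r (replicate δ w)) (w ∷ [])) G)
  where
  rotated : ∀ {L} → Respects L → ∀ G → L (G ∷ f (● ∷ U) ∷ Λ) ≡ L (G ∷ f (U ++ ● ∷ []) ∷ Λ)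
  rotated r G = rot (Respects-prefix r (G ∷ [])) (● ∷ []) U Λ
cut-monomial r false δ G U Λ = rot (Respects-prefix (Respects-prefix r (replicate δ w)) (G ∷ [])) (○ ∷ []) U Λ

length-concat : ∀ {F} os → All (Cycle F) os → length os ≤ length (concat os)
length-concat [] [] = z≤n
length-concat ((x ∷ o) ∷ os) (_ ∷ cs) = s≤s (ℕₚ.≤-trans (length-concat os cs)
  (ℕₚ.≤-trans (ℕₚ.m≤n+m _ (length o)) (ℕₚ.≤-reflexive (sym (Listₚ.length-++ o)))))

length-cover : ∀ {m D xs os} → Structure m D xs os → length xs + length (concat os) ≡ m
length-cover {m} {xs = xs} st = ℕₚ.suc-injective (trans (cong suc (sym (Listₚ.length-++ xs)))
  (trans (↭ₚ.↭-length (cover st)) (Listₚ.length-upTo (suc m))))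

-- Faces are nonempty, so `suc m` faces on `suc m` corners are all singletons.
planar-root : ∀ {m D xs os} → Structure m D xs os → m ≡ length os → xs ≡ []
planar-root {xs = []} st e = refl
planar-root {m} {xs = x ∷ xs} {os} st e = ⊥-elim (ℕₚ.<-irrefl (sym e) (ℕₚ.≤-trans (s≤s (length-concat os (cycles st)))
  (ℕₚ.≤-trans (s≤s (ℕₚ.m≤n+m _ (length xs))) (ℕₚ.≤-reflexive (length-cover st)))))

hasExcess-≡ : ∀ {m D xs os} → Structure m D xs os → ∀ k → hasExcess k D ≡ (m ≡ᵇ length os + k)
hasExcess-≡ st k = cong₂ (λ p q → p ≡ᵇ q + k) (edges (wellFormed st)) (nFaces-≡ st)

every : (xs : List A) → All (λ x → ∃[ ys ] xs ↭ x ∷ ys) xs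
every [] = []
every (x ∷ xs) = (xs , ↭-refl) ∷ All.map (λ { {y} (ys , p) → x ∷ ys , ↭-trans (prep x p) (swap x y ↭-refl) }) (every xs)

middle : ∀ {P : A → Set} us {c vs} → All P (us ++ c ∷ vs) → P c
middle us a = All.head (proj₂ (Allₚ.++⁻ us a))

corners-bounded : ∀ {m D xs os} → Structure m D xs os → All (_< suc m) (0 ∷ xs ++ concat os)
corners-bounded {m} st = ↭ₚ.All-resp-↭ (↭-sym (cover st)) (Allₚ.all-upTo (suc m))

record Joined (m : ℕ) (D : Dipole) (os : List (List ℕ)) (c : ℕ) : Set where
  field
    {os'} : List (List ℕ)
    {xs'} : List ℕ
    c≤m : c ≤ m
    structure : Structure (suc m) (add c D) xs' os'
    fewer : length os ≡ suc (length os')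

-- Any corner off the root face becomes the first corner of the first listed face after a
-- permutation of the faces and a rotation.
joins : ∀ {m D xs os} → Structure m D xs os → All (Joined m D os) (concat os)
joins {m} {D} {xs} {os} st = Allₚ.concat⁺ (All.map (λ { {o} (os' , p) → All.map
  (λ { {c} (us , vs , e) → joined o os' p c us vs e }) (every-split o) }) (every os))
  where
  joined : ∀ o os' → os ↭ o ∷ os' → ∀ c us vs → us ++ c ∷ vs ≡ o → Joined m D os c
  joined _ os' p c us vs refl = record
    { c≤m = s≤s⁻¹ (middle us (proj₁ (Allₚ.++⁻ (us ++ c ∷ vs) (proj₂ (Allₚ.++⁻ xs (All.tail (corners-bounded st')))))))
    ; structure = Structure-join (Structure-rotate us st')
    ; fewer = trans (↭ₚ.↭-length p) (cong suc (sym (Listₚ.length-map _ os'))) }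
    where
    st' : Structure m D xs ((us ++ c ∷ vs) ∷ os')
    st' = Structure-↭ p st

module _ {m D} (wf : WellFormed m D) {s₀} (s≤m : suc s₀ ≤ m) where

  private
    -- Written as a successor so that the root corner has label `●` by computation.
    s = suc s₀
    δ = δD (D , s)

  selects-add : ∀ {c₀} → c₀ ≤ m → ∀ a b c k → hasExcess 2 (add c₀ D) ≡ hasExcess k D →
                selects 2 a b (suc c) (add c₀ D , punchIn (suc c₀) s) ≡ selects k a b c (D , s)
  selects-add {c₀} c₀≤m a b c k e = cong₂ _∧_ (cong (λ n → suc n ≡ᵇ a) (α-add wf c₀≤m s≤m))
    (cong₂ _∧_ (cong (_≡ᵇ b) (β-add wf c₀≤m s≤m)) (cong₂ _∧_ (cong (_≡ᵇ suc c) (γ+δ-add wf c₀≤m s≤m)) e))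

  module _ {L} (r : Respects L) {xs os} (st : Structure m D xs os) where

    private
      Λ = map f (map (map (label s)) os)
      K : Functional
      K t = L (replicate δ w ++ (t ++ Λ))

    weight-cut-root : L (weight (add 0 D , punchIn 1 s)) ≡ K (w ∷ g (● ∷ []) ∷ f (● ∷ map (label s) xs) ∷ [])
    weight-cut-root = trans (weight-Structure r (Structure-cut-root st) (punchIn 1 s)) (trans
      (cong L (trans (cong (λ n → faceWeight n (punchIn 1 s) [] ((1 ∷ map suc xs) ∷ map (map suc) os))
        (δ-add wf z≤n s≤m))
        (cong₂ (λ R Λ' → replicate (suc δ) w ++ (g (● ∷ []) ∷ f (● ∷ R) ∷ map f Λ')) (labels-old 0 s xs)
          (labels-old² 0 s os))))
      (perm r (↭-sym (↭ₚ.shift w (replicate δ w) _))))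

    weight-cut : ∀ us c vs → us ++ c ∷ vs ≡ xs → c ≤ m × L (weight (add c D , punchIn (suc c) s)) ≡
                 K (cutMonomial ● (map (label s) us) (label s c) (map (label s) vs))
    weight-cut us c vs refl = c≤m , trans (weight-Structure r (Structure-cut us vs st) (punchIn (suc c) s)) (trans
      (cong L (trans (cong (λ n → faceWeight n (punchIn (suc c) s) (c ∷ map (punchIn c) vs)
        ((suc c ∷ map (punchIn c) us) ∷ map (map (punchIn c)) os)) (δ-add wf c≤m s≤m))
         (words (label-split c s) (labels-old c s vs) (label-new c s) (labels-old c s us) (labels-old² c s os))))
      (cut-monomial r (c <ᵇ s) δ _ (map (label s) us) Λ))
      where
      c≤m : c ≤ m
      c≤m = s≤s⁻¹ (middle us (proj₁ (Allₚ.++⁻ (us ++ c ∷ vs) (All.tail (corners-bounded st)))))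
      words : ∀ {n} {l l' l₂ l₂' : Label} {V V' U U' : Word} {W W' : List Word} → l ≡ l' → V ≡ V' → l₂ ≡ l₂' → U ≡
        U' → W ≡ W' →
        replicate n w ++ (g (● ∷ l ∷ V) ∷ f (l₂ ∷ U) ∷ map f W) ≡ replicate n w ++
          (g (● ∷ l' ∷ V') ∷ f (l₂' ∷ U') ∷ map f W')
      words refl refl refl refl refl = refl

    -- Corner by corner, the terms of `C''` are the weights after a cut along the root face. The
    -- root corner accounts for the term with the prefactor `w`: an edge entering it ends in Region
    -- 1.
    ∂-cuts : ∂ L (weight (D , s)) ≡ ∑ (0 ∷ xs) (λ c → L (weight (add c D , punchIn (suc c) s)))
    ∂-cuts = begin
        ∂ L (weight (D , s))
      ≡⟨ weight-Structure (∂-Respects r) st s ⟩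
        ∂ L (faceWeight δ s xs os)
      ≡⟨ ∂-weight δ (● ∷ map (label s) xs) (map (map (label s)) os) ⟩
        ⟦ C''g (● ∷ map (label s) xs) ⟧ K
      ≡⟨ ⟦C''g⟧ ● (map (label s) xs) ⟩
        ∑ (splits (map (label s) xs)) (λ (us , c , vs) → K (cutMonomial ● us c vs)) ℤ.+ last
      ≡⟨ cong (ℤ._+ last) (∑-splits-map (label s) xs) ⟩
        ∑ (splits xs) (λ (us , c , vs) → K (cutMonomial ● (map (label s) us) (label s c) (map (label s) vs))) ℤ.+ last
      ≡⟨ cong (ℤ._+ last) (∑-cong-All (All.map (λ { {us , c , vs} e → sym (proj₂ (weight-cut us c vs e)) })
        (splits-++ xs))) ⟩
        ∑ (splits xs) (λ (us , c , vs) → cut c) ℤ.+ last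
      ≡⟨ cong₂ ℤ._+_ (∑-splits xs {cut}) (sym weight-cut-root) ⟩
        ∑ xs cut ℤ.+ cut 0
      ≡⟨ ℤₚ.+-comm (∑ xs cut) (cut 0) ⟩
        ∑ (0 ∷ xs) cut ∎
      where
      open ≡-Reasoning
      last : ℤ
      last = K (w ∷ g (● ∷ []) ∷ f (● ∷ map (label s) xs) ∷ [])
      cut : ℕ → ℤ
      cut c = L (weight (add c D , punchIn (suc c) s))

    excess-cut : All (λ c → c ≤ m × hasExcess 2 (add c D) ≡ hasExcess 2 D) (0 ∷ xs)
    excess-cut = (z≤n , trans (hasExcess-≡ (Structure-cut-root st) 2)
      (trans (cong (λ n → m ≡ᵇ n + 2) (Listₚ.length-map (map suc) os)) (sym (hasExcess-≡ st 2))))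
      ∷ All.map (λ { {c} (us , vs , e) → proj₁ (weight-cut us c vs e) , excess us c vs e }) (every-split xs)
      where
      excess : ∀ us c vs → us ++ c ∷ vs ≡ xs → hasExcess 2 (add c D) ≡ hasExcess 2 D
      excess us c vs refl = trans (hasExcess-≡ (Structure-cut us vs st) 2)
        (trans (cong (λ n → m ≡ᵇ n + 2) (Listₚ.length-map (map (punchIn c)) os)) (sym (hasExcess-≡ st 2)))

    -- A join adds an edge and loses a face, raising the excess by two.
    excess-join : All (λ c → c ≤ m × hasExcess 2 (add c D) ≡ hasExcess 0 D) (concat os)
    excess-join = All.map (λ {c} j → Joined.c≤m j , excess c j) (joins st)
      where
      excess : ∀ c → Joined m D os c → hasExcess 2 (add c D) ≡ hasExcess 0 D
      excess c j = trans (hasExcess-≡ (Joined.structure j) 2)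
        (trans (cong (suc m ≡ᵇ_) (ℕₚ.+-comm (length (Joined.os' j)) 2))
        (sym (trans (hasExcess-≡ st 0) (cong (m ≡ᵇ_) (trans (ℕₚ.+-identityʳ (length os)) (Joined.fewer j))))))

    insertions : ∀ a b c →
      ∑ (upTo (suc m)) (λ c₀ → [ selects 2 a b (suc c) (add c₀ D , punchIn (suc c₀) s) ] L
        (weight (add c₀ D , punchIn (suc c₀) s))) ≡
      ([ selects 2 a b c (D , s) ] ∂ L (weight (D , s))) ℤ.+
      ([ selects 0 a b c (D , s) ] ∑ (oneTo m) (λ c₀ → L (weight (add c₀ D , punchIn (suc c₀) s))))
    insertions a b c = begin
        ∑ (upTo (suc m)) φ
      ≡⟨ ∑-↭ {φ = φ} (↭-sym (cover st)) ⟩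
        ∑ ((0 ∷ xs) ++ concat os) φ
      ≡⟨ ∑-++ (0 ∷ xs) (concat os) {φ} ⟩
        ∑ (0 ∷ xs) φ ℤ.+ ∑ (concat os) φ
      ≡⟨ cong₂ ℤ._+_ (trans (∑-cong-All {xs = 0 ∷ xs} {φ = φ} {ψ = λ c₀ → [ selects 2 a b c (D , s) ] v c₀}
        (selected 2 excess-cut))
                            (∑-[] (0 ∷ xs) (selects 2 a b c (D , s)) {v}))
                     (trans (∑-cong-All (selected 0 excess-join)) (∑-[] (concat os) (selects 0 a b c (D , s)) {v})) ⟩
        ([ selects 2 a b c (D , s) ] ∑ (0 ∷ xs) v) ℤ.+ ([ selects 0 a b c (D , s) ] ∑ (concat os) v)
      ≡⟨ cong₂ ℤ._+_ (cong ([ selects 2 a b c (D , s) ]_) (sym ∂-cuts)) (all-joins (selects 0 a b c (D , s)) refl) ⟩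
        ([ selects 2 a b c (D , s) ] ∂ L (weight (D , s))) ℤ.+ ([ selects 0 a b c (D , s) ] ∑ (oneTo m) v) ∎
      where
      open ≡-Reasoning
      v φ : ℕ → ℤ
      v c₀ = L (weight (add c₀ D , punchIn (suc c₀) s))
      φ c₀ = [ selects 2 a b (suc c) (add c₀ D , punchIn (suc c₀) s) ] v c₀
      selected : ∀ k {cs} → All (λ c₀ → c₀ ≤ m × hasExcess 2 (add c₀ D) ≡ hasExcess k D) cs →
                 All (λ c₀ → φ c₀ ≡ [ selects k a b c (D , s) ] v c₀) cs
      selected k = All.map (λ { {c₀} (le , e) → cong ([_] v c₀) (selects-add le a b c k e) })
      -- Selection forces genus zero. Then the root face is the root corner alone, so the corners
      -- off the root face are precisely those from 1 to `m`.
      all-joins : ∀ t → selects 0 a b c (D , s) ≡ t → ([ t ] ∑ (concat os) v) ≡ ([ t ] ∑ (oneTo m) v)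
      all-joins false e = refl
      all-joins true e = ∑-↭ (nonroot (planar-root st planar))
        where
        planar : m ≡ length os
        planar = trans (≡ᵇ-sound m (length os + 0) (trans (sym (hasExcess-≡ st 0))
          (proj₂ (∧-true {(γD (D , s) + δD (D , s)) ≡ᵇ c}
            (proj₂ (∧-true {βD (D , s) ≡ᵇ b} (proj₂ (∧-true {suc (αD (D , s)) ≡ᵇ a} e))))))))
          (ℕₚ.+-identityʳ _)
        nonroot : xs ≡ [] → concat os ↭ oneTo m
        nonroot refl = ↭ₚ.drop-∷ (↭-trans (cover st) (↭-reflexive (upTo-suc m)))

∃Structure : ℕ → Dipole → Set
∃Structure m D = ∃[ xs ] ∃[ os ] Structure m D xs os

Structure-dips : ∀ m → All (∃Structure m) (dips m)
Structure-dips = All-dips ∃Structure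
  ([] , [] , record { wellFormed = record { starts = refl ; size = refl ; within = λ { zero z≤n → z≤n } } ; root =
    refl ; cycles = [] ; cover = ↭-refl })
  (λ { {m} {D} {c} c≤m (xs , os , st) → extended c≤m st (find c xs os
    (↭ₚ.All-resp-↭ (↭-sym (cover st)) (upTo-≤ m)) st c≤m) })
  where
  data Place {m D xs os} (c : ℕ) (st : Structure m D xs os) : Set where
    at-root : c ≡ 0 → Place c st
    in-root : ∀ us vs → us ++ c ∷ vs ≡ xs → Place c st
    elsewhere : Joined m D os c → Place c st
  find : ∀ {m D} c xs os → All (_≤ m) (0 ∷ xs ++ concat os) → (st : Structure m D xs os) → c ≤ m → Place c st
  find {m} c xs os _ st c≤m = search (↭ₚ.All-resp-↭ (cover st) places)
    where
    places : All (λ z → Place z st) (0 ∷ xs ++ concat os)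
    places = at-root refl ∷ Allₚ.++⁺ (All.map (λ { (us , vs , e) → in-root us vs e }) (every-split xs))
      (All.map elsewhere (joins st))
    search : All (λ z → Place z st) (upTo (suc m)) → Place c st
    search ps = Allₚ.applyUpTo⁻ id (suc m) ps (s≤s c≤m)
  extended : ∀ {m D c xs os} → c ≤ m → (st : Structure m D xs os) → Place c st → ∃Structure (suc m) (add c D)
  extended _ st (at-root refl) = _ , _ , Structure-cut-root st
  extended _ st (in-root us vs refl) = _ , _ , Structure-cut us vs st
  extended _ st (elsewhere j) = _ , _ , Joined.structure j

joinSum : ℕ → Functional → DipoleS → ℤ
joinSum m L (D , s) = ∑ (oneTo m) (λ c₀ → L (weight (add c₀ D , punchIn (suc c₀) s)))

Γ-recursion : ∀ {L} → Respects L → ∀ a b c {m} → a + b + c ≡ m →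
  ⟦ GammaU 2 a b (suc c) ⟧ L ≡
  ⟦ GammaU 2 a b c ⟧ (∂ L) ℤ.+ ∑ (dips m) (λ D → ∑ (oneTo m) (λ s → [ selects 0 a b c (D , s) ] joinSum m L (D , s)))
Γ-recursion {L} r a b c {m} e = begin
    ⟦ GammaU 2 a b (suc c) ⟧ L
  ≡⟨ ⟦GammaU⟧ 2 a b (suc c) (trans (ℕₚ.+-suc (a + b) c) (cong suc e)) L ⟩
    ∑ (dips (suc m)) (λ D' → ∑ (oneTo (suc m)) (λ s' → φ D' s'))
  ≡⟨ ∑-dips-suc m (λ D' → ∑ (oneTo (suc m)) (λ s' → φ D' s')) ⟩
    ∑ (dips m) (λ D → ∑ (upTo (suc m)) (λ c₀ → ∑ (oneTo (suc m)) (λ s' → φ (add c₀ D) s')))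
  ≡⟨ ∑-cong-All {φ = λ D → ∑ (upTo (suc m)) (λ c₀ → ∑ (oneTo (suc m)) (λ s' → φ (add c₀ D) s'))}
    (All.map perDipole (Structure-dips m)) ⟩
    ∑ (dips m) (λ D → ∑ (oneTo m) (λ s → G D s) ℤ.+ ∑ (oneTo m) (λ s → J D s))
  ≡⟨ ∑-+ (dips m) ⟩
    ∑ (dips m) (λ D → ∑ (oneTo m) (λ s → G D s)) ℤ.+ ∑ (dips m) (λ D → ∑ (oneTo m) (λ s → J D s))
  ≡⟨ cong (ℤ._+ ∑ (dips m) (λ D → ∑ (oneTo m) (λ s → J D s))) (sym (⟦GammaU⟧ 2 a b c e (∂ L))) ⟩
    ⟦ GammaU 2 a b c ⟧ (∂ L) ℤ.+ ∑ (dips m) (λ D → ∑ (oneTo m) (λ s → J D s)) ∎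
  where
  open ≡-Reasoning
  φ G J : Dipole → ℕ → ℤ
  φ D' s' = [ selects 2 a b (suc c) (D' , s') ] L (weight (D' , s'))
  G D s = [ selects 2 a b c (D , s) ] ∂ L (weight (D , s))
  J D s = [ selects 0 a b c (D , s) ] joinSum m L (D , s)
  -- With the last edge as secondary edge there are no c- or d-edges, so no positive power of `v`.
  secondary-last : ∀ {D} → WellFormed m D → ∀ {c₀} → c₀ ≤ m → φ (add c₀ D) (suc c₀) ≡ + 0
  secondary-last {D} wf {c₀} le = cong ([_] L (weight (add c₀ D , suc c₀))) none
    where
    none : selects 2 a b (suc c) (add c₀ D , suc c₀) ≡ false
    none = trans (cong ((suc (αD (add c₀ D , suc c₀)) ≡ᵇ a) ∧_) (trans (cong ((βD (add c₀ D , suc c₀) ≡ᵇ b) ∧_)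
      (cong (λ n → (n ≡ᵇ suc c) ∧ hasExcess 2 (add c₀ D)) (cong₂ _+_ (γ-add-new wf le) (δ-add-new wf le))))
        (∧-zeroʳ _))) (∧-zeroʳ _)
  perDipole : ∀ {D} → ∃Structure m D → ∑ (upTo (suc m)) (λ c₀ → ∑ (oneTo (suc m)) (λ s' → φ (add c₀ D) s')) ≡
              ∑ (oneTo m) (λ s → G D s) ℤ.+ ∑ (oneTo m) (λ s → J D s)
  perDipole {D} (xs , os , st) = begin
      ∑ (upTo (suc m)) (λ c₀ → ∑ (oneTo (suc m)) (φ (add c₀ D)))
    ≡⟨ ∑-cong-All {φ = λ c₀ → ∑ (oneTo (suc m)) (φ (add c₀ D))}
      {ψ = λ c₀ → ∑ (oneTo m) (λ s → φ (add c₀ D) (punchIn (suc c₀) s))}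
         (All.map (λ {c₀} le → trans (∑-↭ {φ = φ (add c₀ D)} (↭-sym (oneTo-punchIn le)))
         (trans (cong₂ ℤ._+_ (secondary-last (wellFormed st) le)
           (∑-map (punchIn (suc c₀)) (oneTo m) {φ (add c₀ D)})) (ℤₚ.+-identityˡ _))) (upTo-≤ m)) ⟩
      ∑ (upTo (suc m)) (λ c₀ → ∑ (oneTo m) (λ s → φ (add c₀ D) (punchIn (suc c₀) s)))
    ≡⟨ ∑-swap (upTo (suc m)) (oneTo m) {λ c₀ s → φ (add c₀ D) (punchIn (suc c₀) s)} ⟩
      ∑ (oneTo m) (λ s → ∑ (upTo (suc m)) (λ c₀ → φ (add c₀ D) (punchIn (suc c₀) s)))
    ≡⟨ ∑-cong-All {φ = λ s → ∑ (upTo (suc m)) (λ c₀ → φ (add c₀ D) (punchIn (suc c₀) s))}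
      {ψ = λ s → G D s ℤ.+ J D s} (Allₚ.map⁺ (All.map (λ lt → insertions (wellFormed st) lt r st a b c)
        (Allₚ.all-upTo m))) ⟩
      ∑ (oneTo m) (λ s → G D s ℤ.+ J D s)
    ≡⟨ ∑-+ (oneTo m) {G D} {J D} ⟩
      ∑ (oneTo m) (λ s → G D s) ℤ.+ ∑ (oneTo m) (λ s → J D s) ∎

-- The shapes of dipoles of genus at most one

-- The list 0, m, m-1, ..., 1: opposite cyclic orders at the two vertices, so that every corner is a
-- face of its own.
planarDipole : ℕ → Dipole
planarDipole zero = 0 ∷ []
planarDipole (suc m) = add 0 (planarDipole m)

-- Cycle types of the face permutation: planar is the identity, three p q is (0 p q) and two q p r is (0 p)(q r).
data Shape : Set where
  planar : Shape
  three  : (p q : ℕ) → Shape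
  two    : (q p r : ℕ) → Shape

singles : List ℕ → List (List ℕ)
singles = map (_∷ [])

HasShape : ℕ → Dipole → Shape → Set
HasShape m D planar = D ≡ planarDipole m × ∃[ zs ] Structure m D [] (singles zs)
HasShape m D (three p q) = p < q × ∃[ zs ] Structure m D (p ∷ q ∷ []) (singles zs)
HasShape m D (two q p r) = q < p × p < r × ∃[ zs ] Structure m D (p ∷ []) ((q ∷ r ∷ []) ∷ singles zs)

-- What `shapes` leaves out: genus at least two, and genus one with the root corner alone in its
-- face. The class is closed under insertion, since a cut away from the root corner needs a longer
-- root face and a join raises the genus beyond one.
record Shapeless (m : ℕ) (D : Dipole) : Set where
  field
    {xs} : List ℕ
    {os} : List (List ℕ)
    structure : Structure m D xs os
    notPlanar : m ≢ length os
    rootFixed : m ≡ length os + 2 → xs ≡ []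

-- The insertions that stay among the shapes. A join of the planar dipole at `c` gives (0 c c+1).
-- Cutting (0 p q) at `p` splits off the fixed corner p+1, cutting it at `q` splits off the
-- transposition of `p` and q+1. In a double transposition only the cut at `p` remains.
grow : ℕ → Shape → List Shape
grow m planar = planar ∷ map (λ c → three c (suc c)) (oneTo m)
grow m (three p q) = three p (suc q) ∷ two p q (suc q) ∷ []
grow m (two q p r) = two q p (suc r) ∷ []

shapes : ℕ → List Shape
shapes zero = planar ∷ []
shapes (suc m) = concatMap (grow m) (shapes m)

concat-singles : ∀ zs → concat (singles zs) ≡ zs
concat-singles [] = refl
concat-singles (z ∷ zs) = cong (z ∷_) (concat-singles zs)

map-singles : ∀ (k : ℕ → ℕ) zs → map (map k) (singles zs) ≡ singles (map k zs)
map-singles k [] = refl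
map-singles k (z ∷ zs) = cong ((k z ∷ []) ∷_) (map-singles k zs)

length-singles : ∀ {m D xs os} zs → Structure m D xs (os ++ singles zs) → length xs +
  (length (concat os) + length zs) ≡ m
length-singles {xs = xs} {os} zs st = trans (cong (λ z → length xs + z)
  (sym (trans (cong length (sym (Listₚ.concat-++ os (singles zs))))
  (trans (Listₚ.length-++ (concat os)) (cong (λ l → length (concat os) + length l) (concat-singles zs))))))
    (length-cover st)

private
  far : ∀ k n → k + suc n ≢ n
  far k n e = ℕₚ.<-irrefl (sym e) (ℕₚ.m≤n+m (suc n) k)

  shapeless-cut-root : ∀ {m D xs os} → Structure m D xs os → m ≢ length os → Shapeless (suc m) (add 0 D)
  shapeless-cut-root {os = os} st ne = record
    { structure = Structure-cut-root st
    ; notPlanar = λ e → ne (trans (ℕₚ.suc-injective e) (Listₚ.length-map (map suc) os))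
    ; rootFixed = λ _ → refl }

  shapeless-join : ∀ {m D os c} → length os ≤ m → m ≢ length os → Joined m D os c → Shapeless (suc m) (add c D)
  shapeless-join {m} {os = os} le ne j = record
    { structure = Joined.structure j
    ; notPlanar = λ e → ℕₚ.<-irrefl (sym e) (s≤s (ℕₚ.≤-trans (ℕₚ.n≤1+n _)
      (ℕₚ.≤-trans (ℕₚ.≤-reflexive (sym (Joined.fewer j))) le)))
    ; rootFixed = λ e → ⊥-elim (ne (trans (ℕₚ.suc-injective (trans e (ℕₚ.+-comm _ 2))) (sym (Joined.fewer j)))) }

faces-≤ : ∀ {m D xs os} → Structure m D xs os → length os ≤ m
faces-≤ {xs = xs} {os} st = ℕₚ.≤-trans (length-concat os (cycles st))
  (ℕₚ.≤-trans (ℕₚ.m≤n+m _ (length xs)) (ℕₚ.≤-reflexive (length-cover st)))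

module _ {m : ℕ} {h : Dipole → ℤ} {H : Shape → ℤ}
         (shaped : ∀ D t → HasShape (suc m) D t → h D ≡ H t)
         (shapeless : ∀ D → Shapeless (suc m) D → h D ≡ + 0) where

  private
    h' : Dipole → ℤ
    h' D = ∑ (upTo (suc m)) (λ c → h (add c D))

    covered : ∀ {D xs os} → Structure m D xs os → h' D ≡ h (add 0 D) ℤ.+
      (∑ xs (λ c → h (add c D)) ℤ.+ ∑ (concat os) (λ c → h (add c D)))
    covered {D} {xs} {os} st = trans (∑-↭ {φ = λ c → h (add c D)} (↭-sym (cover st)))
      (cong (ℤ._+_ (h (add 0 D))) (∑-++ xs (concat os)))

    joins-vanish : ∀ {D xs os} → Structure m D xs os → m ≢ length os → ∑ (concat os) (λ c → h (add c D)) ≡ + 0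
    joins-vanish st ne = ∑-zero-All (All.map (λ {c} j → shapeless _ (shapeless-join (faces-≤ st) ne j)) (joins st))

    root-vanishes : ∀ {D xs os} → Structure m D xs os → m ≢ length os → h (add 0 D) ≡ + 0
    root-vanishes st ne = shapeless _ (shapeless-cut-root st ne)

  grow-shape : ∀ D t → HasShape m D t → h' D ≡ ∑ (grow m t) H
  grow-shape D planar (refl , zs , st) = trans (∑-upTo-suc m (λ c → h (add c D))) (cong₂ ℤ._+_
    (shaped _ planar (refl , _ , subst (Structure (suc m) (add 0 D) []) (cong ((1 ∷ []) ∷_) (map-singles suc zs))
      (Structure-cut-root st)))
    (trans (sym (∑-map suc (upTo m) {λ c → h (add c D)}))
      (trans (∑-cong-All {xs = oneTo m} {φ = λ c → h (add c D)} {ψ = λ c → H (three c (suc c))}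
        (↭ₚ.All-resp-↭ zs↭ joined))
      (sym (∑-map (λ c → three c (suc c)) (oneTo m) {H})))))
    where
    zs↭ : zs ↭ oneTo m
    zs↭ = ↭ₚ.drop-∷ (↭-trans (↭-reflexive (cong (0 ∷_) (sym (concat-singles zs))))
      (↭-trans (cover st) (↭-reflexive (upTo-suc m))))
    joined : All (λ c → h (add c D) ≡ H (three c (suc c))) zs
    joined = All.map (λ { {c} (zs' , p) → shaped _ (three c (suc c)) (ℕₚ.≤-refl , _ ,
        subst (Structure (suc m) (add c D) (c ∷ suc c ∷ [])) (map-singles (punchIn c) zs')
          (Structure-join (Structure-↭ (↭ₚ.map⁺ (_∷ []) p) st))) }) (every zs)
  grow-shape D (three p q) (p<q , zs , st) = trans (covered st)
    (trans (cong₂ ℤ._+_ (root-vanishes st ne) (cong₂ ℤ._+_ (cong₂ ℤ._+_ at-p (cong (λ z → z ℤ.+ + 0) at-q))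
      (joins-vanish st ne)))
    (trans (ℤₚ.+-identityˡ _) (ℤₚ.+-identityʳ _)))
    where
    ne : m ≢ length (singles zs)
    ne e = far 1 (length zs) (trans (length-singles {os = []} zs st) (trans e (Listₚ.length-map _ zs)))
    at-p : h (add p D) ≡ H (three p (suc q))
    at-p = shaped _ (three p (suc q)) (ℕₚ.m≤n⇒m≤1+n p<q , _ ,
      subst₂ (λ x os → Structure (suc m) (add p D) (p ∷ x ∷ []) os) (punchIn-≥ (ℕₚ.<⇒≤ p<q))
        (cong ((suc p ∷ []) ∷_) (map-singles (punchIn p) zs)) (Structure-cut [] (q ∷ []) st))
    at-q : h (add q D) ≡ H (two p q (suc q))
    at-q = shaped _ (two p q (suc q)) (p<q , ℕₚ.≤-refl , _ ,
      Structure-rotate (suc q ∷ []) (subst₂ (λ x os → Structure (suc m) (add q D) (q ∷ [])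
        ((suc q ∷ x ∷ []) ∷ os)) (punchIn-< p<q) (map-singles (punchIn q) zs) (Structure-cut (p ∷ []) [] st)))
  grow-shape D (two q p r) (q<p , p<r , zs , st) = trans (covered st)
    (trans (cong₂ ℤ._+_ (root-vanishes st ne) (cong₂ ℤ._+_ (cong (λ z → z ℤ.+ + 0) at-p) (joins-vanish st ne)))
    (trans (ℤₚ.+-identityˡ _) (ℤₚ.+-identityʳ _)))
    where
    ne : m ≢ suc (length (singles zs))
    ne e = far 1 (suc (length zs)) (trans (length-singles {os = (q ∷ r ∷ []) ∷ []} zs st)
      (trans e (cong suc (Listₚ.length-map _ zs))))
    at-p : h (add p D) ≡ H (two q p (suc r))
    at-p = shaped _ (two q p (suc r)) (q<p , ℕₚ.m≤n⇒m≤1+n p<r , (suc p ∷ map (punchIn p) zs) ,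
      Structure-↭ (swap (suc p ∷ []) (q ∷ suc r ∷ []) ↭-refl)
        (subst₂ (λ x os → Structure (suc m) (add p D) (p ∷ []) ((suc p ∷ []) ∷ x ∷ os))
          (cong₂ (λ x y → x ∷ y ∷ []) (punchIn-< q<p) (punchIn-≥ (ℕₚ.<⇒≤ p<r))) (map-singles (punchIn p) zs)
            (Structure-cut [] [] st)))

  grow-shapeless : ∀ D → Shapeless m D → h' D ≡ + 0
  grow-shapeless D sl = trans (covered structure) (cong₂ ℤ._+_ (root-vanishes structure notPlanar)
    (cong₂ ℤ._+_ (∑-zero-All (All.map (λ { {c} (us , vs , e) → at us c vs e structure rootFixed })
      (every-split xs))) (joins-vanish structure notPlanar)))
    where
    open Shapeless sl
    at : ∀ us c vs {xs} → us ++ c ∷ vs ≡ xs → Structure m D xs os → (m ≡ length os + 2 → xs ≡ []) → h (add c D) ≡ + 0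
    at us c vs refl st fixed = shapeless _ (record
      { structure = Structure-cut us vs st
      ; notPlanar = λ e → notPlanar (trans (ℕₚ.suc-injective e) (Listₚ.length-map _ os))
      ; rootFixed = λ e → ⊥-elim (nonempty us (fixed (trans (ℕₚ.suc-injective e)
        (cong (_+ 2) (Listₚ.length-map _ os))))) })
      where
      nonempty : ∀ us → us ++ c ∷ vs ≢ []
      nonempty [] ()
      nonempty (_ ∷ _) ()

-- The last insertion is absorbed into `h`, and correspondingly `grow` into `H`. Both hypotheses
-- survive this, so the induction runs over all such pairs.
∑-shapes : ∀ m {h : Dipole → ℤ} {H : Shape → ℤ} →
           (∀ D t → HasShape m D t → h D ≡ H t) → (∀ D → Shapeless m D → h D ≡ + 0) →
           ∑ (dips m) h ≡ ∑ (shapes m) H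
∑-shapes zero {h} {H} shaped shapeless = cong (λ z → z ℤ.+ + 0) (shaped (0 ∷ []) planar (refl , [] , record
  { wellFormed = record { starts = refl ; size = refl ; within = λ { zero z≤n → z≤n } } ; root = refl ; cycles =
    [] ; cover = ↭-refl }))
∑-shapes (suc m) {h} {H} shaped shapeless = trans (∑-dips-suc m h)
  (trans (∑-shapes m (grow-shape shaped shapeless) (grow-shapeless {h = h} {H} shaped shapeless))
    (sym (∑-concatMap (grow m) (shapes m))))

-- Counting shapes

onPlanar : ℤ → Shape → ℤ
onPlanar K planar = K
onPlanar K _ = + 0

-- `first` and `middle-root` select the shapes in which corner `b` follows the root corner. `second`
-- is auxiliary: cutting (0 p q) at `q` makes `q` the root partner in a double transposition.
first second middle-root : ℕ → ℤ → Shape → ℤ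
first b K (three p q) = [ p ≡ᵇ b ] K
first b K _ = + 0
second b K (three p q) = [ q ≡ᵇ b ] K
second b K _ = + 0
middle-root b K (two q p r) = [ p ≡ᵇ b ] K
middle-root b K _ = + 0

∑-delta : ∀ m b K → ∑ (oneTo m) (λ c → [ c ≡ᵇ suc b ] K) ≡ [ b <ᵇ m ] K
∑-delta m b K = trans (∑-map suc (upTo m)) (go m b)
  where
  go : ∀ m b → ∑ (upTo m) (λ c → [ c ≡ᵇ b ] K) ≡ [ b <ᵇ m ] K
  go zero b = refl
  go (suc m) zero = trans (∑-upTo-suc m (λ c → [ c ≡ᵇ 0 ] K))
    (trans (cong (ℤ._+_ K) (∑-zero (upTo m))) (ℤₚ.+-identityʳ K))
  go (suc m) (suc b) = trans (∑-upTo-suc m (λ c → [ c ≡ᵇ suc b ] K)) (trans (ℤₚ.+-identityˡ _) (go m b))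

∑-delta-0 : ∀ m K → ∑ (oneTo m) (λ c → [ c ≡ᵇ 0 ] K) ≡ + 0
∑-delta-0 m K = trans (∑-map suc (upTo m)) (∑-zero (upTo m))

∑-grow : ∀ m {φ ψ : Shape → ℤ} → (∀ t → ∑ (grow m t) φ ≡ ψ t) → ∑ (shapes (suc m)) φ ≡ ∑ (shapes m) ψ
∑-grow m e = trans (∑-concatMap (grow m) (shapes m)) (∑-cong (shapes m) e)

∑-onPlanar : ∀ m K → ∑ (shapes m) (onPlanar K) ≡ K
∑-onPlanar zero K = ℤₚ.+-identityʳ K
∑-onPlanar (suc m) K = trans (∑-grow m {onPlanar K} {onPlanar K} grown) (∑-onPlanar m K)
  where
  grown : ∀ t → ∑ (grow m t) (onPlanar K) ≡ onPlanar K t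
  grown planar = trans (cong (ℤ._+_ K) (trans (∑-map (λ c → three c (suc c)) (oneTo m) {onPlanar K})
    (∑-zero (oneTo m)))) (ℤₚ.+-identityʳ K)
  grown (three p q) = refl
  grown (two q p r) = refl

staircase : ∀ b K (x : ℕ → ℤ) → x 0 ≡ + 0 → (∀ m → x (suc m) ≡ x m ℤ.+ [ b <ᵇ m ] K) → ∀ m → x m ≡ + (m ∸ suc b) ℤ.* K
staircase b K x x0 xs zero = trans x0 (sym (ℤₚ.*-zeroˡ K))
staircase b K x x0 xs (suc m) = trans (xs m) (trans (cong (ℤ._+ [ b <ᵇ m ] K) (staircase b K x x0 xs m)) (climb b m))
  where
  climb : ∀ b m → + (m ∸ suc b) ℤ.* K ℤ.+ [ b <ᵇ m ] K ≡ + (m ∸ b) ℤ.* K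
  climb b zero rewrite ℕₚ.0∸n≡0 b = ℤₚ.+-identityʳ _
  climb zero (suc m) = trans (ℤₚ.+-comm (+ m ℤ.* K) K) (sym (ℤₚ.suc-* (+ m) K))
  climb (suc b) (suc m) = climb b m

∑-first : ∀ b K m → ∑ (shapes m) (first (suc b) K) ≡ + (m ∸ suc b) ℤ.* K
∑-first b K = staircase b K _ refl (λ m → trans (∑-grow m (grown m))
  (trans (∑-+ (shapes m)) (cong (ℤ._+_ (∑ (shapes m) (first (suc b) K))) (∑-onPlanar m _))))
  where
  grown : ∀ m t → ∑ (grow m t) (first (suc b) K) ≡ first (suc b) K t ℤ.+ onPlanar ([ b <ᵇ m ] K) t
  grown m planar = trans (ℤₚ.+-identityˡ _) (trans (∑-map (λ c → three c (suc c)) (oneTo m) {first (suc b) K})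
    (trans (∑-delta m b K) (sym (ℤₚ.+-identityˡ _))))
  grown m (three p q) = refl
  grown m (two q p r) = refl

-- Growth raises `q` by one, so the count at `suc b` is the count at `b` one edge earlier, plus the
-- new cycle (0 b b+1). In total `p` takes each value from 1 to `b`.
∑-second : ∀ b K m → ∑ (shapes m) (second (suc b) K) ≡ [ b <ᵇ m ] (+ b ℤ.* K)
∑-second-0 : ∀ K m → ∑ (shapes m) (second 0 K) ≡ + 0
∑-second-suc : ∀ b K m → ∑ (shapes (suc m)) (second (suc b) K) ≡ ∑ (shapes m) (second b K) ℤ.+ ∑ (oneTo m)
  (λ c → [ c ≡ᵇ b ] K)
∑-second-suc b K m = trans (∑-grow m {second (suc b) K} grown)
  (trans (∑-+ (shapes m)) (cong (ℤ._+_ (∑ (shapes m) (second b K))) (∑-onPlanar m _)))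
  where
  grown : ∀ t → ∑ (grow m t) (second (suc b) K) ≡ second b K t ℤ.+ onPlanar (∑ (oneTo m) (λ c → [ c ≡ᵇ b ] K)) t
  grown planar = trans (ℤₚ.+-identityˡ _) (trans (∑-map (λ c → three c (suc c)) (oneTo m) {second (suc b) K})
    (sym (ℤₚ.+-identityˡ _)))
  grown (three p q) = refl
  grown (two q p r) = refl
∑-second-0 K zero = refl
∑-second-0 K (suc m) = trans (∑-grow m {second 0 K} {λ _ → + 0} grown) (∑-zero (shapes m))
  where
  grown : ∀ t → ∑ (grow m t) (second 0 K) ≡ + 0
  grown planar = trans (ℤₚ.+-identityˡ _) (trans (∑-map (λ c → three c (suc c)) (oneTo m) {second 0 K})
    (∑-zero (oneTo m)))
  grown (three p q) = refl
  grown (two q p r) = refl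
∑-second b K zero = refl
∑-second zero K (suc m) = trans (∑-second-suc 0 K m) (trans (cong₂ ℤ._+_ (∑-second-0 K m) (∑-delta-0 m K))
  (sym (ℤₚ.*-zeroˡ K)))
∑-second (suc b) K (suc m) = trans (∑-second-suc (suc b) K m)
  (trans (cong₂ ℤ._+_ (∑-second b K m) (∑-delta m b K)) (merge (b <ᵇ m)))
  where
  merge : ∀ t → ([ t ] (+ b ℤ.* K)) ℤ.+ ([ t ] K) ≡ [ t ] (+ suc b ℤ.* K)
  merge true = trans (ℤₚ.+-comm (+ b ℤ.* K) K) (sym (ℤₚ.suc-* (+ b) K))
  merge false = refl

-- Each step adds the cuts of (0 p q) at `q = suc b`, one for every smaller positive corner; later
-- steps only raise `r`. So both remaining corners vary independently, below and above the root
-- partner.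
∑-middle-root : ∀ b K m → ∑ (shapes m) (middle-root (suc b) K) ≡ + (m ∸ suc b) ℤ.* (+ b ℤ.* K)
∑-middle-root b K = staircase b (+ b ℤ.* K) _ refl (λ m → trans (∑-grow m (grown m)) (trans (∑-+ (shapes m))
  (cong (ℤ._+_ (∑ (shapes m) (middle-root (suc b) K))) (∑-second b K m))))
  where
  grown : ∀ m t → ∑ (grow m t) (middle-root (suc b) K) ≡ middle-root (suc b) K t ℤ.+ second (suc b) K t
  grown m planar = trans (ℤₚ.+-identityˡ _) (trans (∑-map (λ c → three c (suc c)) (oneTo m)
    {middle-root (suc b) K}) (∑-zero (oneTo m)))
  grown m (three p q) = cong (ℤ._+_ (+ 0)) (ℤₚ.+-identityʳ ([ q ≡ᵇ suc b ] K))
  grown m (two q p r) = refl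

-- Joins of planar dipoles

selects-false : ∀ k a b c Ds → hasExcess k (proj₁ Ds) ≡ false → selects k a b c Ds ≡ false
selects-false k a b c Ds e rewrite e | ∧-zeroʳ ((γD Ds + δD Ds) ≡ᵇ c) | ∧-zeroʳ (βD Ds ≡ᵇ b) = ∧-zeroʳ _

∑-pick : ∀ n {c} (φ : ℕ → ℤ) → c < n → ∑ (upTo n) (λ i → [ i ≡ᵇ c ] φ i) ≡ φ c
∑-pick (suc n) {zero} φ _ = trans (∑-upTo-suc n (λ i → [ i ≡ᵇ 0 ] φ i))
  (trans (cong (ℤ._+_ (φ 0)) (∑-zero (upTo n))) (ℤₚ.+-identityʳ (φ 0)))
∑-pick (suc n) {suc c} φ (s≤s lt) = trans (∑-upTo-suc n (λ i → [ i ≡ᵇ suc c ] φ i))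
  (trans (ℤₚ.+-identityˡ _) (∑-pick n (φ ∘ suc) lt))

∑-threshold : ∀ c a (X Y : ℤ) → ∑ (upTo (c + a)) (λ k → if k <ᵇ c then X else Y) ≡ + c ℤ.* X ℤ.+ + a ℤ.* Y
∑-threshold zero a X Y = trans (constant a) (sym (trans (cong (ℤ._+ (+ a ℤ.* Y)) (ℤₚ.*-zeroˡ X)) (ℤₚ.+-identityˡ _)))
  where
  constant : ∀ a → ∑ (upTo a) (λ k → if k <ᵇ 0 then X else Y) ≡ + a ℤ.* Y
  constant zero = sym (ℤₚ.*-zeroˡ Y)
  constant (suc a) = trans (∑-upTo-suc a (λ k → if k <ᵇ 0 then X else Y))
    (trans (cong (ℤ._+_ Y) (constant a)) (sym (ℤₚ.suc-* (+ a) Y)))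
∑-threshold (suc c) a X Y = trans (∑-upTo-suc (c + a) (λ k → if k <ᵇ suc c then X else Y))
  (trans (cong (ℤ._+_ X) (∑-threshold c a X Y))
  (trans (sym (ℤₚ.+-assoc X (+ c ℤ.* X) (+ a ℤ.* Y))) (cong (ℤ._+ (+ a ℤ.* Y)) (sym (ℤₚ.suc-* (+ c) X)))))

labels-upTo : ∀ c a → map (label c) (upTo (c + a)) ≡ replicate c ● ++ replicate a ○
labels-upTo zero a = trans (Listₚ.map-cong {g = λ _ → ○} (λ _ → refl) (upTo a)) (constant a)
  where
  constant : ∀ a → map (λ _ → ○) (upTo a) ≡ replicate a ○
  constant zero = refl
  constant (suc a) = cong (○ ∷_) (trans (cong (map (λ _ → ○)) (sym (Listₚ.map-upTo suc a)))
    (trans (sym (Listₚ.map-∘ (upTo a))) (constant a)))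
labels-upTo (suc c) a = trans (cong (map (label (suc c))) (upTo-suc (c + a)))
  (cong (● ∷_) (trans (sym (Listₚ.map-∘ (upTo (c + a)))) (labels-upTo c a)))

letter : Label → Var
letter l = f (l ∷ [])

map-singles-letters : ∀ s zs → map f (map (map (label s)) (singles zs)) ≡ map letter (map (label s) zs)
map-singles-letters s [] = refl
map-singles-letters s (z ∷ zs) = cong (f (label s z ∷ []) ∷_) (map-singles-letters s zs)

bicolour : ℕ → ℕ → Monomial
bicolour b a = replicate b (f (● ∷ [])) ++ replicate a (f (○ ∷ []))

letters-bicolour : ∀ b a → map letter (replicate b ● ++ replicate a ○) ≡ bicolour b a
letters-bicolour b a = trans (Listₚ.map-++ letter (replicate b ●) (replicate a ○))
  (cong₂ _++_ (Listₚ.map-replicate letter b ●) (Listₚ.map-replicate letter a ○))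

drop-○ : ∀ b {a} {ls : Word} → ○ ∷ ls ↭ replicate b ● ++ replicate (suc a) ○ → ls ↭ replicate b ● ++ replicate a ○
drop-○ b p = ↭ₚ.drop-∷ (↭-trans p (↭ₚ.shift ○ (replicate b ●) _))

planar-Structure : ∀ m → Structure m (planarDipole m) [] (singles (oneTo m))
planar-Structure zero = record { wellFormed = record { starts = refl ; size = refl ; within =
  λ { zero z≤n → z≤n } } ; root = refl ; cycles = [] ; cover = ↭-refl }
planar-Structure (suc m) = subst (Structure (suc m) (planarDipole (suc m)) [])
  (trans (cong ((1 ∷ []) ∷_) (map-singles suc (oneTo m))) (cong singles (cong (map suc) (sym (upTo-suc m)))))
    (Structure-cut-root (planar-Structure m))

planar-wf : ∀ m → WellFormed m (planarDipole m)
planar-wf m = wellFormed (planar-Structure m)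

-- Because the two cyclic orders are opposite, edges numbered above the secondary edge are a-edges
-- and ordinary edges below it are d-edges; there are no others.
planar-α : ∀ m s₀ → s₀ ≤ m → αD (planarDipole (suc m) , suc s₀) ≡ m ∸ s₀
planar-α m zero _ = α-add-new (planar-wf m) z≤n
planar-α (suc m) (suc s₀) (s≤s le) = trans (α-add (planar-wf (suc m)) z≤n (s≤s le)) (planar-α m s₀ le)

planar-β : ∀ m s₀ → s₀ ≤ m → βD (planarDipole (suc m) , suc s₀) ≡ 0
planar-β m zero _ = β-add-new (planar-wf m) z≤n
planar-β (suc m) (suc s₀) (s≤s le) = trans (β-add (planar-wf (suc m)) z≤n (s≤s le)) (planar-β m s₀ le)

planar-γ : ∀ m s₀ → s₀ ≤ m → γD (planarDipole (suc m) , suc s₀) ≡ 0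
planar-γ m zero _ = γ-add-new (planar-wf m) z≤n
planar-γ (suc m) (suc s₀) (s≤s le) = trans (γ-add (planar-wf (suc m)) z≤n (s≤s le)) (planar-γ m s₀ le)

planar-δ : ∀ m s₀ → s₀ ≤ m → δD (planarDipole (suc m) , suc s₀) ≡ s₀
planar-δ m zero _ = δ-add-new (planar-wf m) z≤n
planar-δ (suc m) (suc s₀) (s≤s le) = trans (δ-add (planar-wf (suc m)) z≤n (s≤s le)) (cong suc (planar-δ m s₀ le))

-- The contribution of an edge joining two faces of a planar dipole
joinTerm : ℕ → ℕ → ℕ → Functional → ℤ
joinTerm a b c L = ∑ (dips (a + b + c)) (λ D → ∑ (oneTo (a + b + c))
  (λ s → [ selects 0 a b c (D , s) ] joinSum (a + b + c) L (D , s)))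

joinTerm-planar : ∀ a b c L → joinTerm a b c L ≡
  ∑ (oneTo (a + b + c)) (λ s → [ selects 0 a b c (planarDipole (a + b + c) , s) ] joinSum (a + b + c) L
    (planarDipole (a + b + c) , s))
joinTerm-planar a b c L = trans (∑-shapes m {value} {onPlanar (value (planarDipole m))} shaped
  (λ D sl → vanish D (Shapeless.structure sl) (Shapeless.notPlanar sl))) (∑-onPlanar m _)
  where
  m = a + b + c
  value : Dipole → ℤ
  value D = ∑ (oneTo m) (λ s → [ selects 0 a b c (D , s) ] joinSum m L (D , s))
  vanish : ∀ D {xs os} → Structure m D xs os → m ≢ length os → value D ≡ + 0
  vanish D {os = os} st ne = trans (∑-cong (oneTo m) (λ s → cong ([_] joinSum m L (D , s))
    (selects-false 0 a b c (D , s)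
    (trans (hasExcess-≡ st 0) (≢⇒≡ᵇ (λ e → ne (trans e (ℕₚ.+-identityʳ (length os))))))))) (∑-zero (oneTo m))
  shaped : ∀ D t → HasShape m D t → value D ≡ onPlanar (value (planarDipole m)) t
  shaped D planar (refl , _) = refl
  shaped D (three p q) (_ , zs , st) = vanish D st
    (λ e → ℕₚ.<-irrefl (sym (trans (length-singles {os = []} zs st) (trans e (Listₚ.length-map _ zs))))
      (ℕₚ.m≤n+m (suc (length zs)) 1))
  shaped D (two q p r) (_ , _ , zs , st) = vanish D st
    (λ e → ℕₚ.<-irrefl (sym (trans (length-singles {os = (q ∷ r ∷ []) ∷ []} zs st)
      (trans e (cong suc (Listₚ.length-map _ zs))))) (ℕₚ.m≤n+m (suc (suc (length zs))) 1))

joinTerm-suc : ∀ a b c L → joinTerm (suc a) (suc b) c L ≡ + 0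
joinTerm-suc a b c L = trans (joinTerm-planar (suc a) (suc b) c L)
  (trans (∑-map suc (upTo (suc m)) {value}) (∑-zero-All {φ = value ∘ suc} (All.map (λ {s₀} le →
    cong ([_] joinSum (suc m) L (planarDipole (suc m) , suc s₀)) (none s₀ le)) (upTo-≤ m))))
  where
  m = a + suc b + c
  value : ℕ → ℤ
  value s = [ selects 0 (suc a) (suc b) c (planarDipole (suc m) , s) ] joinSum (suc m) L (planarDipole (suc m) , s)
  none : ∀ s₀ → s₀ ≤ m → selects 0 (suc a) (suc b) c (planarDipole (suc m) , suc s₀) ≡ false
  none s₀ le = trans (cong (λ n → (suc (αD (planarDipole (suc m) , suc s₀)) ≡ᵇ suc a) ∧ (n ≡ᵇ suc b) ∧ rest)
    (planar-β m s₀ le)) (∧-zeroʳ _)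
    where
    rest : Bool
    rest = ((γD (planarDipole (suc m) , suc s₀) + δD (planarDipole (suc m) , suc s₀)) ≡ᵇ c) ∧ hasExcess 0
      (planarDipole (suc m))

-- Both halves of the joined corner keep its label, so the root word is ●●● or ●○○. A black corner
-- costs one of the `c` black faces and gives a d-edge, hence one more `w`; since `c₀` is nonzero,
-- that branch has `c` positive and the subtraction is genuine.
join-weight : ∀ {L} → Respects L → ∀ a c {c₀} → c₀ ≤ c + suc a → c₀ ≢ 0 → let m = c + suc a in
  L (weight (add c₀ (planarDipole m) , punchIn (suc c₀) (suc c))) ≡
  (if c₀ <ᵇ suc c then L (replicate (suc c) w ++ (g (● ∷ ● ∷ ● ∷ []) ∷ bicolour (c ∸ 1) (suc a)))
                  else L (replicate c w ++ (g (● ∷ ○ ∷ ○ ∷ []) ∷ bicolour c a)))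
join-weight {L} r a c {zero} _ c₀≢0 = ⊥-elim (c₀≢0 refl)
join-weight {L} r a c {suc k} c₀≤m _ = trans (weight-Structure r joined (punchIn (suc c₀) s))
  (trans (cong L (cong₂ (λ n Λ → replicate n w ++ (g (● ∷ label s' c₀ ∷ label s' (suc c₀) ∷ []) ∷ Λ)) δ≡ Λ≡))
  (trans (cong₂ (λ l l' → L (replicate δ' w ++ (g (● ∷ l ∷ l' ∷ []) ∷ map letter (map (label s) zs'))))
    (label-split c₀ s) (label-new c₀ s))
         (by-colour (c₀ <ᵇ s) refl)))
  where
  m = c + suc a
  c₀ = suc k
  s = suc c
  s' = punchIn (suc c₀) s
  s≤m : s ≤ m
  s≤m = ℕₚ.≤-trans (s≤s (ℕₚ.m≤m+n c a)) (ℕₚ.≤-reflexive (sym (ℕₚ.+-suc c a)))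
  c₀∈ : ∃[ zs' ] oneTo m ↭ c₀ ∷ zs'
  c₀∈ = Allₚ.applyUpTo⁻ id m (Allₚ.map⁻ (every (oneTo m))) c₀≤m
  zs' = proj₁ c₀∈
  joined : Structure (suc m) (add c₀ (planarDipole m)) (c₀ ∷ suc c₀ ∷ []) (map (map (punchIn c₀)) (singles zs'))
  joined = Structure-join (Structure-↭ (↭ₚ.map⁺ (_∷ []) (proj₂ c₀∈)) (planar-Structure m))
  δ' = if c₀ <ᵇ s then suc c else c
  δ≡ : δD (add c₀ (planarDipole m) , s') ≡ δ'
  δ≡ = trans (δ-add (planar-wf m) c₀≤m s≤m) (cong (λ n → if c₀ <ᵇ s then suc n else n)
    (subst (λ m → δD (planarDipole m , s) ≡ c) (sym (ℕₚ.+-suc c a)) (planar-δ (c + a) c (ℕₚ.m≤m+n c a))))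
  Λ≡ : map f (map (map (label s')) (map (map (punchIn c₀)) (singles zs'))) ≡ map letter (map (label s) zs')
  Λ≡ = trans (cong (map f) (labels-old² c₀ s (singles zs'))) (map-singles-letters s zs')
  labels : label s c₀ ∷ map (label s) zs' ↭ replicate c ● ++ replicate (suc a) ○
  labels = ↭-trans (↭-sym (↭ₚ.map⁺ (label s) (proj₂ c₀∈)))
    (↭-reflexive (trans (sym (Listₚ.map-∘ (upTo m))) (labels-upTo c (suc a))))
  by-colour : ∀ t → (c₀ <ᵇ s) ≡ t →
    L (replicate δ' w ++ (g (● ∷ label s c₀ ∷ label s c₀ ∷ []) ∷ map letter (map (label s) zs'))) ≡
    (if t then L (replicate (suc c) w ++ (g (● ∷ ● ∷ ● ∷ []) ∷ bicolour (c ∸ 1) (suc a)))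
          else L (replicate c w ++ (g (● ∷ ○ ∷ ○ ∷ []) ∷ bicolour c a)))
  by-colour true e rewrite e = perm r (↭ₚ.++⁺ˡ (replicate (suc c) w)
    (prep _ (↭-trans (↭ₚ.map⁺ letter black) (↭-reflexive (letters-bicolour (c ∸ 1) (suc a))))))
    where
    drop-● : ∀ c → c₀ < suc c → ● ∷ map (label s) zs' ↭ replicate c ● ++ replicate (suc a) ○ → map (label s) zs' ↭
      replicate (c ∸ 1) ● ++ replicate (suc a) ○
    drop-● (suc c) _ p = ↭ₚ.drop-∷ p
    drop-● zero (s≤s ()) p
    black : map (label s) zs' ↭ replicate (c ∸ 1) ● ++ replicate (suc a) ○
    black = drop-● c (ℕₚ.<ᵇ⇒< c₀ s (subst T (sym e) tt))
      (subst (λ l → l ∷ map (label s) zs' ↭ replicate c ● ++ replicate (suc a) ○) (cong (if_then ● else ○) e) labels)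
  by-colour false e rewrite e = perm r (↭ₚ.++⁺ˡ (replicate c w) (prep _ (↭-trans (↭ₚ.map⁺ letter
      (drop-○ c (subst (λ l → l ∷ map (label s) zs' ↭ replicate c ● ++ replicate (suc a) ○)
        (cong (if_then ● else ○) e) labels))) (↭-reflexive (letters-bicolour c a)))))

-- In the planar dipole `γ + δ` is one less than the secondary edge, so the power of `v` determines
-- that edge. Of the corners available for a join, `c` are black and `suc a` white.
joinTerm-xv : ∀ {L} → Respects L → ∀ a c → joinTerm (suc a) 0 c L ≡
  + c ℤ.* L (replicate (suc c) w ++ (g (● ∷ ● ∷ ● ∷ []) ∷ bicolour (c ∸ 1) (suc a))) ℤ.+
  + suc a ℤ.* L (replicate c w ++ (g (● ∷ ○ ∷ ○ ∷ []) ∷ bicolour c a))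
joinTerm-xv {L} r a c = begin
    joinTerm (suc a) 0 c L
  ≡⟨ joinTerm-planar (suc a) 0 c L ⟩
    ∑ (oneTo M) (λ s → [ selects 0 (suc a) 0 c (planarDipole M , s) ] joinSum M L (planarDipole M , s))
  ≡⟨ cong (λ M → ∑ (oneTo M) (λ s → [ selects 0 (suc a) 0 c (planarDipole M , s) ] joinSum M L
    (planarDipole M , s))) M≡ ⟩
    ∑ (oneTo (suc m)) (λ s → [ selects 0 (suc a) 0 c (planarDipole (suc m) , s) ] joinSum (suc m) L
      (planarDipole (suc m) , s))
  ≡⟨ ∑-map suc (upTo (suc m)) {term} ⟩
    ∑ (upTo (suc m)) (λ s₀ → [ selects 0 (suc a) 0 c (planarDipole (suc m) , suc s₀) ] V (suc s₀))
  ≡⟨ ∑-cong-All {φ = term ∘ suc} {ψ = λ s₀ → [ s₀ ≡ᵇ c ] V (suc s₀)}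
    (All.map (λ {s₀} le → cong ([_] V (suc s₀)) (selected s₀ le)) (upTo-≤ m)) ⟩
    ∑ (upTo (suc m)) (λ s₀ → [ s₀ ≡ᵇ c ] V (suc s₀))
  ≡⟨ ∑-pick (suc m) (V ∘ suc) (s≤s (ℕₚ.m≤m+n c a)) ⟩
    V (suc c)
  ≡⟨ cong (λ M → joinSum M L (planarDipole M , suc c)) (sym (ℕₚ.+-suc c a)) ⟩
    ∑ (oneTo (c + suc a)) (λ c₀ → L (weight (add c₀ (planarDipole (c + suc a)) , punchIn (suc c₀) (suc c))))
  ≡⟨ ∑-map suc (upTo (c + suc a)) ⟩
    ∑ (upTo (c + suc a)) (λ k → L (weight (add (suc k) (planarDipole (c + suc a)) , punchIn (suc (suc k)) (suc c))))
  ≡⟨ ∑-cong-All (All.map (λ lt → join-weight r a c lt (λ ())) (Allₚ.all-upTo (c + suc a))) ⟩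
    ∑ (upTo (c + suc a)) (λ k → if k <ᵇ c then X else Y)
  ≡⟨ ∑-threshold c (suc a) X Y ⟩
    + c ℤ.* X ℤ.+ + suc a ℤ.* Y ∎
  where
  open ≡-Reasoning
  M m : ℕ
  M = suc a + 0 + c
  m = c + a
  X Y : ℤ
  X = L (replicate (suc c) w ++ (g (● ∷ ● ∷ ● ∷ []) ∷ bicolour (c ∸ 1) (suc a)))
  Y = L (replicate c w ++ (g (● ∷ ○ ∷ ○ ∷ []) ∷ bicolour c a))
  V term : ℕ → ℤ
  term s = [ selects 0 (suc a) 0 c (planarDipole (suc m) , s) ] V s
  V s = joinSum (suc m) L (planarDipole (suc m) , s)
  M≡ : M ≡ suc m
  M≡ = cong suc (trans (cong (_+ c) (ℕₚ.+-identityʳ a)) (ℕₚ.+-comm a c))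
  excess : hasExcess 0 (planarDipole (suc m)) ≡ true
  excess = trans (hasExcess-≡ (planar-Structure (suc m)) 0) (trans (cong (suc m ≡ᵇ_) (trans (ℕₚ.+-identityʳ _)
    (trans (Listₚ.length-map (_∷ []) (oneTo (suc m))) (trans (Listₚ.length-map suc (upTo (suc m)))
      (Listₚ.length-upTo (suc m)))))) (≡ᵇ-refl (suc m)))
  selected : ∀ s₀ → s₀ ≤ m → selects 0 (suc a) 0 c (planarDipole (suc m) , suc s₀) ≡ (s₀ ≡ᵇ c)
  selected s₀ le = trans (cong₂ (λ x y → (x ≡ᵇ a) ∧ y) (planar-α m s₀ le)
    (cong₂ (λ x y → (x ≡ᵇ 0) ∧ y) (planar-β m s₀ le)
      (cong₂ (λ x y → (x ≡ᵇ c) ∧ y) (cong₂ _+_ (planar-γ m s₀ le) (planar-δ m s₀ le)) excess))) (decide (s₀ ≡ᵇ c) refl)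
    where
    decide : ∀ t → (s₀ ≡ᵇ c) ≡ t → (m ∸ s₀ ≡ᵇ a) ∧ true ∧ (s₀ ≡ᵇ c) ∧ true ≡ t
    decide true e rewrite e | ≡ᵇ-sound s₀ c e | ℕₚ.m+n∸m≡n c a | ≡ᵇ-refl a = refl
    decide false e rewrite e = ∧-zeroʳ _

-- Dipoles without c- and d-edges: the secondary edge is the last one at the non-root vertex

Γ-base : ∀ a b L → ⟦ GammaU 2 (suc a) b 0 ⟧ L ≡
         ∑ (dips (a + b)) (λ D → [ hasExcess 2 (add b D) ] L (bareWeight (add b D , suc b)))
Γ-base a b L = begin
    ⟦ GammaU 2 (suc a) b 0 ⟧ L
  ≡⟨ ⟦GammaU⟧ 2 (suc a) b 0 (ℕₚ.+-identityʳ (suc m)) L ⟩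
    ∑ (dips (suc m)) (λ D' → ∑ (oneTo (suc m)) (φ D'))
  ≡⟨ ∑-dips-suc m (λ D' → ∑ (oneTo (suc m)) (φ D')) ⟩
    ∑ (dips m) (λ D → ∑ (upTo (suc m)) (λ c₀ → ∑ (oneTo (suc m)) (φ (add c₀ D))))
  ≡⟨ ∑-cong-All {φ = λ D → ∑ (upTo (suc m)) (λ c₀ → ∑ (oneTo (suc m)) (φ (add c₀ D)))}
    (All.map perDipole (WellFormed-dips m)) ⟩
    ∑ (dips m) (λ D → value D b) ∎
  where
  open ≡-Reasoning
  m : ℕ
  m = a + b
  φ : Dipole → ℕ → ℤ
  φ D' s' = [ selects 2 (suc a) b 0 (D' , s') ] L (weight (D' , s'))
  value : Dipole → ℕ → ℤ
  value D c₀ = [ hasExcess 2 (add c₀ D) ] L (bareWeight (add c₀ D , suc c₀))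
  -- The number of b-edges equals the corner of insertion, so only `c₀ = b` contributes.
  perDipole : ∀ {D} → WellFormed m D → ∑ (upTo (suc m)) (λ c₀ → ∑ (oneTo (suc m)) (φ (add c₀ D))) ≡ value D b
  perDipole {D} wf = trans
    (∑-cong-All {φ = λ c₀ → ∑ (oneTo (suc m)) (φ (add c₀ D))} {ψ = λ c₀ → [ c₀ ≡ᵇ b ] value D c₀}
      (All.map (λ {c₀} le → perCorner c₀ le) (upTo-≤ m)))
    (∑-pick (suc m) (value D) (s≤s (ℕₚ.m≤n+m b a)))
    where
    perCorner : ∀ c₀ → c₀ ≤ m → ∑ (oneTo (suc m)) (φ (add c₀ D)) ≡ [ c₀ ≡ᵇ b ] value D c₀
    perCorner c₀ le = trans (∑-↭ {φ = φ (add c₀ D)} (↭-sym (oneTo-punchIn le)))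
      (trans (cong₂ ℤ._+_ last (trans (∑-map (punchIn (suc c₀)) (oneTo m) {φ (add c₀ D)})
        (∑-zero-All {φ = φ (add c₀ D) ∘ punchIn (suc c₀)} (All.map (λ {s} → notLast s) (oneTo-≤ m)))))
          (ℤₚ.+-identityʳ _))
      where
      D' : Dipole
      D' = add c₀ D
      notLast : ∀ s → s ≤ m → φ D' (punchIn (suc c₀) s) ≡ + 0
      notLast s s≤m = cong ([_] L (weight (D' , punchIn (suc c₀) s)))
        (trans (cong ((suc (αD (D' , punchIn (suc c₀) s)) ≡ᵇ suc a) ∧_)
        (trans (cong (λ n → (βD (D' , punchIn (suc c₀) s) ≡ᵇ b) ∧ (n ≡ᵇ 0) ∧ hasExcess 2 D') (γ+δ-add wf le s≤m))
          (∧-zeroʳ _))) (∧-zeroʳ _))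
      last : φ D' (suc c₀) ≡ [ c₀ ≡ᵇ b ] value D c₀
      last = trans (cong₂ (λ t n → [ t ] L (replicate n w ++ bareWeight (D' , suc c₀)))
          (trans (cong₂ (λ x y → (x ≡ᵇ a) ∧ y) (α-add-new wf le) (cong₂ (λ x y → (x ≡ᵇ b) ∧ y) (β-add-new wf le)
            (cong (λ n → (n ≡ᵇ 0) ∧ hasExcess 2 D') (cong₂ _+_ (γ-add-new wf le) (δ-add-new wf le)))))
              (decide (c₀ ≡ᵇ b) refl))
          (δ-add-new wf le)) (nested (c₀ ≡ᵇ b))
        where
        decide : ∀ t → (c₀ ≡ᵇ b) ≡ t → (m ∸ c₀ ≡ᵇ a) ∧ (c₀ ≡ᵇ b) ∧ hasExcess 2 D' ≡ t ∧ hasExcess 2 D'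
        decide true e rewrite ≡ᵇ-sound c₀ b e | ≡ᵇ-refl b | ℕₚ.m+n∸n≡m a b | ≡ᵇ-refl a = refl
        decide false e rewrite e = ∧-zeroʳ _
        nested : ∀ t {z} → [ t ∧ hasExcess 2 D' ] z ≡ [ t ] ([ hasExcess 2 D' ] z)
        nested true = refl
        nested false = refl

-- With b-edges: the shapes with a root face through corner b

cover-labels : ∀ {m D xs os} → Structure m D xs os → ∀ s a → m ≡ s + a →
               map (label (suc s)) (0 ∷ xs ++ concat os) ↭ replicate (suc s) ● ++ replicate a ○
cover-labels st s a refl = ↭-trans (↭ₚ.map⁺ (label (suc s)) (cover st)) (↭-reflexive (labels-upTo (suc s) a))

-- The weights when `suc b` follows the root corner and `suc (suc b)` is the secondary edge: corners
-- up to `suc b` are black, later ones white. Thus `q` is white in (0 p q), while in (0 p)(q r) the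
-- corner `q` is black and `r` white.
threeWeight twoWeight : ℕ → ℕ → Monomial
threeWeight a b = g (● ∷ ● ∷ ○ ∷ []) ∷ bicolour b a
twoWeight a b = g (● ∷ ● ∷ []) ∷ f (● ∷ ○ ∷ []) ∷ bicolour (b ∸ 1) a

-- The corner of insertion can be read off afterwards as the successor of the root corner. Replacing
-- it by the test `marked` turns the sum into one over all dipoles with one more edge, where the
-- counts of shapes apply.
Γ-base-b : ∀ {L} → Respects L → ∀ a b → ⟦ GammaU 2 (suc a) (suc b) 0 ⟧ L ≡
           + suc a ℤ.* L (threeWeight a b) ℤ.+ + suc a ℤ.* (+ b ℤ.* L (twoWeight a b))
Γ-base-b {L} r a b = begin
    ⟦ GammaU 2 (suc a) (suc b) 0 ⟧ L
  ≡⟨ Γ-base a (suc b) L ⟩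
    ∑ (dips m) (λ D → value (add (suc b) D))
  ≡⟨ sym (∑-cong-All {φ = λ D → ∑ (upTo (suc m)) (λ c₀ → marked (add c₀ D))} (All.map (λ {D} wf → trans
       (∑-cong (upTo (suc m)) (λ c₀ → cong (λ n → [ n ≡ᵇ suc b ] value (add c₀ D)) (next-add-root wf c₀)))
       (∑-pick (suc m) (λ c₀ → value (add c₀ D)) (s≤s (ℕₚ.m≤n+m (suc b) a)))) (WellFormed-dips m))) ⟩
    ∑ (dips m) (λ D → ∑ (upTo (suc m)) (λ c₀ → marked (add c₀ D)))
  ≡⟨ sym (∑-dips-suc m marked) ⟩
    ∑ (dips (suc m)) marked
  ≡⟨ ∑-shapes (suc m) {marked} {H} shaped shapeless ⟩
    ∑ (shapes (suc m)) H
  ≡⟨ ∑-+ (shapes (suc m)) ⟩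
    ∑ (shapes (suc m)) (first (suc b) X) ℤ.+ ∑ (shapes (suc m)) (middle-root (suc b) Y)
  ≡⟨ cong₂ ℤ._+_ (∑-first b X (suc m)) (∑-middle-root b Y (suc m)) ⟩
    + (m ∸ b) ℤ.* X ℤ.+ + (m ∸ b) ℤ.* (+ b ℤ.* Y)
  ≡⟨ cong (λ n → + n ℤ.* X ℤ.+ + n ℤ.* (+ b ℤ.* Y)) (trans (cong (_∸ b) (ℕₚ.+-suc a b)) (ℕₚ.m+n∸n≡m (suc a) b)) ⟩
    + suc a ℤ.* X ℤ.+ + suc a ℤ.* (+ b ℤ.* Y) ∎
  where
  open ≡-Reasoning
  m : ℕ
  m = a + suc b
  m≡ : suc m ≡ suc b + suc a
  m≡ = cong suc (trans (ℕₚ.+-suc a b) (trans (cong suc (ℕₚ.+-comm a b)) (sym (ℕₚ.+-suc b a))))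
  X Y : ℤ
  X = L (threeWeight a b)
  Y = L (twoWeight a b)
  value marked : Dipole → ℤ
  value D' = [ hasExcess 2 D' ] L (bareWeight (D' , suc (suc b)))
  marked D' = [ nextCorner D' 0 ≡ᵇ suc b ] value D'
  H : Shape → ℤ
  H t = first (suc b) X t ℤ.+ middle-root (suc b) Y t
  s = suc (suc b)
  shaped : ∀ D t → HasShape (suc m) D t → marked D ≡ H t
  shaped D planar (refl , zs , st) = cong (λ n → [ n ≡ᵇ suc b ] value D) (root st)
  shaped D (three p q) (p<q , zs , st) = trans (cong (λ n → [ n ≡ᵇ suc b ] value D) (proj₁ (root st)))
      (trans (at (p ≡ᵇ suc b) refl) (sym (ℤₚ.+-identityʳ _)))
    where
    excess : hasExcess 2 D ≡ true
    excess = trans (hasExcess-≡ st 2) (trans (cong₂ (λ x y → x ≡ᵇ y + 2) (sym (length-singles {os = []} zs st))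
      (Listₚ.length-map _ zs))
      (trans (cong (2 + length zs ≡ᵇ_) (ℕₚ.+-comm (length zs) 2)) (≡ᵇ-refl (length zs))))
    at : ∀ t → (p ≡ᵇ suc b) ≡ t → ([ t ] value D) ≡ [ t ] X
    at false _ = refl
    at true e with ≡ᵇ-sound p (suc b) e
    ... | refl = trans (cong ([_] L (bareWeight (D , s))) excess) (trans (bareWeight-Structure r st s)
        (trans (cong L (cong₂ (λ l Λ → g (l ∷ map (label s) (suc b ∷ q ∷ [])) ∷ Λ) refl (map-singles-letters s zs)))
        (trans (cong₂ (λ l l' → L (g (● ∷ l ∷ l' ∷ []) ∷ map letter (map (label s) zs))) (label-● {s} ℕₚ.≤-refl)
          (label-○ {s} p<q))
        (perm r (prep _ (↭-trans (↭ₚ.map⁺ letter remaining) (↭-reflexive (letters-bicolour b a))))))))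
      where
      remaining : map (label s) zs ↭ replicate b ● ++ replicate a ○
      remaining = drop-○ b (↭ₚ.drop-∷ (↭ₚ.drop-∷ (subst₂
        (λ l l' → ● ∷ l ∷ l' ∷ map (label s) zs ↭ replicate s ● ++ replicate (suc a) ○)
        (label-● {s} ℕₚ.≤-refl) (label-○ {s} p<q)
        (subst (λ ys → map (label s) (0 ∷ suc b ∷ q ∷ ys) ↭ replicate s ● ++ replicate (suc a) ○)
          (concat-singles zs) (cover-labels st (suc b) (suc a) m≡)))))
  shaped D (two q p r') (q<p , p<r , zs , st) = trans (cong (λ n → [ n ≡ᵇ suc b ] value D) (proj₁ (root st)))
      (trans (at (p ≡ᵇ suc b) refl) (sym (ℤₚ.+-identityˡ _)))
    where
    excess : hasExcess 2 D ≡ true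
    excess = trans (hasExcess-≡ st 2) (trans (cong₂ (λ x y → x ≡ᵇ suc y + 2)
      (sym (length-singles {os = (q ∷ r' ∷ []) ∷ []} zs st)) (Listₚ.length-map _ zs))
      (trans (cong (3 + length zs ≡ᵇ_) (cong suc (ℕₚ.+-comm (length zs) 2))) (≡ᵇ-refl (length zs))))
    at : ∀ t → (p ≡ᵇ suc b) ≡ t → ([ t ] value D) ≡ [ t ] Y
    at false _ = refl
    at true e with ≡ᵇ-sound p (suc b) e
    ... | refl = trans (cong ([_] L (bareWeight (D , s))) excess) (trans (bareWeight-Structure r st s)
        (trans (cong (λ Λ → L (g (● ∷ label s (suc b) ∷ []) ∷ f (label s q ∷ label s r' ∷ []) ∷ Λ))
          (map-singles-letters s zs))
        (trans (cong L (cong₂ (λ l Λ → g (● ∷ l ∷ []) ∷ Λ) (label-● {s} ℕₚ.≤-refl)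
                 (cong₂ (λ l l' → f (l ∷ l' ∷ []) ∷ map letter (map (label s) zs))
                   (label-● {s} (ℕₚ.m≤n⇒m≤1+n q<p)) (label-○ {s} p<r))))
        (perm r (prep _ (prep _ (↭-trans (↭ₚ.map⁺ letter (remaining b dropped))
          (↭-reflexive (letters-bicolour (b ∸ 1) a)))))))))
      where
      dropped : ● ∷ ○ ∷ map (label s) zs ↭ replicate b ● ++ replicate (suc a) ○
      dropped = ↭ₚ.drop-∷ (↭ₚ.drop-∷ (subst (λ ls → ● ∷ ls ↭ replicate s ● ++ replicate (suc a) ○)
        (cong₂ (λ l ls → l ∷ ls) (label-● {s} ℕₚ.≤-refl)
          (cong₂ (λ l l' → l ∷ l' ∷ map (label s) zs) (label-● {s} (ℕₚ.m≤n⇒m≤1+n q<p)) (label-○ {s} p<r)))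
        (subst (λ ys → map (label s) (0 ∷ suc b ∷ q ∷ r' ∷ ys) ↭ replicate s ● ++ replicate (suc a) ○)
          (concat-singles zs) (cover-labels st (suc b) (suc a) m≡))))
      remaining : ∀ b → ● ∷ ○ ∷ map (label s) zs ↭ replicate b ● ++ replicate (suc a) ○ → map (label s) zs ↭
        replicate (b ∸ 1) ● ++ replicate a ○
      remaining (suc b) p = drop-○ b (↭ₚ.drop-∷ p)
      -- For `b = 0` no black corner is left for `q`, so the permutation is contradictory.
      remaining zero p = ⊥-elim (all-○ (All.head (↭ₚ.All-resp-↭ (↭-sym p)
        (Allₚ.replicate⁺ {P = λ l → l ≢ ●} (suc a) (λ ())))))
        where
        all-○ : ● ≢ ● → ⊥
        all-○ ne = ne refl
  shapeless : ∀ D → Shapeless (suc m) D → marked D ≡ + 0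
  shapeless D sl = by-excess (hasExcess 2 D) refl
    where
    open Shapeless sl
    zero-marked : ∀ t → ([ t ] (+ 0)) ≡ + 0
    zero-marked true = refl
    zero-marked false = refl
    root-fixed : ∀ {ys} → ys ≡ [] → Structure (suc m) D ys os → nextCorner D 0 ≡ 0
    root-fixed refl st = root st
    by-excess : ∀ t → hasExcess 2 D ≡ t → marked D ≡ + 0
    by-excess false e = trans (cong (λ t → [ nextCorner D 0 ≡ᵇ suc b ] ([ t ] L (bareWeight (D , s)))) e)
      (zero-marked _)
    by-excess true e = cong (λ n → [ n ≡ᵇ suc b ] value D)
      (root-fixed (rootFixed (≡ᵇ-sound (suc m) _ (trans (sym (hasExcess-≡ structure 2)) e))) structure)

-- Without b-edges: the partitions (3,1,…,1) and (2,2,1,…,1)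

threePart twoTwoPart : ℕ → List ℕ
threePart n = 3 ∷ replicate (n ∸ 3) 1
twoTwoPart n = 2 ∷ 2 ∷ replicate (n ∸ 4) 1

-- Partitions sorted by the excess of their sum over their length.

sum-↭ : ∀ {xs ys} → xs ↭ ys → sum xs ≡ sum ys
sum-↭ ↭.refl = refl
sum-↭ (prep x p) = cong (λ z → x + z) (sum-↭ p)
sum-↭ {ys = _ ∷ _ ∷ ys} (swap x y p) = trans (cong (λ z → x + (y + z)) (sum-↭ p))
  (trans (sym (ℕₚ.+-assoc x y (sum ys))) (trans (cong (_+ sum ys) (ℕₚ.+-comm x y)) (ℕₚ.+-assoc y x (sum ys))))
sum-↭ (↭.trans p q) = trans (sum-↭ p) (sum-↭ q)

sum-ones : ∀ k → sum (replicate k 1) ≡ k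
sum-ones zero = refl
sum-ones (suc k) = cong suc (sum-ones k)

length≤sum : ∀ {ls} → All (1 ≤_) ls → length ls ≤ sum ls
length≤sum [] = z≤n
length≤sum {x ∷ ls} (p ∷ ps) = ℕₚ.+-mono-≤ p (length≤sum ps)

private
  too-large : ∀ k {s l} → l ≤ s → suc (k + s) ≢ l
  too-large k {s} le e = ℕₚ.<-irrefl (sym e) (ℕₚ.≤-trans (s≤s le) (s≤s (ℕₚ.m≤n+m s k)))

  swapped : ∀ (x y : ℕ) {ls ms} → ls ↭ y ∷ ms → x ∷ ls ↭ y ∷ x ∷ ms
  swapped x y p = ↭-trans (prep x p) (swap x y ↭-refl)

excess-0 : ∀ {ls} → All (1 ≤_) ls → sum ls ≡ length ls → ls ≡ replicate (length ls) 1
excess-0 [] e = refl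
excess-0 {suc zero ∷ ls} (_ ∷ ps) e = cong (1 ∷_) (excess-0 ps (ℕₚ.suc-injective e))
excess-0 {suc (suc x) ∷ ls} (_ ∷ ps) e = ⊥-elim (too-large x (length≤sum ps) (ℕₚ.suc-injective e))

excess-1 : ∀ {ls} → All (1 ≤_) ls → sum ls ≡ suc (length ls) → ∃[ k ] ls ↭ 2 ∷ replicate k 1
excess-1 {suc zero ∷ ls} (_ ∷ ps) e with excess-1 ps (ℕₚ.suc-injective e)
... | k , p = suc k , swapped 1 2 p
excess-1 {suc (suc zero) ∷ ls} (_ ∷ ps) e = length ls , prep 2
  (↭-reflexive (excess-0 ps (ℕₚ.suc-injective (ℕₚ.suc-injective e))))
excess-1 {suc (suc (suc x)) ∷ ls} (_ ∷ ps) e = ⊥-elim (too-large x (length≤sum ps)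
  (ℕₚ.suc-injective (ℕₚ.suc-injective e)))

-- These are the possible face-degree sequences in genus one. The excess two is spent either on a
-- single part or, one unit each, on two parts.
excess-2 : ∀ {ls} → All (1 ≤_) ls → sum ls ≡ 2 + length ls →
           (∃[ k ] ls ↭ 3 ∷ replicate k 1) ⊎ (∃[ k ] ls ↭ 2 ∷ 2 ∷ replicate k 1)
excess-2 {suc zero ∷ ls} (_ ∷ ps) e with excess-2 ps (ℕₚ.suc-injective e)
... | inj₁ (k , p) = inj₁ (suc k , swapped 1 3 p)
... | inj₂ (k , p) = inj₂ (suc k , ↭-trans (swapped 1 2 p) (prep 2 (swap 1 2 ↭-refl)))
excess-2 {suc (suc zero) ∷ ls} (_ ∷ ps) e with excess-1 ps (ℕₚ.suc-injective (ℕₚ.suc-injective e))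
... | k , p = inj₂ (k , prep 2 p)
excess-2 {suc (suc (suc zero)) ∷ ls} (_ ∷ ps) e =
  inj₁ (length ls , prep 3 (↭-reflexive (excess-0 ps (ℕₚ.suc-injective (ℕₚ.suc-injective (ℕₚ.suc-injective e))))))
excess-2 {suc (suc (suc (suc x))) ∷ ls} (_ ∷ ps) e = ⊥-elim
  (too-large x (length≤sum ps) (ℕₚ.suc-injective (ℕₚ.suc-injective (ℕₚ.suc-injective e))))

removeOne-sound : ∀ x ys {zs} → removeOne _≡ᵇ_ x ys ≡ (true , zs) → ys ↭ x ∷ zs
removeOne-sound x (y ∷ ys) e with x ≡ᵇ y in eq
removeOne-sound x (y ∷ ys) refl | true rewrite ≡ᵇ-sound x y eq = ↭-refl
removeOne-sound x (y ∷ ys) e | false with removeOne _≡ᵇ_ x ys in eq'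
removeOne-sound x (y ∷ ys) refl | false | true , zs = swapped y x (removeOne-sound x ys eq')

removeOne-absent : ∀ x ys {zs} → removeOne _≡ᵇ_ x ys ≡ (false , zs) → All (x ≢_) ys
removeOne-absent x [] e = []
removeOne-absent x (y ∷ ys) e with x ≡ᵇ y in eq
removeOne-absent x (y ∷ ys) e | false with removeOne _≡ᵇ_ x ys in eq'
removeOne-absent x (y ∷ ys) refl | false | false , zs = x≢y ∷ removeOne-absent x ys eq'
  where
  x≢y : x ≢ y
  x≢y refl with trans (sym eq) (≡ᵇ-refl x)
  ... | ()

bagEq-sound : ∀ xs ys → bagEq _≡ᵇ_ xs ys ≡ true → xs ↭ ys
bagEq-sound [] [] e = ↭-refl
bagEq-sound (x ∷ xs) ys e with removeOne _≡ᵇ_ x ys in eq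
... | true , zs = ↭-trans (prep x (bagEq-sound xs zs e)) (↭-sym (removeOne-sound x ys eq))

bagEq-complete : ∀ xs ys → xs ↭ ys → bagEq _≡ᵇ_ xs ys ≡ true
bagEq-complete [] ys p with ↭ₚ.↭-empty-inv (↭-sym p)
... | refl = refl
bagEq-complete (x ∷ xs) ys p with removeOne _≡ᵇ_ x ys in eq
... | true , zs = bagEq-complete xs zs (↭ₚ.drop-∷ (↭-trans p (removeOne-sound x ys eq)))
... | false , zs = ⊥-elim (All.head (↭ₚ.All-resp-↭ (↭-sym p) (removeOne-absent x ys eq)) refl)

module _ {ls : List ℕ} (positive : All (1 ≤_) ls) (V : List ℕ → ℤ) (V-↭ : ∀ {xs ys} → xs ↭ ys → V xs ≡ V ys) where

  private
    n : ℕ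
    n = sum ls
    isThree isTwoTwo : Bool
    -- The size guards are those of `psiSeries`; below them truncated subtraction would produce a
    -- partition of a number other than `n`.
    isThree = (3 ≤ᵇ n) ∧ bagEq _≡ᵇ_ ls (threePart n)
    isTwoTwo = (4 ≤ᵇ n) ∧ bagEq _≡ᵇ_ ls (twoTwoPart n)

    three≢twoTwo : ∀ {k l} → 3 ∷ replicate k 1 ↭ 2 ∷ 2 ∷ replicate l 1 → ⊥
    three≢twoTwo {l = l} p = ℕₚ.1+n≰n (All.head (↭ₚ.All-resp-↭ {P = _≤ 2} (↭-sym p)
      (ℕₚ.≤-refl ∷ ℕₚ.≤-refl ∷ Allₚ.replicate⁺ l (s≤s z≤n))))

    three-n : ∀ {k} → ls ↭ 3 ∷ replicate k 1 → n ≡ 3 + k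
    three-n {k} p = trans (sum-↭ p) (cong (λ z → 3 + z) (sum-ones k))

    twoTwo-n : ∀ {k} → ls ↭ 2 ∷ 2 ∷ replicate k 1 → n ≡ 4 + k
    twoTwo-n {k} p = trans (sum-↭ p) (cong (λ z → 4 + z) (sum-ones k))

    excess-three : ∀ {k} → ls ↭ 3 ∷ replicate k 1 → (n ≡ᵇ length ls + 2) ≡ true
    excess-three {k} p = trans (cong₂ _≡ᵇ_ (three-n p) (trans (ℕₚ.+-comm (length ls) 2)
      (cong (λ z → 2 + z) (trans (↭ₚ.↭-length p) (cong suc (Listₚ.length-replicate k)))))) (≡ᵇ-refl (3 + k))

    excess-twoTwo : ∀ {k} → ls ↭ 2 ∷ 2 ∷ replicate k 1 → (n ≡ᵇ length ls + 2) ≡ true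
    excess-twoTwo {k} p = trans (cong₂ _≡ᵇ_ (twoTwo-n p)
      (trans (ℕₚ.+-comm (length ls) 2) (cong (λ z → 2 + z)
        (trans (↭ₚ.↭-length p) (cong (λ z → 2 + z) (Listₚ.length-replicate k)))))) (≡ᵇ-refl (4 + k))

    three-true : ∀ {k} → ls ↭ 3 ∷ replicate k 1 → isThree ≡ true
    three-true {k} p = trans (cong (λ n → (3 ≤ᵇ n) ∧ bagEq _≡ᵇ_ ls (threePart n)) (three-n p)) (bagEq-complete ls _ p)

    twoTwo-true : ∀ {k} → ls ↭ 2 ∷ 2 ∷ replicate k 1 → isTwoTwo ≡ true
    twoTwo-true {k} p = trans (cong (λ n → (4 ≤ᵇ n) ∧ bagEq _≡ᵇ_ ls (twoTwoPart n)) (twoTwo-n p))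
      (bagEq-complete ls _ p)

  -- The two patterns exclude each other by their largest part, each has excess two, and `excess-2`
  -- leaves no third possibility.
  by-partition : ([ n ≡ᵇ length ls + 2 ] V ls) ≡ ([ isThree ] V (threePart n)) ℤ.+ ([ isTwoTwo ] V (twoTwoPart n))
  by-partition = go isThree isTwoTwo refl refl
    where
    go : ∀ s t → isThree ≡ s → isTwoTwo ≡ t → ([ n ≡ᵇ length ls + 2 ] V ls) ≡ ([ s ] V (threePart n)) ℤ.+
      ([ t ] V (twoTwoPart n))
    go true true e e' = ⊥-elim (three≢twoTwo {n ∸ 3} {n ∸ 4}
      (↭-trans (↭-sym (bagEq-sound ls _ (proj₂ (∧-true {3 ≤ᵇ n} e)))) (bagEq-sound ls _ (proj₂ (∧-true {4 ≤ᵇ n} e')))))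
    go true false e e' with bagEq-sound ls _ (proj₂ (∧-true {3 ≤ᵇ n} e))
    ... | p = trans (cong ([_] V ls) (excess-three {n ∸ 3} p)) (trans (V-↭ p) (sym (ℤₚ.+-identityʳ _)))
    go false true e e' with bagEq-sound ls _ (proj₂ (∧-true {4 ≤ᵇ n} e'))
    ... | p = trans (cong ([_] V ls) (excess-twoTwo {n ∸ 4} p)) (trans (V-↭ p) (sym (ℤₚ.+-identityˡ _)))
    go false false e e' with n ≡ᵇ length ls + 2 in eq
    ... | false = refl
    ... | true with excess-2 positive (trans (≡ᵇ-sound n (length ls + 2) eq) (ℕₚ.+-comm (length ls) 2))
    ... | inj₁ (k , p) = case trans (sym e) (three-true p) of λ ()
    ... | inj₂ (k , p) = case trans (sym e') (twoTwo-true p) of λ ()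

faceLengths : Dipole → List ℕ
faceLengths D = map length (faces D)

∑-psi : ∀ {n} m → n ≡ suc m → ∀ λs → sum λs ≡ n → ∀ K →
        ∑ (dips m) (λ D → [ bagEq _≡ᵇ_ (faceLengths D) λs ] K) ≡ + psi λs ℤ.* K
∑-psi m refl λs e K = trans (sym (∑-dipoles m _)) (trans
  (cong (λ n → ∑ (dipoles n) (λ D → [ bagEq _≡ᵇ_ (faceLengths D) λs ] K)) (sym e))
  (∑-if-const (dipoles (sum λs)) (λ D → bagEq _≡ᵇ_ (faceLengths D) λs) K))

white : ℕ → Var
white n = f (replicate n ○)

white-labels : ∀ xs → map (label 1) (map suc xs) ≡ replicate (length xs) ○
white-labels [] = refl
white-labels (x ∷ xs) = cong (○ ∷_) (white-labels xs)

rep-mono : ∀ v k {L} → ⟦ varP v ^P k ⟧ L ≡ L (replicate k v)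
rep-mono v zero {L} = ⟦mono⟧ [] {L}
rep-mono v (suc k) {L} = trans (⟦mono*⟧ (v ∷ []) (varP v ^P k)) (rep-mono v k)

-- The new edge is edge 1 and secondary, so the root corner alone is black. The insertion only
-- splits the root corner off; every face of `D` survives with its length, all white. The weight
-- therefore depends only on the face degrees of `D`.
Γ-base-ψ : ∀ {L} → Respects L → ∀ a → ⟦ GammaU 2 (suc a) 0 0 ⟧ L ≡ ⟦ psiSeries (suc a) 0 0 ⟧ (λ M → L (g (● ∷ []) ∷ M))
Γ-base-ψ {L} r a = begin
    ⟦ GammaU 2 (suc a) 0 0 ⟧ L
  ≡⟨ Γ-base a 0 L ⟩
    ∑ (dips (a + 0)) (λ D → [ hasExcess 2 (add 0 D) ] L (bareWeight (add 0 D , 1)))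
  ≡⟨ cong (λ m → ∑ (dips m) (λ D → [ hasExcess 2 (add 0 D) ] L (bareWeight (add 0 D , 1)))) (ℕₚ.+-identityʳ a) ⟩
    ∑ (dips a) (λ D → [ hasExcess 2 (add 0 D) ] L (bareWeight (add 0 D , 1)))
  ≡⟨ ∑-cong-All (All.map (λ { (xs , os , st) → perDipole st }) (Structure-dips a)) ⟩
    ∑ (dips a) (λ D → ([ (3 ≤ᵇ suc a) ∧ bagEq _≡ᵇ_ (faceLengths D) (threePart (suc a)) ] V (threePart (suc a))) ℤ.+
                      ([ (4 ≤ᵇ suc a) ∧ bagEq _≡ᵇ_ (faceLengths D) (twoTwoPart (suc a)) ] V (twoTwoPart (suc a))))
  ≡⟨ ∑-+ (dips a) ⟩
    ∑ (dips a) (λ D → [ (3 ≤ᵇ suc a) ∧ bagEq _≡ᵇ_ (faceLengths D) (threePart (suc a)) ] V (threePart (suc a))) ℤ.+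
    ∑ (dips a) (λ D → [ (4 ≤ᵇ suc a) ∧ bagEq _≡ᵇ_ (faceLengths D) (twoTwoPart (suc a)) ] V (twoTwoPart (suc a)))
  ≡⟨ cong₂ ℤ._+_ (threes a) (twoTwos a) ⟩
    ⟦ threeTerm ⟧ K ℤ.+ ⟦ twoTwoTerm ⟧ K
  ≡⟨ sym (⟦+⟧ threeTerm twoTwoTerm) ⟩
    ⟦ psiSeries (suc a) 0 0 ⟧ K ∎
  where
  open ≡-Reasoning
  K : Functional
  K M = L (g (● ∷ []) ∷ M)
  V : List ℕ → ℤ
  V ls = K (map white ls)
  V-↭ : ∀ {xs ys} → xs ↭ ys → V xs ≡ V ys
  V-↭ p = perm r (prep _ (↭ₚ.map⁺ white p))
  threeOf twoTwoOf : ℕ → Poly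
  threeOf n = if 3 ≤ᵇ n then scaleP (+ psi (3 ∷ replicate (n ∸ 3) 1))
    (fP (○ ∷ ○ ∷ ○ ∷ []) *P (fP (○ ∷ []) ^P (n ∸ 3))) else 0P
  twoTwoOf n = if 4 ≤ᵇ n then scaleP (+ psi (2 ∷ 2 ∷ replicate (n ∸ 4) 1))
    ((fP (○ ∷ ○ ∷ []) ^P 2) *P (fP (○ ∷ []) ^P (n ∸ 4))) else 0P
  threeTerm = threeOf (suc a)
  twoTwoTerm = twoTwoOf (suc a)
  threes : ∀ a → ∑ (dips a) (λ D → [ (3 ≤ᵇ suc a) ∧ bagEq _≡ᵇ_ (faceLengths D) (threePart (suc a)) ] V
    (threePart (suc a))) ≡ ⟦ threeOf (suc a) ⟧ K
  threes zero = ∑-zero (dips 0)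
  threes (suc zero) = ∑-zero (dips 1)
  threes (suc (suc k)) = trans (∑-psi (2 + k) refl (3 ∷ replicate k 1) (cong (λ z → 3 + z) (sum-ones k))
    (V (3 ∷ replicate k 1)))
    (sym (trans (⟦scale⟧ (+ psi (3 ∷ replicate k 1)) (fP (○ ∷ ○ ∷ ○ ∷ []) *P (fP (○ ∷ []) ^P k)) {K})
      (cong (λ z → + psi (3 ∷ replicate k 1) ℤ.* z)
      (trans (⟦mono*⟧ (f (○ ∷ ○ ∷ ○ ∷ []) ∷ []) (fP (○ ∷ []) ^P k) {K})
        (trans (rep-mono (f (○ ∷ [])) k {λ M → K (f (○ ∷ ○ ∷ ○ ∷ []) ∷ M)})
        (cong (λ M → K (f (○ ∷ ○ ∷ ○ ∷ []) ∷ M)) (sym (Listₚ.map-replicate white k 1))))))))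
  twoTwos : ∀ a → ∑ (dips a) (λ D → [ (4 ≤ᵇ suc a) ∧ bagEq _≡ᵇ_ (faceLengths D) (twoTwoPart (suc a)) ] V
    (twoTwoPart (suc a))) ≡ ⟦ twoTwoOf (suc a) ⟧ K
  twoTwos zero = ∑-zero (dips 0)
  twoTwos (suc zero) = ∑-zero (dips 1)
  twoTwos (suc (suc zero)) = ∑-zero (dips 2)
  twoTwos (suc (suc (suc k))) = trans (∑-psi (3 + k) refl (2 ∷ 2 ∷ replicate k 1)
    (cong (λ z → 4 + z) (sum-ones k)) (V (2 ∷ 2 ∷ replicate k 1)))
    (sym (trans (⟦scale⟧ (+ psi (2 ∷ 2 ∷ replicate k 1)) ((fP (○ ∷ ○ ∷ []) ^P 2) *P (fP (○ ∷ []) ^P k)) {K})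
      (cong (λ z → + psi (2 ∷ 2 ∷ replicate k 1) ℤ.* z)
      (trans (⟦*⟧ (fP (○ ∷ ○ ∷ []) ^P 2) (fP (○ ∷ []) ^P k) {K})
        (trans (rep-mono (f (○ ∷ ○ ∷ [])) 2 {λ M → ⟦ fP (○ ∷ []) ^P k ⟧ (λ M' → K (M ++ M'))})
        (trans (rep-mono (f (○ ∷ [])) k {λ M → K (f (○ ∷ ○ ∷ []) ∷ f (○ ∷ ○ ∷ []) ∷ M)})
          (cong (λ M → K (f (○ ∷ ○ ∷ []) ∷ f (○ ∷ ○ ∷ []) ∷ M)) (sym (Listₚ.map-replicate white k 1)))))))))
  perDipole : ∀ {D xs os} → Structure a D xs os →
    ([ hasExcess 2 (add 0 D) ] L (bareWeight (add 0 D , 1))) ≡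
    ([ (3 ≤ᵇ suc a) ∧ bagEq _≡ᵇ_ (faceLengths D) (threePart (suc a)) ] V (threePart (suc a))) ℤ.+
    ([ (4 ≤ᵇ suc a) ∧ bagEq _≡ᵇ_ (faceLengths D) (twoTwoPart (suc a)) ] V (twoTwoPart (suc a)))
  perDipole {D} {xs} {os} st = trans (cong₂ ([_]_) excess value)
    (subst (λ n → ([ n ≡ᵇ length (faceLengths D) + 2 ] V (faceLengths D)) ≡
       ([ (3 ≤ᵇ n) ∧ bagEq _≡ᵇ_ (faceLengths D) (threePart n) ] V (threePart n)) ℤ.+
       ([ (4 ≤ᵇ n) ∧ bagEq _≡ᵇ_ (faceLengths D) (twoTwoPart n) ] V (twoTwoPart n))) total (by-partition positive V V-↭))
    where
    lengths : faceLengths D ↭ suc (length xs) ∷ map length os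
    lengths = face-lengths st
    sum-lengths : ∀ os → sum (map length os) ≡ length (concat {A = ℕ} os)
    sum-lengths [] = refl
    sum-lengths (o ∷ os) = trans (cong (λ z → length o + z) (sum-lengths os)) (sym (Listₚ.length-++ o))
    total : sum (faceLengths D) ≡ suc a
    total = trans (sum-↭ lengths) (cong suc (trans (cong (λ z → length xs + z) (sum-lengths os)) (length-cover st)))
    nonempty : ∀ {os} → All (Cycle (nextCorner D)) os → All (1 ≤_) (map length os)
    nonempty [] = []
    nonempty {(_ ∷ _) ∷ _} (_ ∷ cs) = s≤s z≤n ∷ nonempty cs
    positive : All (1 ≤_) (faceLengths D)
    positive = ↭ₚ.All-resp-↭ (↭-sym lengths) (s≤s z≤n ∷ nonempty (cycles st))
    excess : hasExcess 2 (add 0 D) ≡ (suc a ≡ᵇ length (faceLengths D) + 2)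
    excess = trans (hasExcess-≡ (Structure-cut-root st) 2) (cong (λ n → suc a ≡ᵇ n + 2)
      (sym (trans (↭ₚ.↭-length lengths) (cong suc (trans (Listₚ.length-map length os)
        (sym (Listₚ.length-map (map suc) os)))))))
    whites : ∀ os → map f (map (map (label 1)) (map (map suc) os)) ≡ map white (map length os)
    whites [] = refl
    whites (o ∷ os) = cong₂ (λ S Λ → f S ∷ Λ) (white-labels o) (whites os)
    value : L (bareWeight (add 0 D , 1)) ≡ V (faceLengths D)
    value = trans (bareWeight-Structure r (Structure-cut-root st) 1) (trans
      (cong₂ (λ S Λ → K (f (○ ∷ S) ∷ Λ)) (white-labels xs) (whites os)) (V-↭ (↭-sym lengths)))

-- Products of series in disjoint sets of variables

infix 4 _≋S_
_≋S_ : Series → Series → Set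
s ≋S t = ∀ a b c → s a b c ≋ t a b c

⟦sumTo⟧ : ∀ n F {L} → ⟦ sumTo n F ⟧ L ≡ ∑ (upTo (suc n)) (λ i → ⟦ F i ⟧ L)
⟦sumTo⟧ n F = ∑-concatMap F (upTo (suc n))

sumTo-cong : ∀ n {F G} → (∀ i → i ≤ n → F i ≋ G i) → sumTo n F ≋ sumTo n G
eval (sumTo-cong n {F} {G} e) L r = trans (⟦sumTo⟧ n F)
  (trans (∑-cong-All {φ = λ i → ⟦ F i ⟧ L} (All.map (λ {i} le → eval (e i le) L r) (upTo-≤ n))) (sym (⟦sumTo⟧ n G)))

sumTo-only : ∀ {n} i₀ {F} → i₀ ≤ n → (∀ i → i ≤ n → i ≢ i₀ → F i ≋ 0P) → sumTo n F ≋ F i₀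
eval (sumTo-only {n} i₀ {F} le e) L r = trans (⟦sumTo⟧ n F)
  (trans (∑-cong-All {φ = value} {ψ = λ i → [ i ≡ᵇ i₀ ] value i}
    (All.map (λ {i} le → at i le (i ≡ᵇ i₀) refl) (upTo-≤ n)))
         (∑-pick (suc n) value (s≤s le)))
  where
  value : ℕ → ℤ
  value i = ⟦ F i ⟧ L
  at : ∀ i → i ≤ n → ∀ t → (i ≡ᵇ i₀) ≡ t → value i ≡ [ t ] value i
  at i le true _ = refl
  at i le false eq = eval (e i le (λ { refl → case trans (sym eq) (≡ᵇ-refl i) of λ () })) L r

sumTo-0 : ∀ n {F} → (∀ i → i ≤ n → F i ≋ 0P) → sumTo n F ≋ 0P
eval (sumTo-0 n {F} e) L r = trans (⟦sumTo⟧ n F) (∑-zero-All {φ = λ i → ⟦ F i ⟧ L}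
  (All.map (λ {i} le → eval (e i le) L r) (upTo-≤ n)))

⊗-cong : ∀ {s s' t t'} → s ≋S s' → t ≋S t' → (s ⊗ t) ≋S (s' ⊗ t')
⊗-cong {s} {s'} {t} {t'} e e' a b c = sumTo-cong a (λ i _ → sumTo-cong b (λ j _ → sumTo-cong c (λ k _ →
  scaleP-cong (+ ((a C i) * (b C j) * (c C k))) {s i j k *P t (a ∸ i) (b ∸ j) (c ∸ k)}
    {s' i j k *P t' (a ∸ i) (b ∸ j) (c ∸ k)}
    (*P-cong {s i j k} {s' i j k} (e i j k) (e' (a ∸ i) (b ∸ j) (c ∸ k))))))

⊕-cong : ∀ {s s' t t'} → s ≋S s' → t ≋S t' → (s ⊕ t) ≋S (s' ⊕ t')
⊕-cong {s} {s'} e e' a b c = +P-cong {s a b c} {s' a b c} (e a b c) (e' a b c)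

≋S-trans : ∀ {s t u} → s ≋S t → t ≋S u → s ≋S u
≋S-trans e e' a b c = ≋-trans (e a b c) (e' a b c)

productTerm : Series → Series → (a b c i j k : ℕ) → Poly
productTerm s t a b c i j k = scaleP (+ ((a C i) * (b C j) * (c C k))) (s i j k *P t (a ∸ i) (b ∸ j) (c ∸ k))

Vanishes : Series → Series → (a b c i j k : ℕ) → Set
Vanishes s t a b c i j k = (s i j k ≋ 0P) ⊎ (t (a ∸ i) (b ∸ j) (c ∸ k) ≋ 0P)

scaleP-0 : ∀ k {p} → p ≋ 0P → scaleP k p ≋ 0P
scaleP-0 k e = scaleP-cong k e

productTerm-0 : ∀ {s t a b c} i j k → Vanishes s t a b c i j k → productTerm s t a b c i j k ≋ 0P
productTerm-0 {s} {t} {a} {b} {c} i j k (inj₁ e) =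
  scaleP-0 (+ ((a C i) * (b C j) * (c C k))) {s i j k *P t (a ∸ i) (b ∸ j) (c ∸ k)}
    (*P-cong {s i j k} {0P} e (≋-refl {t (a ∸ i) (b ∸ j) (c ∸ k)}))
productTerm-0 {s} {t} {a} {b} {c} i j k (inj₂ e) =
  scaleP-0 (+ ((a C i) * (b C j) * (c C k))) {s i j k *P t (a ∸ i) (b ∸ j) (c ∸ k)}
    (≋-trans (*P-cong (≋-refl {s i j k}) e) (*P-zeroʳ (s i j k)))

⊗-single : ∀ s t a b c i₀ j₀ k₀ → i₀ ≤ a → j₀ ≤ b → k₀ ≤ c →
           (∀ i j k → i ≤ a → i ≢ i₀ → Vanishes s t a b c i j k) →
           (∀ j k → j ≤ b → j ≢ j₀ → Vanishes s t a b c i₀ j k) →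
           (∀ k → k ≤ c → k ≢ k₀ → Vanishes s t a b c i₀ j₀ k) →
           (s ⊗ t) a b c ≋ productTerm s t a b c i₀ j₀ k₀
⊗-single s t a b c i₀ j₀ k₀ li lj lk ei ej ek =
  ≋-trans (sumTo-only {a} i₀ {F = λ i → sumTo b (λ j → sumTo c (λ k → productTerm s t a b c i j k))} li
    (λ i le ne → sumTo-0 b (λ j _ → sumTo-0 c (λ k _ → productTerm-0 {s} {t} {a} {b} {c} i j k (ei i j k le ne)))))
  (≋-trans (sumTo-only {b} j₀ {F = λ j → sumTo c (λ k → productTerm s t a b c i₀ j k)} lj
    (λ j le ne → sumTo-0 c (λ k _ → productTerm-0 {s} {t} {a} {b} {c} i₀ j k (ej j k le ne))))
           (sumTo-only {c} k₀ {F = λ k → productTerm s t a b c i₀ j₀ k} lk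
             (λ k le ne → productTerm-0 {s} {t} {a} {b} {c} i₀ j₀ k (ek k le ne))))

⊗-0 : ∀ s t a b c → (∀ i j k → i ≤ a → Vanishes s t a b c i j k) → (s ⊗ t) a b c ≋ 0P
⊗-0 s t a b c e = sumTo-0 a (λ i le → sumTo-0 b (λ j _ → sumTo-0 c
  (λ k _ → productTerm-0 {s} {t} {a} {b} {c} i j k (e i j k le))))

atZero : ℕ → Poly → Poly
atZero b p = if isZero b then p else 0P

vSeries : (ℕ → Poly) → Series
vSeries u a b c = if isZero a ∧ isZero b then u c else 0P

yvSeries xyvSeries : (ℕ → ℕ → Poly) → Series
yvSeries G a b c = if isZero a then G b c else 0P
xyvSeries G a b c = if a ≡ᵇ 1 then G b c else 0P

xSeries : (ℕ → Poly) → Series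
xSeries Y a b c = if isZero b ∧ isZero c then Y a else 0P

scaleP-1 : ∀ p → scaleP (+ 1) p ≋ p
eval (scaleP-1 p) L r = trans (⟦scale⟧ (+ 1) p) (ℤₚ.*-identityˡ _)

private
  one-one-one : ∀ {x y z} → x ≡ 1 → y ≡ 1 → z ≡ 1 → ∀ p → scaleP (+ (x * y * z)) p ≋ p
  one-one-one refl refl refl p = scaleP-1 p

  ∸-pos : ∀ {n i} → i ≤ n → i ≢ n → ∃[ d ] n ∸ i ≡ suc d
  ∸-pos {n} {i} le ne with n ∸ i in e
  ... | zero = ⊥-elim (ne (ℕₚ.≤-antisym le (ℕₚ.m∸n≡0⇒m≤n e)))
  ... | suc d = d , refl

xSeries-0ʸ : ∀ Y a {b} c {d} → b ≡ suc d → xSeries Y a b c ≋ 0P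
xSeries-0ʸ Y a c refl = ≋-refl

xSeries-0ᵛ : ∀ Y a b {c d} → c ≡ suc d → xSeries Y a b c ≋ 0P
xSeries-0ᵛ Y a zero refl = ≋-refl
xSeries-0ᵛ Y a (suc b) refl = ≋-refl

xSeries-00 : ∀ Y a {b c} → b ≡ 0 → c ≡ 0 → xSeries Y a b c ≋ Y a
xSeries-00 Y a refl refl = ≋-refl

yv⊗x : ∀ G Y a b c → (yvSeries G ⊗ xSeries Y) a b c ≋ (G b c *P Y a)
yv⊗x G Y a b c = ≋-trans
  (⊗-single (yvSeries G) (xSeries Y) a b c 0 b c z≤n ℕₚ.≤-refl ℕₚ.≤-refl
    (λ { zero j k _ ne → ⊥-elim (ne refl) ; (suc i) j k _ _ → inj₁ ≋-refl })
    (λ j k le ne → inj₂ (xSeries-0ʸ Y a (c ∸ k) (proj₂ (∸-pos le ne))))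
    (λ k le ne → inj₂ (xSeries-0ᵛ Y a (b ∸ b) (proj₂ (∸-pos le ne)))))
  (≋-trans (one-one-one refl (nCn≡1 b) (nCn≡1 c) (G b c *P xSeries Y a (b ∸ b) (c ∸ c)))
           (*P-cong (≋-refl {G b c}) (xSeries-00 Y a (ℕₚ.n∸n≡0 b) (ℕₚ.n∸n≡0 c))))

-- In exponential form the single factor `x` contributes the binomial coefficient `suc a C 1`.
xyv⊗x : ∀ G Y a b c → (xyvSeries G ⊗ xSeries Y) (suc a) b c ≋ scaleP (+ suc a) (G b c *P Y a)
xyv⊗x G Y a b c = ≋-trans
  (⊗-single (xyvSeries G) (xSeries Y) (suc a) b c 1 b c (s≤s z≤n) ℕₚ.≤-refl ℕₚ.≤-refl
    (λ { zero j k _ _ → inj₁ ≋-refl ; (suc zero) j k _ ne → ⊥-elim (ne refl) ; (suc (suc i)) j k _ _ → inj₁ ≋-refl })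
    (λ j k le ne → inj₂ (xSeries-0ʸ Y a (c ∸ k) (proj₂ (∸-pos le ne))))
    (λ k le ne → inj₂ (xSeries-0ᵛ Y a (b ∸ b) (proj₂ (∸-pos le ne)))))
  (≋-trans (≋-reflexive (cong (λ n → scaleP (+ n) (G b c *P xSeries Y a (b ∸ b) (c ∸ c))) binomials))
           (scaleP-cong (+ suc a) (*P-cong (≋-refl {G b c}) (xSeries-00 Y a (ℕₚ.n∸n≡0 b) (ℕₚ.n∸n≡0 c)))))
  where
  binomials : (suc a C 1) * (b C b) * (c C c) ≡ suc a
  binomials = trans (cong₂ _*_ (cong₂ _*_ (nC1≡n (suc a)) (nCn≡1 b)) (nCn≡1 c))
    (trans (ℕₚ.*-identityʳ _) (ℕₚ.*-identityʳ (suc a)))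

xyv⊗x-0 : ∀ G Y b c → (xyvSeries G ⊗ xSeries Y) 0 b c ≋ 0P
xyv⊗x-0 G Y b c = ⊗-0 (xyvSeries G) (xSeries Y) 0 b c (λ { zero j k z≤n → inj₁ ≋-refl })

xS≋ : xS ≋S xSeries (λ a → if a ≡ᵇ 1 then 1P else 0P)
xS≋ a b c with a ≡ᵇ 1
... | true = ≋-refl
... | false with isZero b ∧ isZero c
... | true = ≋-refl
... | false = ≋-refl

yv⊗xS : ∀ G → (yvSeries G ⊗ xS) ≋S xyvSeries G
yv⊗xS G a b c = ≋-trans (⊗-cong {yvSeries G} (λ a b c → ≋-refl) xS≋ a b c)
  (≋-trans (yv⊗x G (λ a → if a ≡ᵇ 1 then 1P else 0P) a b c) at)
  where
  at : (G b c *P (if a ≡ᵇ 1 then 1P else 0P)) ≋ xyvSeries G a b c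
  at with a ≡ᵇ 1
  ... | true = *P-identityʳ (G b c)
  ... | false = *P-zeroʳ (G b c)

v≋yv : ∀ u → vSeries u ≋S yvSeries (λ b c → atZero b (u c))
v≋yv u zero b c = ≋-refl
v≋yv u (suc a) b c = ≋-refl

v⊗y : ∀ u i → (vSeries u ⊗ phiY i) ≋S yvSeries (λ b c → u c *P phiY i 0 b 0)
v⊗y u i zero b c = ≋-trans
  (⊗-single (vSeries u) (phiY i) 0 b c 0 0 c z≤n z≤n ℕₚ.≤-refl
    (λ { zero j k _ ne → ⊥-elim (ne refl) ; (suc _) j k () _ })
    (λ { zero k _ ne → ⊥-elim (ne refl) ; (suc j) k _ _ → inj₁ ≋-refl })
    (λ k le ne → inj₂ (≋-reflexive (cong (λ d → if isZero d then phiY i 0 b 0 else 0P) (proj₂ (∸-pos le ne))))))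
  (≋-trans (one-one-one {1} {1} refl refl (nCn≡1 c) (u c *P phiY i 0 b (c ∸ c)))
           (≋-reflexive (cong (λ d → u c *P phiY i 0 b d) (ℕₚ.n∸n≡0 c))))
v⊗y u i (suc a) b c = ⊗-0 (vSeries u) (phiY i) (suc a) b c
  (λ { zero j k _ → inj₂ ≋-refl ; (suc _) j k _ → inj₁ ≋-refl })

cst⊗v : ∀ p u → (cst p ⊗ vSeries u) ≋S vSeries (λ c → p *P u c)
cst⊗v p u zero zero c = ≋-trans
  (⊗-single (cst p) (vSeries u) 0 0 c 0 0 0 z≤n z≤n z≤n
    (λ { zero j k _ ne → ⊥-elim (ne refl) ; (suc _) j k () _ })
    (λ { zero k _ ne → ⊥-elim (ne refl) ; (suc _) k () _ })
    (λ { zero _ ne → ⊥-elim (ne refl) ; (suc k) _ _ → inj₁ ≋-refl }))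
  (scaleP-1 (p *P u c))
cst⊗v p u zero (suc b) c = ⊗-0 (cst p) (vSeries u) 0 (suc b) c
  (λ { zero zero k _ → inj₂ ≋-refl ; zero (suc j) k _ → inj₁ ≋-refl ; (suc _) j k _ → inj₁ ≋-refl })
cst⊗v p u (suc a) b c = ⊗-0 (cst p) (vSeries u) (suc a) b c
  (λ { zero j k _ → inj₂ ≋-refl ; (suc _) j k _ → inj₁ ≋-refl })

v⊗cst : ∀ u q → (vSeries u ⊗ cst q) ≋S vSeries (λ c → u c *P q)
v⊗cst u q zero zero c = ≋-trans
  (⊗-single (vSeries u) (cst q) 0 0 c 0 0 c z≤n z≤n ℕₚ.≤-refl
    (λ { zero j k _ ne → ⊥-elim (ne refl) ; (suc _) j k () _ })
    (λ { zero k _ ne → ⊥-elim (ne refl) ; (suc _) k () _ })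
    (λ k le ne → inj₂ (≋-reflexive (cong (cst q 0 0) (proj₂ (∸-pos le ne))))))
  (≋-trans (one-one-one {1} {1} refl refl (nCn≡1 c) (u c *P cst q 0 0 (c ∸ c)))
    (≋-reflexive (cong (λ d → u c *P cst q 0 0 d) (ℕₚ.n∸n≡0 c))))
v⊗cst u q zero (suc b) c = ⊗-0 (vSeries u) (cst q) 0 (suc b) c
  (λ { zero zero k _ → inj₂ ≋-refl ; zero (suc j) k _ → inj₁ ≋-refl ; (suc _) j k _ → inj₁ ≋-refl })
v⊗cst u q (suc a) b c = ⊗-0 (vSeries u) (cst q) (suc a) b c
  (λ { zero j k _ → inj₂ ≋-refl ; (suc _) j k _ → inj₁ ≋-refl })

v⊕v : ∀ u u' → (vSeries u ⊕ vSeries u') ≋S vSeries (λ c → u c +P u' c)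
v⊕v u u' zero zero c = ≋-refl
v⊕v u u' zero (suc b) c = ≋-refl
v⊕v u u' (suc a) b c = ≋-refl

expX-1 : Poly → ℕ → Poly
expX-1 p a = p ^P a +P negP (if isZero a then 1P else 0P)

expX⊖1≋ : ∀ p → (expX p ⊖ 1S) ≋S xSeries (expX-1 p)
expX⊖1≋ p zero zero zero = ≋-refl
expX⊖1≋ p (suc a) zero zero = ≋-refl
expX⊖1≋ p zero zero (suc c) = ≋-refl
expX⊖1≋ p (suc a) zero (suc c) = ≋-refl
expX⊖1≋ p zero (suc b) c = ≋-refl
expX⊖1≋ p (suc a) (suc b) c = ≋-refl

expX-1-0 : ∀ p → expX-1 p 0 ≋ 0P
eval (expX-1-0 p) L r = trans (⟦+⟧ 1P (negP 1P) {L}) (trans (cong (λ z → ⟦ 1P ⟧ L ℤ.+ z) (⟦neg⟧ 1P {L}))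
  (ℤₚ.+-inverseʳ (⟦ 1P ⟧ L)))

-- The right-hand side with an arbitrary family u in place of the τ_{R,S}

f○ f● : Poly
f○ = fP (○ ∷ [])
f● = fP (● ∷ [])

Family : Set
Family = Word → Word → ℕ → Poly

v₁ v₂ v₃ v₄ v₅ : Family → ℕ → Poly
v₁ u c = (wP *P f●) *P u (○ ∷ ○ ∷ []) (● ∷ []) c +P u (○ ∷ ○ ∷ []) [] c
v₂ u c = (wP ^P 2) *P u (● ∷ ● ∷ []) (● ∷ []) c +P ((wP ^P 3) *P f●) *P u (● ∷ ● ∷ []) (● ∷ ● ∷ []) c
v₃ u c = ((wP *P fP (● ∷ ● ∷ ○ ∷ [])) *P u [] [] c +P (wP *P f●) *P u (● ∷ ○ ∷ []) [] c) +P fP (● ∷ ○ ∷ []) *P u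
  (○ ∷ []) [] c
v₄ u c = ((wP *P fP (● ∷ ● ∷ [])) *P u [] [] c +P (wP *P f●) *P u (● ∷ []) [] c) *P fP (● ∷ ○ ∷ [])
v₅ u c = (wP *P f●) *P u [] [] c

-- One expression serves twice: at `tauCoeff` it unfolds to the right-hand side without `B⁽¹⁾`, and
-- with the inhomogeneities of the τ equations in place of `u` it gives the inhomogeneity of the
-- whole.
rhsSeries : Family → Series
rhsSeries u =
    (cst (wP *P fP (● ∷ [])) ⊗ τ' (○ ∷ ○ ∷ []) (● ∷ []) ⊕ τ' (○ ∷ ○ ∷ []) [])
      ⊗ xS ⊗ expX (fP (○ ∷ []))
  ⊕ (cst (wP ^P 2) ⊗ τ' (● ∷ ● ∷ []) (● ∷ [])
      ⊕ cst ((wP ^P 3) *P fP (● ∷ [])) ⊗ τ' (● ∷ ● ∷ []) (● ∷ ● ∷ []))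
      ⊗ (expX (fP (○ ∷ [])) ⊖ 1S)
  ⊕ (cst (wP *P fP (● ∷ ● ∷ ○ ∷ [])) ⊗ τ' [] []
      ⊕ cst (wP *P fP (● ∷ [])) ⊗ τ' (● ∷ ○ ∷ []) []
      ⊕ cst (fP (● ∷ ○ ∷ [])) ⊗ τ' (○ ∷ []) [])
      ⊗ phiY 1 ⊗ xS ⊗ expX (fP (○ ∷ []))
  ⊕ (cst (wP *P fP (● ∷ ● ∷ [])) ⊗ τ' [] []
      ⊕ cst (wP *P fP (● ∷ [])) ⊗ τ' (● ∷ []) [])
      ⊗ cst (fP (● ∷ ○ ∷ [])) ⊗ phiY 2 ⊗ xS ⊗ expX (fP (○ ∷ []))
  ⊕ cst (wP *P fP (● ∷ [])) ⊗ τ' [] [] ⊗ psiSeries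
  where
  τ' : Word → Word → Series
  τ' R S = vSeries (u R S)

-- The coefficient at exponent `suc a` of `x`; exponent 0 is treated by `rhs-0`.
rhsCoeff : Family → (a b c : ℕ) → Poly
rhsCoeff u a b c =
     scaleP (+ suc a) (atZero b (v₁ u c) *P f○ ^P a)
  +P atZero b (v₂ u c) *P expX-1 f○ (suc a)
  +P scaleP (+ suc a) ((v₃ u c *P phiY 1 0 b 0) *P f○ ^P a)
  +P scaleP (+ suc a) ((v₄ u c *P phiY 2 0 b 0) *P f○ ^P a)
  +P atZero b (v₅ u c) *P psiSeries (suc a) 0 0

sum₅ : ∀ {p₁ p₂ p₃ p₄ p₅ q₁ q₂ q₃ q₄ q₅} → p₁ ≋ q₁ → p₂ ≋ q₂ → p₃ ≋ q₃ → p₄ ≋ q₄ → p₅ ≋ q₅ →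
       (p₁ +P p₂ +P p₃ +P p₄ +P p₅) ≋ (q₁ +P q₂ +P q₃ +P q₄ +P q₅)
sum₅ {p₁} {p₂} {p₃} {p₄} {p₅} {q₁} {q₂} {q₃} {q₄} {q₅} e₁ e₂ e₃ e₄ e₅ =
  +P-cong {p₁ +P p₂ +P p₃ +P p₄} {q₁ +P q₂ +P q₃ +P q₄} (+P-cong {p₁ +P p₂ +P p₃} {q₁ +P q₂ +P q₃}
    (+P-cong {p₁ +P p₂} {q₁ +P q₂} (+P-cong {p₁} {q₁} e₁ e₂) e₃) e₄) e₅

≋S-refl : ∀ s → s ≋S s
≋S-refl s a b c = ≋-refl

module _ (u : Family) where

  private
    τ' : Word → Word → Series
    τ' R S = vSeries (u R S)

    scaled : ∀ p R S → (cst p ⊗ τ' R S) ≋S vSeries (λ c → p *P u R S c)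
    scaled p R S = cst⊗v p (u R S)

    E : Series
    E = expX f○

    yv-part : ∀ {s} v → s ≋S vSeries v → s ≋S yvSeries (λ b c → atZero b (v c))
    yv-part v e = ≋S-trans e (v≋yv v)

    xE : ∀ {s} G → s ≋S yvSeries G → (s ⊗ xS ⊗ E) ≋S (xyvSeries G ⊗ xSeries (f○ ^P_))
    xE {s} G e = ⊗-cong (≋S-trans (⊗-cong e (≋S-refl xS)) (yv⊗xS G)) (≋S-refl E)

    times-φ : ∀ {s} v i → s ≋S vSeries v → (s ⊗ phiY i) ≋S yvSeries (λ b c → v c *P phiY i 0 b 0)
    times-φ v i e = ≋S-trans (⊗-cong e (≋S-refl (phiY i))) (v⊗y v i)

    sum₂ : ∀ {s t} v v' → s ≋S vSeries v → t ≋S vSeries v' → (s ⊕ t) ≋S vSeries (λ c → v c +P v' c)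
    sum₂ v v' e e' = ≋S-trans (⊕-cong e e') (v⊕v v v')

    S₁ = cst (wP *P f●) ⊗ τ' (○ ∷ ○ ∷ []) (● ∷ []) ⊕ τ' (○ ∷ ○ ∷ []) []
    S₂ = cst (wP ^P 2) ⊗ τ' (● ∷ ● ∷ []) (● ∷ []) ⊕ cst ((wP ^P 3) *P f●) ⊗ τ' (● ∷ ● ∷ []) (● ∷ ● ∷ [])
    S₃ = cst (wP *P fP (● ∷ ● ∷ ○ ∷ [])) ⊗ τ' [] [] ⊕ cst (wP *P f●) ⊗ τ' (● ∷ ○ ∷ []) [] ⊕ cst (fP (● ∷ ○ ∷ []))
      ⊗ τ' (○ ∷ []) []
    S₄ = (cst (wP *P fP (● ∷ ● ∷ [])) ⊗ τ' [] [] ⊕ cst (wP *P f●) ⊗ τ' (● ∷ []) []) ⊗ cst (fP (● ∷ ○ ∷ []))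
    S₅ = cst (wP *P f●) ⊗ τ' [] []

    G₁ G₂ G₃ G₄ G₅ : ℕ → ℕ → Poly
    G₁ b c = atZero b (v₁ u c)
    G₂ b c = atZero b (v₂ u c)
    G₃ b c = v₃ u c *P phiY 1 0 b 0
    G₄ b c = v₄ u c *P phiY 2 0 b 0
    G₅ b c = atZero b (v₅ u c)

    e₁ : (S₁ ⊗ xS ⊗ E) ≋S (xyvSeries G₁ ⊗ xSeries (f○ ^P_))
    e₁ = xE G₁ (yv-part (v₁ u) (sum₂ _ (u (○ ∷ ○ ∷ []) []) (scaled (wP *P f●) (○ ∷ ○ ∷ []) (● ∷ []))
      (≋S-refl (τ' (○ ∷ ○ ∷ []) []))))

    e₂ : (S₂ ⊗ (E ⊖ 1S)) ≋S (yvSeries G₂ ⊗ xSeries (expX-1 f○))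
    e₂ = ⊗-cong (yv-part (v₂ u) (sum₂ _ _ (scaled (wP ^P 2) (● ∷ ● ∷ []) (● ∷ []))
      (scaled ((wP ^P 3) *P f●) (● ∷ ● ∷ []) (● ∷ ● ∷ [])))) (expX⊖1≋ f○)

    e₃ : (S₃ ⊗ phiY 1 ⊗ xS ⊗ E) ≋S (xyvSeries G₃ ⊗ xSeries (f○ ^P_))
    e₃ = xE G₃ (times-φ (v₃ u) 1 (sum₂ _ _ (sum₂ _ _ (scaled (wP *P fP (● ∷ ● ∷ ○ ∷ [])) [] [])
      (scaled (wP *P f●) (● ∷ ○ ∷ []) [])) (scaled (fP (● ∷ ○ ∷ [])) (○ ∷ []) [])))

    e₄ : (S₄ ⊗ phiY 2 ⊗ xS ⊗ E) ≋S (xyvSeries G₄ ⊗ xSeries (f○ ^P_))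
    e₄ = xE G₄ (times-φ (v₄ u) 2 (≋S-trans (⊗-cong (sum₂ _ _ (scaled (wP *P fP (● ∷ ● ∷ [])) [] [])
      (scaled (wP *P f●) (● ∷ []) [])) (≋S-refl (cst (fP (● ∷ ○ ∷ [])))))
           (v⊗cst _ (fP (● ∷ ○ ∷ [])))))

    e₅ : (S₅ ⊗ psiSeries) ≋S (yvSeries G₅ ⊗ xSeries (λ n → psiSeries n 0 0))
    e₅ = ⊗-cong (yv-part (v₅ u) (scaled (wP *P f●) [] [])) (≋S-refl psiSeries)

  rhs-suc : ∀ a b c → rhsSeries u (suc a) b c ≋ rhsCoeff u a b c
  rhs-suc a b c = ≋-sum₅
    (≋-trans (e₁ (suc a) b c) (xyv⊗x G₁ (f○ ^P_) a b c))
    (≋-trans (e₂ (suc a) b c) (yv⊗x G₂ (expX-1 f○) (suc a) b c))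
    (≋-trans (e₃ (suc a) b c) (xyv⊗x G₃ (f○ ^P_) a b c))
    (≋-trans (e₄ (suc a) b c) (xyv⊗x G₄ (f○ ^P_) a b c))
    (≋-trans (e₅ (suc a) b c) (yv⊗x G₅ (λ n → psiSeries n 0 0) (suc a) b c))
    where
    ≋-sum₅ : (S₁ ⊗ xS ⊗ E) (suc a) b c ≋ scaleP (+ suc a) (G₁ b c *P f○ ^P a) →
             (S₂ ⊗ (E ⊖ 1S)) (suc a) b c ≋ (G₂ b c *P expX-1 f○ (suc a)) →
             (S₃ ⊗ phiY 1 ⊗ xS ⊗ E) (suc a) b c ≋ scaleP (+ suc a) (G₃ b c *P f○ ^P a) →
             (S₄ ⊗ phiY 2 ⊗ xS ⊗ E) (suc a) b c ≋ scaleP (+ suc a) (G₄ b c *P f○ ^P a) →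
             (S₅ ⊗ psiSeries) (suc a) b c ≋ (G₅ b c *P psiSeries (suc a) 0 0) →
             rhsSeries u (suc a) b c ≋ rhsCoeff u a b c
    ≋-sum₅ p₁ p₂ p₃ p₄ p₅ = sum₅ p₁ p₂ p₃ p₄ p₅

  -- Every summand contains `x`, an exponential less its constant term, or a ψ-sum starting at the
  -- third power of `x`.
  rhs-0 : ∀ b c → rhsSeries u 0 b c ≋ 0P
  rhs-0 b c = sum₅ {q₁ = 0P} {q₂ = 0P} {q₃ = 0P} {q₄ = 0P} {q₅ = 0P}
    (≋-trans (e₁ 0 b c) (xyv⊗x-0 G₁ (f○ ^P_) b c))
    (≋-trans (e₂ 0 b c) (≋-trans (yv⊗x G₂ (expX-1 f○) 0 b c)
      (≋-trans (*P-cong (≋-refl {G₂ b c}) (expX-1-0 f○)) (*P-zeroʳ (G₂ b c)))))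
    (≋-trans (e₃ 0 b c) (xyv⊗x-0 G₃ (f○ ^P_) b c))
    (≋-trans (e₄ 0 b c) (xyv⊗x-0 G₄ (f○ ^P_) b c))
    (≋-trans (e₅ 0 b c) (≋-trans (yv⊗x G₅ (λ n → psiSeries n 0 0) 0 b c) (*P-zeroʳ (G₅ b c))))

-- Complete homogeneous polynomials with all arguments equal

^-+ : ∀ p m n → (p ^P m *P p ^P n) ≋ (p ^P (m + n))
^-+ p zero n = *P-identityˡ (p ^P n)
^-+ p (suc m) n = ≋-trans (*P-assoc p (p ^P m) (p ^P n)) (*P-cong (≋-refl {p}) (^-+ p m n))

∑-const : (xs : List A) (k : ℤ) → ∑ xs (λ _ → k) ≡ + length xs ℤ.* k
∑-const [] k = sym (ℤₚ.*-zeroˡ k)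
∑-const (x ∷ xs) k = trans (cong (ℤ._+_ k) (∑-const xs k)) (sym (ℤₚ.suc-* (+ length xs) k))

h-one : ∀ x n → h n (x ∷ []) ≋ (x ^P n)
h-one x zero = ≋-refl
h-one x (suc j) = ≋-trans
  (sumTo-only (suc j) {F = λ k → (x ^P k) *P h (suc j ∸ k) []} ℕₚ.≤-refl
    (λ k le ne → ≋-trans (*P-cong (≋-refl {x ^P k}) (≋-reflexive (empty (ℕₚ.m<n⇒0<n∸m (ℕₚ.≤∧≢⇒< le ne)))))
      (*P-zeroʳ (x ^P k))))
  (≋-trans (*P-cong (≋-refl {x ^P suc j}) (≋-reflexive (cong (λ d → h d []) (ℕₚ.n∸n≡0 j)))) (*P-identityʳ (x ^P suc j)))
  where
  empty : ∀ {d} → 0 < d → h d [] ≡ 0P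
  empty {suc d} _ = refl

h-two : ∀ x n → h n (x ∷ x ∷ []) ≋ scaleP (+ suc n) (x ^P n)
h-two x zero = ≋-sym (scaleP-1 1P)
h-two x (suc j) = ≋-trans
  (sumTo-cong (suc j) {F = λ k → (x ^P k) *P h (suc j ∸ k) (x ∷ [])} {G = λ _ → x ^P suc j}
    (λ k le → ≋-trans (*P-cong (≋-refl {x ^P k}) (h-one x (suc j ∸ k)))
      (≋-trans (^-+ x k (suc j ∸ k)) (≋-reflexive (cong (x ^P_) (ℕₚ.m+[n∸m]≡n le))))))
  (functionally (λ L r → trans (⟦sumTo⟧ (suc j) (λ _ → x ^P suc j))
    (trans (∑-const (upTo (suc (suc j))) (⟦ x ^P suc j ⟧ L))
    (trans (cong (λ n → + n ℤ.* ⟦ x ^P suc j ⟧ L) (Listₚ.length-upTo (suc (suc j))))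
      (sym (⟦scale⟧ (+ suc (suc j)) (x ^P suc j)))))))

-- The recursion for the right-hand side

Constant-≋ : ∀ {p q} → p ≋ q → Constant p → Constant q
Constant-≋ {p} {q} e cp t = ≋-trans (C''-cong (*P-cong (≋-sym e) (≋-refl {t})))
  (≋-trans (cp t) (*P-cong e (≋-refl {C'' t})))

Constant-if : ∀ t {p} → Constant p → Constant (if t then p else 0P)
Constant-if true cp = cp
Constant-if false cp = Constant-0

Constant-phi₁ : ∀ b → Constant (phiY 1 0 b 0)
Constant-phi₁ zero = Constant-0
Constant-phi₁ (suc b) = Constant-≋ (≋-sym (h-one f● b)) (Constant-^ {f●} (Constant-f (● ∷ [])) b)

Constant-phi₂ : ∀ b → Constant (phiY 2 0 b 0)
Constant-phi₂ zero = Constant-0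
Constant-phi₂ (suc zero) = Constant-0
Constant-phi₂ (suc (suc b)) = Constant-≋ (≋-sym (h-two f● b))
  (Constant-scale {f● ^P b} (+ suc b) (Constant-^ {f●} (Constant-f (● ∷ [])) b))

Constant-psi : ∀ n → Constant (psiSeries n 0 0)
Constant-psi n = Constant-+ {threeTerm} {twoTwoTerm}
  (Constant-if (3 ≤ᵇ n) (Constant-scale {fP (○ ∷ ○ ∷ ○ ∷ []) *P (f○ ^P (n ∸ 3))} (+ psi (3 ∷ replicate (n ∸ 3) 1))
    (Constant-* {fP (○ ∷ ○ ∷ ○ ∷ [])} {f○ ^P (n ∸ 3)} (Constant-f (○ ∷ ○ ∷ ○ ∷ []))
      (Constant-^ {f○} (Constant-f (○ ∷ [])) (n ∸ 3)))))
  (Constant-if (4 ≤ᵇ n) (Constant-scale {(fP (○ ∷ ○ ∷ []) ^P 2) *P (f○ ^P (n ∸ 4))}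
    (+ psi (2 ∷ 2 ∷ replicate (n ∸ 4) 1))
    (Constant-* {fP (○ ∷ ○ ∷ []) ^P 2} {f○ ^P (n ∸ 4)} (Constant-^ {fP (○ ∷ ○ ∷ [])} (Constant-f (○ ∷ ○ ∷ [])) 2)
      (Constant-^ {f○} (Constant-f (○ ∷ [])) (n ∸ 4)))))
  where
  threeTerm twoTwoTerm : Poly
  threeTerm = if 3 ≤ᵇ n then scaleP (+ psi (3 ∷ replicate (n ∸ 3) 1)) (fP (○ ∷ ○ ∷ ○ ∷ []) *P (f○ ^P (n ∸ 3))) else 0P
  twoTwoTerm = if 4 ≤ᵇ n then scaleP (+ psi (2 ∷ 2 ∷ replicate (n ∸ 4) 1))
    ((fP (○ ∷ ○ ∷ []) ^P 2) *P (f○ ^P (n ∸ 4))) else 0P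

source : Family
source R S c = varP (g (● ∷ R)) *P phiCoeff (map xOf S) c

Solves-0 : Solves (λ _ → 0P) (λ _ → 0P)
Solves-0 = solves ≋-refl (λ _ → ≋-refl)

Solves-atZero : ∀ b {u j} → Solves u j → Solves (λ c → atZero b (u c)) (λ c → atZero b (j c))
Solves-atZero zero s = s
Solves-atZero (suc b) s = Solves-0

Solves-rhs : ∀ a b → Solves (rhsCoeff tauCoeff a b) (rhsCoeff source a b)
Solves-rhs a b = Solves-+ (Solves-+ (Solves-+ (Solves-+
    (Solves-scale (+ suc a) (Solves-*ʳ (f○ ^P a) cf (Solves-atZero b {v₁ tauCoeff} {v₁ source} s₁)))
    (Solves-*ʳ (expX-1 f○ (suc a)) (Constant-+ {f○ ^P suc a} {0P} (Constant-^ {f○} (Constant-f (○ ∷ [])) (suc a))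
      Constant-0) (Solves-atZero b {v₂ tauCoeff} {v₂ source} s₂)))
    (Solves-scale (+ suc a) (Solves-*ʳ (f○ ^P a) cf (Solves-*ʳ (phiY 1 0 b 0) (Constant-phi₁ b) s₃))))
    (Solves-scale (+ suc a) (Solves-*ʳ (f○ ^P a) cf (Solves-*ʳ (phiY 2 0 b 0) (Constant-phi₂ b) s₄))))
    (Solves-*ʳ (psiSeries (suc a) 0 0) (Constant-psi (suc a)) (Solves-atZero b {v₅ tauCoeff} {v₅ source} s₅))
  where
  cf : Constant (f○ ^P a)
  cf = Constant-^ {f○} (Constant-f (○ ∷ [])) a
  wf : ∀ S → Constant (wP *P fP S)
  wf S = Constant-* {wP} {fP S} Constant-w (Constant-f S)
  times : ∀ p → Constant p → ∀ R S → Solves (λ c → p *P tauCoeff R S c) (λ c → p *P source R S c)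
  times p cp R S = Solves-*ˡ p cp (Solves-τ R S)
  s₁ : Solves (v₁ tauCoeff) (v₁ source)
  s₁ = Solves-+ (times (wP *P f●) (wf (● ∷ [])) (○ ∷ ○ ∷ []) (● ∷ [])) (Solves-τ (○ ∷ ○ ∷ []) [])
  s₂ : Solves (v₂ tauCoeff) (v₂ source)
  s₂ = Solves-+ (times (wP ^P 2) (Constant-^ {wP} Constant-w 2) (● ∷ ● ∷ []) (● ∷ []))
    (times ((wP ^P 3) *P f●) (Constant-* {wP ^P 3} {f●} (Constant-^ {wP} Constant-w 3) (Constant-f (● ∷ [])))
      (● ∷ ● ∷ []) (● ∷ ● ∷ []))
  s₃ : Solves (v₃ tauCoeff) (v₃ source)
  s₃ = Solves-+ (Solves-+ (times (wP *P fP (● ∷ ● ∷ ○ ∷ [])) (wf (● ∷ ● ∷ ○ ∷ [])) [] [])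
    (times (wP *P f●) (wf (● ∷ [])) (● ∷ ○ ∷ []) []))
    (times (fP (● ∷ ○ ∷ [])) (Constant-f (● ∷ ○ ∷ [])) (○ ∷ []) [])
  s₄ : Solves (v₄ tauCoeff) (v₄ source)
  s₄ = Solves-*ʳ (fP (● ∷ ○ ∷ [])) (Constant-f (● ∷ ○ ∷ []))
    (Solves-+ (times (wP *P fP (● ∷ ● ∷ [])) (wf (● ∷ ● ∷ [])) [] []) (times (wP *P f●) (wf (● ∷ [])) (● ∷ []) []))
  s₅ : Solves (v₅ tauCoeff) (v₅ source)
  s₅ = times (wP *P f●) (wf (● ∷ [])) [] []

-- Values of the source terms

vb vo : Var
vb = f (● ∷ [])
vo = f (○ ∷ [])

⟦xOf●^⟧ : ∀ k {L} → Respects L → ⟦ xOf ● ^P k ⟧ L ≡ L (replicate k w ++ replicate k vb)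
⟦xOf●^⟧ zero {L} r = ⟦mono⟧ [] {L}
⟦xOf●^⟧ (suc k) {L} r = trans (⟦mono*⟧ (w ∷ vb ∷ []) (xOf ● ^P k) {L})
  (trans (⟦xOf●^⟧ k (Respects-prefix r (w ∷ vb ∷ [])))
  (perm r (prep w (↭-sym (↭ₚ.shift vb (replicate k w) (replicate k vb))))))

⟦source⟧ : ∀ m R S c {L} → ⟦ mono m *P source R S c ⟧ L ≡ ⟦ phiCoeff (map xOf S) c ⟧ (λ M → L (m ++ (g (● ∷ R) ∷ M)))
⟦source⟧ m R S c {L} = trans (⟦mono*⟧ m (source R S c) {L})
  (⟦mono*⟧ (g (● ∷ R) ∷ []) (phiCoeff (map xOf S) c) {λ m' → L (m ++ m')})

⟦source₀⟧ : ∀ R S c {L} → ⟦ source R S c ⟧ L ≡ ⟦ phiCoeff (map xOf S) c ⟧ (λ M → L (g (● ∷ R) ∷ M))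
⟦source₀⟧ R S c {L} = ⟦mono*⟧ (g (● ∷ R) ∷ []) (phiCoeff (map xOf S) c) {L}

-- With X = w f_(●), the source is g_●○○ (1 + X φ_●(v)) = g_●○○ exp(Xv): the ε-term supplies `c = 0`
-- and the ●-term all positive `c`.
⟦v₁⟧ : ∀ c {L} → Respects L → ⟦ v₁ source c ⟧ L ≡ L (replicate c w ++ (g (● ∷ ○ ∷ ○ ∷ []) ∷ replicate c vb))
⟦v₁⟧ zero {L} r = trans (⟦+⟧ (mono (w ∷ vb ∷ []) *P source (○ ∷ ○ ∷ []) (● ∷ []) 0) (source (○ ∷ ○ ∷ []) [] 0) {L})
  (trans (cong₂ ℤ._+_ (⟦source⟧ (w ∷ vb ∷ []) (○ ∷ ○ ∷ []) (● ∷ []) 0 {L})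
    (trans (⟦source₀⟧ (○ ∷ ○ ∷ []) [] 0 {L}) (⟦mono⟧ [] {λ M → L (g (● ∷ ○ ∷ ○ ∷ []) ∷ M)}))) (ℤₚ.+-identityˡ _))
⟦v₁⟧ (suc c) {L} r = trans (⟦+⟧ (mono (w ∷ vb ∷ []) *P source (○ ∷ ○ ∷ []) (● ∷ []) (suc c))
  (source (○ ∷ ○ ∷ []) [] (suc c)) {L})
  (trans (cong₂ ℤ._+_
    (trans (⟦source⟧ (w ∷ vb ∷ []) (○ ∷ ○ ∷ []) (● ∷ []) (suc c) {L})
      (trans (eval (h-one (xOf ●) c) _ r') (⟦xOf●^⟧ c r')))
    (⟦source₀⟧ (○ ∷ ○ ∷ []) [] (suc c) {L}))
  (trans (ℤₚ.+-identityʳ _) (perm r (prep w (↭-trans (swap vb G ↭-refl)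
    (↭-trans (prep G (↭-sym (↭ₚ.shift vb (replicate c w) (replicate c vb))))
    (↭-sym (↭ₚ.shift G (replicate c w) (vb ∷ replicate c vb)))))))))
  where
  G : Var
  G = g (● ∷ ○ ∷ ○ ∷ [])
  r' : Respects (λ M → L (w ∷ vb ∷ G ∷ M))
  r' = Respects-prefix r (w ∷ vb ∷ G ∷ [])

-- With X = w f_(●), φ_● + X φ_●● = v exp(Xv): to the single monomial from φ_● are added the c-1
-- equal ones from φ_●●, which yields the factor `c`.
⟦v₂⟧ : ∀ c {L} → Respects L → ⟦ v₂ source c ⟧ L ≡ + c ℤ.* L
  (replicate (suc c) w ++ (g (● ∷ ● ∷ ● ∷ []) ∷ replicate (c ∸ 1) vb))
⟦v₂⟧ c {L} r = trans (⟦+⟧ (mono (w ∷ w ∷ []) *P source (● ∷ ● ∷ []) (● ∷ []) c)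
  (mono (w ∷ w ∷ w ∷ vb ∷ []) *P source (● ∷ ● ∷ []) (● ∷ ● ∷ []) c) {L})
  (trans (cong₂ ℤ._+_ (⟦source⟧ (w ∷ w ∷ []) (● ∷ ● ∷ []) (● ∷ []) c {L})
    (⟦source⟧ (w ∷ w ∷ w ∷ vb ∷ []) (● ∷ ● ∷ []) (● ∷ ● ∷ []) c {L})) (go c))
  where
  G : Var
  G = g (● ∷ ● ∷ ● ∷ [])
  r₂ : Respects (λ M → L (w ∷ w ∷ G ∷ M))
  r₂ = Respects-prefix r (w ∷ w ∷ G ∷ [])
  r₃ : Respects (λ M → L (w ∷ w ∷ w ∷ vb ∷ G ∷ M))
  r₃ = Respects-prefix r (w ∷ w ∷ w ∷ vb ∷ G ∷ [])
  go : ∀ c → ⟦ phiCoeff (xOf ● ∷ []) c ⟧ (λ M → L (w ∷ w ∷ G ∷ M)) ℤ.+ ⟦ phiCoeff (xOf ● ∷ xOf ● ∷ []) c ⟧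
    (λ M → L (w ∷ w ∷ w ∷ vb ∷ G ∷ M)) ≡
             + c ℤ.* L (replicate (suc c) w ++ (G ∷ replicate (c ∸ 1) vb))
  go zero = sym (ℤₚ.*-zeroˡ (L (w ∷ G ∷ [])))
  go (suc zero) = trans (ℤₚ.+-identityʳ _) (trans (⟦mono⟧ [] {λ M → L (w ∷ w ∷ G ∷ M)}) (sym (ℤₚ.*-identityˡ _)))
  go (suc (suc k)) = trans (cong₂ ℤ._+_
      (trans (eval (h-one (xOf ●) (suc k)) _ r₂) (trans (⟦xOf●^⟧ (suc k) r₂)
        (perm r (prep w (prep w (↭-sym (↭ₚ.shift G (replicate (suc k) w) (replicate (suc k) vb))))))))
      (trans (eval (h-two (xOf ●) k) _ r₃) (trans (⟦scale⟧ (+ suc k) (xOf ● ^P k)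
        {λ M → L (w ∷ w ∷ w ∷ vb ∷ G ∷ M)}) (cong (λ z → + suc k ℤ.* z)
        (trans (⟦xOf●^⟧ k r₃) (perm r (prep w (prep w (prep w
          (↭-trans (swap vb G ↭-refl) (↭-trans (prep G (↭-sym (↭ₚ.shift vb (replicate k w) (replicate k vb))))
          (↭-sym (↭ₚ.shift G (replicate k w) (replicate (suc k) vb))))))))))))))
      (sym (ℤₚ.suc-* (+ suc k) (L (replicate (3 + k) w ++ (G ∷ replicate (suc k) vb)))))

⟦*f○^⟧ : ∀ p a {L} → ⟦ p *P f○ ^P a ⟧ L ≡ ⟦ p ⟧ (λ m → L (m ++ replicate a vo))
⟦*f○^⟧ p a {L} = trans (⟦*⟧ p (f○ ^P a)) (⟦⟧-cong p (λ m → rep-mono vo a {λ m' → L (m ++ m')}))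

-- `C''` takes g_● to w g_● f_(●), while the ψ-terms consist of `f` letters and pass through it.
∂-psi : ∀ {L} → Respects L → ∀ n → ⟦ psiSeries n 0 0 ⟧ (λ M → ∂ L (g (● ∷ []) ∷ M)) ≡ ⟦ psiSeries n 0 0 ⟧
  (λ M → L (w ∷ vb ∷ g (● ∷ []) ∷ M))
∂-psi {L} r n = begin
    ⟦ Ψ ⟧ (λ M → ∂ L (G ∷ M))
  ≡⟨ ⟦⟧-cong Ψ (λ M → perm (∂-Respects r) (↭ₚ.++-comm (G ∷ []) M)) ⟩
    ⟦ Ψ ⟧ (λ M → ∂ L (M ++ G ∷ []))
  ≡⟨ ⟦⟧-cong Ψ (λ M → sym (⟦mono⟧ (G ∷ []) {λ m' → ∂ L (M ++ m')})) ⟩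
    ⟦ Ψ ⟧ (λ M → ⟦ varP G ⟧ (λ m' → ∂ L (M ++ m')))
  ≡⟨ sym (⟦*⟧ Ψ (varP G)) ⟩
    ⟦ Ψ *P varP G ⟧ (∂ L)
  ≡⟨ sym (⟦C''⟧ (Ψ *P varP G)) ⟩
    ⟦ C'' (Ψ *P varP G) ⟧ L
  ≡⟨ eval (Constant-psi n (varP G)) L r ⟩
    ⟦ Ψ *P mono (w ∷ G ∷ vb ∷ []) ⟧ L
  ≡⟨ ⟦*⟧ Ψ (mono (w ∷ G ∷ vb ∷ [])) ⟩
    ⟦ Ψ ⟧ (λ M → ⟦ mono (w ∷ G ∷ vb ∷ []) ⟧ (λ m' → L (M ++ m')))
  ≡⟨ ⟦⟧-cong Ψ (λ M → trans (⟦mono⟧ (w ∷ G ∷ vb ∷ []) {λ m' → L (M ++ m')})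
       (perm r (↭-trans (↭ₚ.++-comm M (w ∷ G ∷ vb ∷ [])) (prep w (swap G vb ↭-refl))))) ⟩
    ⟦ Ψ ⟧ (λ M → L (w ∷ vb ∷ G ∷ M)) ∎
  where
  open ≡-Reasoning
  Ψ : Poly
  Ψ = psiSeries n 0 0
  G : Var
  G = g (● ∷ [])

bicolour-words : ∀ b a → bicolour b a ≡ map f (replicate b (● ∷ []) ++ replicate a (○ ∷ []))
bicolour-words b a = sym (trans (Listₚ.map-++ f (replicate b (● ∷ [])) (replicate a (○ ∷ [])))
  (cong₂ _++_ (Listₚ.map-replicate f b (● ∷ [])) (Listₚ.map-replicate f a (○ ∷ []))))

∂-g : ∀ {L} R b a → ∂ L (g R ∷ bicolour b a) ≡ ⟦ C''g R ⟧ (λ t → L (t ++ bicolour b a))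
∂-g {L} R b a rewrite bicolour-words b a = ∂-weight {L} 0 R (replicate b (● ∷ []) ++ replicate a (○ ∷ []))

-- The terms are the cuts of ●●○ at its second, third and root corner.
∂-three : ∀ {L} → Respects L → ∀ a b → ∂ L (threeWeight a b) ≡
  L (w ∷ vb ∷ g (● ∷ ● ∷ ○ ∷ []) ∷ bicolour b a) ℤ.+ (L (f (● ∷ ○ ∷ []) ∷ g (● ∷ ○ ∷ []) ∷ bicolour b a) ℤ.+ L
    (w ∷ f (● ∷ ● ∷ ○ ∷ []) ∷ g (● ∷ []) ∷ bicolour b a))
∂-three {L} r a b = trans (∂-g {L} (● ∷ ● ∷ ○ ∷ []) b a)
  (cong₂ ℤ._+_ (trans (ℤₚ.*-identityˡ _) (perm r (prep w (swap _ _ ↭-refl))))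
  (cong₂ ℤ._+_ (trans (ℤₚ.*-identityˡ _) (perm r (swap _ _ ↭-refl)))
  (trans (ℤₚ.+-identityʳ _) (trans (ℤₚ.*-identityˡ _) (perm r (prep w (swap _ _ ↭-refl)))))))

∂-two : ∀ {L} → Respects L → ∀ a b → ∂ L (twoWeight a b) ≡
  L (w ∷ vb ∷ g (● ∷ ● ∷ []) ∷ f (● ∷ ○ ∷ []) ∷ bicolour (b ∸ 1) a) ℤ.+ L
    (w ∷ f (● ∷ ● ∷ []) ∷ g (● ∷ []) ∷ f (● ∷ ○ ∷ []) ∷ bicolour (b ∸ 1) a)
∂-two {L} r a b = trans (perm (∂-Respects r) (swap G X ↭-refl)) (trans (ℤₚ.+-identityˡ _)
  (trans (∂-g {λ m → L (X ∷ m)} (● ∷ ● ∷ []) (b ∸ 1) a)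
  (cong₂ ℤ._+_ (trans (ℤₚ.*-identityˡ _) (perm r (toFront w G vb M)))
  (trans (ℤₚ.+-identityʳ _) (trans (ℤₚ.*-identityˡ _) (perm r (toFront w (g (● ∷ [])) (f (● ∷ ● ∷ [])) M)))))))
  where
  G X : Var
  G = g (● ∷ ● ∷ [])
  X = f (● ∷ ○ ∷ [])
  M : Monomial
  M = bicolour (b ∸ 1) a
  toFront : ∀ x y z M → X ∷ x ∷ y ∷ z ∷ M ↭ x ∷ z ∷ y ∷ X ∷ M
  toFront x y z M = ↭-trans (↭-sym (↭ₚ.shift X (x ∷ y ∷ z ∷ []) M)) (prep x (swap y z ↭-refl))

⟦psi-source⟧ : ∀ a c {L} → Respects L →
  ⟦ v₅ source c *P psiSeries (suc a) 0 0 ⟧ L ≡ (if isZero c then ⟦ psiSeries (suc a) 0 0 ⟧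
    (λ M → L (w ∷ vb ∷ g (● ∷ []) ∷ M)) else + 0)
⟦psi-source⟧ a zero {L} r = trans (⟦*⟧ (v₅ source 0) Ψ {L})
  (trans (⟦source⟧ (w ∷ vb ∷ []) [] [] 0 {λ m → ⟦ Ψ ⟧ (λ M → L (m ++ M))})
  (⟦mono⟧ [] {λ m → ⟦ Ψ ⟧ (λ M → L (w ∷ vb ∷ g (● ∷ []) ∷ m ++ M))}))
  where
  Ψ : Poly
  Ψ = psiSeries (suc a) 0 0
⟦psi-source⟧ a (suc c) {L} r = trans (⟦*⟧ (v₅ source (suc c)) Ψ {L})
  (⟦source⟧ (w ∷ vb ∷ []) [] [] (suc c) {λ m → ⟦ Ψ ⟧ (λ M → L (m ++ M))})
  where
  Ψ : Poly
  Ψ = psiSeries (suc a) 0 0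

⟦+⟧₅ : ∀ p₁ p₂ p₃ p₄ p₅ {L} → ⟦ p₁ +P p₂ +P p₃ +P p₄ +P p₅ ⟧ L ≡ ⟦ p₁ ⟧ L ℤ.+ ⟦ p₂ ⟧ L ℤ.+ ⟦ p₃ ⟧ L ℤ.+ ⟦ p₄ ⟧ L
  ℤ.+ ⟦ p₅ ⟧ L
⟦+⟧₅ p₁ p₂ p₃ p₄ p₅ {L} = trans (⟦+⟧ (p₁ +P p₂ +P p₃ +P p₄) p₅) (cong (ℤ._+ ⟦ p₅ ⟧ L)
  (trans (⟦+⟧ (p₁ +P p₂ +P p₃) p₄) (cong (ℤ._+ ⟦ p₄ ⟧ L)
    (trans (⟦+⟧ (p₁ +P p₂) p₃) (cong (ℤ._+ ⟦ p₃ ⟧ L) (⟦+⟧ p₁ p₂))))))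

scaled-0 : ∀ a v → scaleP (+ suc a) ((v *P 0P) *P f○ ^P a) ≋ 0P
scaled-0 a v = scaleP-cong (+ suc a) {(v *P 0P) *P f○ ^P a} {0P}
  (*P-cong {v *P 0P} {0P} (*P-zeroʳ v) (≋-refl {f○ ^P a}))

-- Without `y` the third and fourth summands vanish, as `φ₁` and `φ₂` have no constant term. The
-- first two match the white and the black joins, and the ψ-term enters at `c = 0` only.
⟦rhs-xv⟧ : ∀ a c {L} → Respects L → ⟦ rhsCoeff source a 0 c ⟧ L ≡
  (if isZero c then ⟦ psiSeries (suc a) 0 0 ⟧ (λ M → L (w ∷ vb ∷ g (● ∷ []) ∷ M)) else + 0) ℤ.+ joinTerm (suc a) 0 c L
⟦rhs-xv⟧ a c {L} r = trans (⟦+⟧₅ p₁ p₂ p₃ p₄ p₅ {L}) (trans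
  (cong₂ ℤ._+_ (cong₂ ℤ._+_ (cong₂ ℤ._+_ (cong₂ ℤ._+_ t₁ t₂) (eval (scaled-0 a (v₃ source c)) L r))
    (eval (scaled-0 a (v₄ source c)) L r)) (⟦psi-source⟧ a c r))
  (trans (rearrange (+ suc a ℤ.* Y) (+ c ℤ.* X) _) (cong
    (ℤ._+_ (if isZero c then ⟦ psiSeries (suc a) 0 0 ⟧ (λ M → L (w ∷ vb ∷ g (● ∷ []) ∷ M)) else + 0))
    (sym (joinTerm-xv r a c)))))
  where
  p₁ p₂ p₃ p₄ p₅ : Poly
  p₁ = scaleP (+ suc a) (v₁ source c *P f○ ^P a)
  p₂ = v₂ source c *P expX-1 f○ (suc a)
  p₃ = scaleP (+ suc a) ((v₃ source c *P 0P) *P f○ ^P a)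
  p₄ = scaleP (+ suc a) ((v₄ source c *P 0P) *P f○ ^P a)
  p₅ = v₅ source c *P psiSeries (suc a) 0 0
  X Y : ℤ
  X = L (replicate (suc c) w ++ (g (● ∷ ● ∷ ● ∷ []) ∷ bicolour (c ∸ 1) (suc a)))
  Y = L (replicate c w ++ (g (● ∷ ○ ∷ ○ ∷ []) ∷ bicolour c a))
  t₁ : ⟦ p₁ ⟧ L ≡ + suc a ℤ.* Y
  t₁ = trans (⟦scale⟧ (+ suc a) (v₁ source c *P f○ ^P a)) (cong (+ suc a ℤ.*_) (trans (⟦*f○^⟧ (v₁ source c) a)
    (trans (⟦v₁⟧ c (Respects-suffix r (replicate a vo))) (cong L (Listₚ.++-assoc (replicate c w) _ (replicate a vo))))))
  t₂ : ⟦ p₂ ⟧ L ≡ + c ℤ.* X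
  -- At a positive power of `x` the subtracted 1 has become the empty list.
  t₂ = trans (cong (λ p → ⟦ v₂ source c *P p ⟧ L) (Listₚ.++-identityʳ (f○ ^P suc a)))
    (trans (⟦*f○^⟧ (v₂ source c) (suc a))
    (trans (⟦v₂⟧ c (Respects-suffix r (replicate (suc a) vo)))
      (cong (λ m → + c ℤ.* L m) (Listₚ.++-assoc (replicate (suc c) w) _ (replicate (suc a) vo)))))
  rearrange : ∀ x y z → x ℤ.+ y ℤ.+ + 0 ℤ.+ + 0 ℤ.+ z ≡ z ℤ.+ (y ℤ.+ x)
  rearrange = solve 3 (λ x y z → x :+ y :+ con (+ 0) :+ con (+ 0) :+ z := z :+ (y :+ x)) refl
    where open +-*-Solver

⟦phi₁⟧ : ∀ b {L} → Respects L → ⟦ phiY 1 0 (suc b) 0 ⟧ L ≡ L (replicate b vb)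
⟦phi₁⟧ b {L} r = trans (eval (h-one f● b) L r) (rep-mono vb b)

⟦phi₂⟧ : ∀ b {L} → Respects L → ⟦ phiY 2 0 (suc b) 0 ⟧ L ≡ + b ℤ.* L (replicate (b ∸ 1) vb)
⟦phi₂⟧ zero {L} r = sym (ℤₚ.*-zeroˡ (L []))
⟦phi₂⟧ (suc b) {L} r = trans (eval (h-two f● b) L r) (trans (⟦scale⟧ (+ suc b) (f● ^P b))
  (cong (+ suc b ℤ.*_) (rep-mono vb b)))

source-ε-0 : ∀ m R {L} → ⟦ mono m *P source R [] 0 ⟧ L ≡ L (m ++ (g (● ∷ R) ∷ []))
source-ε-0 m R {L} = trans (⟦source⟧ m R [] 0 {L}) (⟦mono⟧ [] {λ M → L (m ++ (g (● ∷ R) ∷ M))})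

⟦v₃⟧ : ∀ {L} → ⟦ v₃ source 0 ⟧ L ≡
  L (w ∷ f (● ∷ ● ∷ ○ ∷ []) ∷ g (● ∷ []) ∷ []) ℤ.+ L (w ∷ vb ∷ g (● ∷ ● ∷ ○ ∷ []) ∷ []) ℤ.+ L
    (f (● ∷ ○ ∷ []) ∷ g (● ∷ ○ ∷ []) ∷ [])
⟦v₃⟧ {L} = trans (⟦+⟧ (p +P q) s {L}) (cong₂ ℤ._+_ (trans (⟦+⟧ p q {L})
    (cong₂ ℤ._+_ (source-ε-0 (w ∷ f (● ∷ ● ∷ ○ ∷ []) ∷ []) [] {L}) (source-ε-0 (w ∷ vb ∷ []) (● ∷ ○ ∷ []) {L})))
  (source-ε-0 (f (● ∷ ○ ∷ []) ∷ []) (○ ∷ []) {L}))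
  where
  p q s : Poly
  p = mono (w ∷ f (● ∷ ● ∷ ○ ∷ []) ∷ []) *P source [] [] 0
  q = mono (w ∷ vb ∷ []) *P source (● ∷ ○ ∷ []) [] 0
  s = mono (f (● ∷ ○ ∷ []) ∷ []) *P source (○ ∷ []) [] 0

⟦v₄⟧ : ∀ {L} → ⟦ v₄ source 0 ⟧ L ≡
  L (w ∷ f (● ∷ ● ∷ []) ∷ g (● ∷ []) ∷ f (● ∷ ○ ∷ []) ∷ []) ℤ.+ L (w ∷ vb ∷ g (● ∷ ● ∷ []) ∷ f (● ∷ ○ ∷ []) ∷ [])
⟦v₄⟧ {L} = trans (⟦*⟧ (p +P q) (fP (● ∷ ○ ∷ [])) {L}) (trans
  (⟦⟧-cong (p +P q) {λ m → ⟦ fP (● ∷ ○ ∷ []) ⟧ (λ m' → L (m ++ m'))} {L'}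
    (λ m → ⟦mono⟧ (f (● ∷ ○ ∷ []) ∷ []) {λ m' → L (m ++ m')}))
  (trans (⟦+⟧ p q {L'}) (cong₂ ℤ._+_ (source-ε-0 (w ∷ f (● ∷ ● ∷ []) ∷ []) [] {L'})
    (source-ε-0 (w ∷ vb ∷ []) (● ∷ []) {L'}))))
  where
  p q : Poly
  p = mono (w ∷ f (● ∷ ● ∷ []) ∷ []) *P source [] [] 0
  q = mono (w ∷ vb ∷ []) *P source (● ∷ []) [] 0
  L' : Functional
  L' m = L (m ++ f (● ∷ ○ ∷ []) ∷ [])

-- The series φ_ε is the constant 1, so it supplies no positive power of `v`.
source-ε-suc : ∀ p R c → (p *P source R [] (suc c)) ≋ 0P
source-ε-suc p R c = ≋-trans (*P-cong (≋-refl {p}) (*P-zeroʳ (varP (g (● ∷ R))))) (*P-zeroʳ p)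

v₃-suc : ∀ c → v₃ source (suc c) ≋ 0P
v₃-suc c = +P-cong {p +P q} {0P} (+P-cong {p} {0P} (source-ε-suc (wP *P fP (● ∷ ● ∷ ○ ∷ [])) [] c)
  (source-ε-suc (wP *P f●) (● ∷ ○ ∷ []) c)) (source-ε-suc (fP (● ∷ ○ ∷ [])) (○ ∷ []) c)
  where
  p q : Poly
  p = (wP *P fP (● ∷ ● ∷ ○ ∷ [])) *P source [] [] (suc c)
  q = (wP *P f●) *P source (● ∷ ○ ∷ []) [] (suc c)

v₄-suc : ∀ c → v₄ source (suc c) ≋ 0P
v₄-suc c = *P-cong {p +P q} {0P} (+P-cong {p} {0P} (source-ε-suc (wP *P fP (● ∷ ● ∷ [])) [] c)
  (source-ε-suc (wP *P f●) (● ∷ []) c)) (≋-refl {fP (● ∷ ○ ∷ [])})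
  where
  p q : Poly
  p = (wP *P fP (● ∷ ● ∷ [])) *P source [] [] (suc c)
  q = (wP *P f●) *P source (● ∷ []) [] (suc c)

⟦rhs-b-suc⟧ : ∀ a b c {L} → Respects L → ⟦ rhsCoeff source a (suc b) (suc c) ⟧ L ≡ + 0
⟦rhs-b-suc⟧ a b c {L} r = trans (⟦+⟧₅ 0P 0P p₃ p₄ 0P {L}) (cong₂ (λ x y → + 0 ℤ.+ x ℤ.+ y ℤ.+ + 0)
    (eval (vanish (v₃ source (suc c)) (v₃-suc c) (phiY 1 0 (suc b) 0)) L r)
      (eval (vanish (v₄ source (suc c)) (v₄-suc c) (phiY 2 0 (suc b) 0)) L r))
  where
  p₃ p₄ : Poly
  p₃ = scaleP (+ suc a) ((v₃ source (suc c) *P phiY 1 0 (suc b) 0) *P f○ ^P a)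
  p₄ = scaleP (+ suc a) ((v₄ source (suc c) *P phiY 2 0 (suc b) 0) *P f○ ^P a)
  vanish : ∀ v → v ≋ 0P → ∀ φ → scaleP (+ suc a) ((v *P φ) *P f○ ^P a) ≋ 0P
  vanish v e φ = scaleP-cong (+ suc a) {(v *P φ) *P f○ ^P a} {0P}
    (*P-cong {v *P φ} {0P} (*P-cong {v} {0P} e (≋-refl {φ})) (≋-refl {f○ ^P a}))

-- The three τ-terms beside `φ₁` are the three cuts of the root word ●●○, the two beside `φ₂` the
-- two cuts of ●●. At exponent `suc b` of `y`, `φ₁` has the b-th power of f_(●) and `φ₂` has `b`
-- times its predecessor, as in the weights of the shapes.
⟦rhs-b-0⟧ : ∀ a b {L} → Respects L → ⟦ rhsCoeff source a (suc b) 0 ⟧ L ≡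
  + suc a ℤ.* ∂ L (threeWeight a b) ℤ.+ + suc a ℤ.* (+ b ℤ.* ∂ L (twoWeight a b))
⟦rhs-b-0⟧ a b {L} r = trans (⟦+⟧₅ 0P 0P p₃ p₄ 0P {L}) (trans (cong₂ (λ x y → + 0 ℤ.+ x ℤ.+ y ℤ.+ + 0) t₃ t₄)
  (drop-zeros (+ suc a ℤ.* ∂ L (threeWeight a b)) (+ suc a ℤ.* (+ b ℤ.* ∂ L (twoWeight a b)))))
  where
  after : Functional
  after m = L (m ++ replicate a vo)
  p₃ p₄ : Poly
  p₃ = scaleP (+ suc a) ((v₃ source 0 *P phiY 1 0 (suc b) 0) *P f○ ^P a)
  p₄ = scaleP (+ suc a) ((v₄ source 0 *P phiY 2 0 (suc b) 0) *P f○ ^P a)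
  drop-zeros : ∀ x y → + 0 ℤ.+ x ℤ.+ y ℤ.+ + 0 ≡ x ℤ.+ y
  drop-zeros = solve 2 (λ x y → con (+ 0) :+ x :+ y :+ con (+ 0) := x :+ y) refl
    where open +-*-Solver
  t₃ : ⟦ p₃ ⟧ L ≡ + suc a ℤ.* ∂ L (threeWeight a b)
  t₃ = trans (⟦scale⟧ (+ suc a) ((v₃ source 0 *P phiY 1 0 (suc b) 0) *P f○ ^P a) {L}) (cong (+ suc a ℤ.*_)
    (trans (⟦*f○^⟧ (v₃ source 0 *P phiY 1 0 (suc b) 0) a {L}) (trans (⟦*⟧ (v₃ source 0) (phiY 1 0 (suc b) 0) {after})
    (trans (⟦⟧-cong (v₃ source 0) {λ m → ⟦ phiY 1 0 (suc b) 0 ⟧ (λ m' → after (m ++ m'))}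
      {λ m → L (m ++ bicolour b a)} (λ m → trans (⟦phi₁⟧ b
        (Respects-prefix (Respects-suffix r (replicate a vo)) m))
          (cong L (Listₚ.++-assoc m (replicate b vb) (replicate a vo)))))
    (trans (⟦v₃⟧ {λ m → L (m ++ bicolour b a)}) (trans (rearrange
      (L (w ∷ f (● ∷ ● ∷ ○ ∷ []) ∷ g (● ∷ []) ∷ bicolour b a)) (L (w ∷ vb ∷ g (● ∷ ● ∷ ○ ∷ []) ∷ bicolour b a)) _)
        (sym (∂-three r a b))))))))
    where
    rearrange : ∀ x y z → x ℤ.+ y ℤ.+ z ≡ y ℤ.+ (z ℤ.+ x)
    rearrange = solve 3 (λ x y z → x :+ y :+ z := y :+ (z :+ x)) refl
      where open +-*-Solver
  t₄ : ⟦ p₄ ⟧ L ≡ + suc a ℤ.* (+ b ℤ.* ∂ L (twoWeight a b))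
  t₄ = trans (⟦scale⟧ (+ suc a) ((v₄ source 0 *P phiY 2 0 (suc b) 0) *P f○ ^P a) {L}) (cong (+ suc a ℤ.*_)
    (trans (⟦*f○^⟧ (v₄ source 0 *P phiY 2 0 (suc b) 0) a {L}) (trans (⟦*⟧ (v₄ source 0) (phiY 2 0 (suc b) 0) {after})
    (trans (⟦⟧-cong (v₄ source 0) {λ m → ⟦ phiY 2 0 (suc b) 0 ⟧ (λ m' → after (m ++ m'))}
      {λ m → + b ℤ.* L (m ++ bicolour (b ∸ 1) a)} (λ m → trans
        (⟦phi₂⟧ b (Respects-prefix (Respects-suffix r (replicate a vo)) m))
       (cong (λ M → + b ℤ.* L M) (Listₚ.++-assoc m (replicate (b ∸ 1) vb) (replicate a vo)))))
    (trans (⟦⟧-*-functional (v₄ source 0) (+ b) {λ m → L (m ++ bicolour (b ∸ 1) a)})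
      (cong (+ b ℤ.*_) (trans (⟦v₄⟧ {λ m → L (m ++ bicolour (b ∸ 1) a)})
        (trans (ℤₚ.+-comm (L (w ∷ f (● ∷ ● ∷ []) ∷ g (● ∷ []) ∷ f (● ∷ ○ ∷ []) ∷ bicolour (b ∸ 1) a)) _)
          (sym (∂-two r a b))))))))))

-- Comparison of Γ, B and the right-hand side

filter-ext : {P Q : A → Bool} → (∀ x → P x ≡ Q x) → ∀ xs → filter P xs ≡ filter Q xs
filter-ext e xs = filter-cong (All.universal e xs)

Γ-no-x : ∀ k b c → GammaU k 0 b c ≡ []
Γ-no-x k b c = cong (map (λ Ds → + 1 , weight Ds)) (filter-none _ (All.universal (λ _ → refl) (dipolesS (b + c + 1))))

B-no-x : ∀ k b c → BU k 0 b c ≡ []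
B-no-x k b c = cong (map (λ Ds → + 1 , weight Ds)) (filter-none _ (All.universal (λ _ → refl) (dipolesS (b + c + 1))))

B-no-v : ∀ k a b → BU k a b 0 ≡ GammaU k a b 0
B-no-v k a b = cong (map (λ Ds → + 1 , weight Ds)) (filter-ext
  (λ Ds → cong ((suc (αD Ds) ≡ᵇ a) ∧_) (cong ((βD Ds ≡ᵇ b) ∧_)
  (redundant (γD Ds) (δD Ds) (nEdges (proj₁ Ds) ≡ᵇ nFaces (proj₁ Ds) + k)))) (dipolesS (a + b + 0 + 1)))
  where
  redundant : ∀ γ δ t → ((γ + δ) ≡ᵇ 0) ∧ (γ ≡ᵇ 0) ∧ (δ ≡ᵇ 0) ∧ t ≡ ((γ + δ) ≡ᵇ 0) ∧ t
  redundant zero zero t = refl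
  redundant zero (suc δ) t = refl
  redundant (suc γ) δ t = refl

B-v : ∀ k a b c → BU k a b (suc c) ≡ []
B-v k a b c = cong (map (λ Ds → + 1 , weight Ds)) (filter-none _
  (All.universal (λ Ds → trans (cong ((suc (αD Ds) ≡ᵇ a) ∧_)
  (trans (cong ((βD Ds ≡ᵇ b) ∧_) (contradictory (γD Ds) (δD Ds) (nEdges (proj₁ Ds) ≡ᵇ nFaces (proj₁ Ds) + k)))
    (∧-zeroʳ _))) (∧-zeroʳ _)) (dipolesS (a + b + suc c + 1))))
  where
  contradictory : ∀ γ δ t → ((γ + δ) ≡ᵇ suc c) ∧ (γ ≡ᵇ 0) ∧ (δ ≡ᵇ 0) ∧ t ≡ false
  contradictory zero zero t = refl
  contradictory zero (suc δ) t = ∧-zeroʳ _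
  contradictory (suc γ) δ t = ∧-zeroʳ _

-- This is the inhomogeneity satisfied by the difference of `Γ⁽¹⁾` and `B⁽¹⁾`. The four cases arise
-- because `B⁽¹⁾` lives at `c = 0` and the joins at `b = 0`.
source-equation : ∀ a b c {L} → Respects L → ⟦ rhsCoeff source a b c ⟧ L ≡ ⟦ BU 2 (suc a) b c ⟧ (∂ L) ℤ.+ joinTerm
  (suc a) b c L
source-equation a zero zero {L} r = trans (⟦rhs-xv⟧ a 0 r) (cong (ℤ._+ joinTerm (suc a) 0 0 L) (sym
  (trans (cong (λ p → ⟦ p ⟧ (∂ L)) (B-no-v 2 (suc a) 0)) (trans (Γ-base-ψ (∂-Respects r) a) (∂-psi r (suc a))))))
source-equation a zero (suc c) {L} r = trans (⟦rhs-xv⟧ a (suc c) r) (cong (ℤ._+ joinTerm (suc a) 0 (suc c) L) (sym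
  (cong (λ p → ⟦ p ⟧ (∂ L)) (B-v 2 (suc a) 0 c))))
source-equation a (suc b) zero {L} r = trans (⟦rhs-b-0⟧ a b r) (sym (trans (cong₂ ℤ._+_
  (trans (cong (λ p → ⟦ p ⟧ (∂ L)) (B-no-v 2 (suc a) (suc b))) (Γ-base-b (∂-Respects r) a b))
    (joinTerm-suc a b 0 L)) (ℤₚ.+-identityʳ _)))
source-equation a (suc b) (suc c) {L} r = trans (⟦rhs-b-suc⟧ a b c r) (sym (cong₂ ℤ._+_
  (cong (λ p → ⟦ p ⟧ (∂ L)) (B-v 2 (suc a) (suc b) c)) (joinTerm-suc a b (suc c) L)))

-- Induction on `c`, with `L` varying because the recursion replaces it by `∂ L`. At `c = 0` the
-- solution vanishes and only `B⁽¹⁾` is left.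
Γ-rhs : ∀ a b c {L} → Respects L → ⟦ GammaU 2 (suc a) b c ⟧ L ≡ ⟦ rhsCoeff tauCoeff a b c ⟧ L ℤ.+ ⟦ BU 2 (suc a) b c ⟧ L
Γ-rhs a b zero {L} r = sym (trans (cong₂ ℤ._+_ (eval (at-zero (Solves-rhs a b)) L r)
  (cong (λ p → ⟦ p ⟧ L) (B-no-v 2 (suc a) b))) (ℤₚ.+-identityˡ _))
Γ-rhs a b (suc c) {L} r = begin
    ⟦ GammaU 2 (suc a) b (suc c) ⟧ L
  ≡⟨ Γ-recursion r (suc a) b c refl ⟩
    ⟦ GammaU 2 (suc a) b c ⟧ (∂ L) ℤ.+ joinTerm (suc a) b c L
  ≡⟨ cong (ℤ._+ joinTerm (suc a) b c L) (Γ-rhs a b c (∂-Respects r)) ⟩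
    ⟦ X c ⟧ (∂ L) ℤ.+ ⟦ BU 2 (suc a) b c ⟧ (∂ L) ℤ.+ joinTerm (suc a) b c L
  ≡⟨ ℤₚ.+-assoc (⟦ X c ⟧ (∂ L)) (⟦ BU 2 (suc a) b c ⟧ (∂ L)) (joinTerm (suc a) b c L) ⟩
    ⟦ X c ⟧ (∂ L) ℤ.+ (⟦ BU 2 (suc a) b c ⟧ (∂ L) ℤ.+ joinTerm (suc a) b c L)
  ≡⟨ cong₂ ℤ._+_ (sym (⟦C''⟧ (X c) {L})) (sym (source-equation a b c r)) ⟩
    ⟦ C'' (X c) ⟧ L ℤ.+ ⟦ rhsCoeff source a b c ⟧ L
  ≡⟨ sym (⟦+⟧ (C'' (X c)) (rhsCoeff source a b c)) ⟩
    ⟦ C'' (X c) +P rhsCoeff source a b c ⟧ L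
  ≡⟨ sym (eval (recurrence (Solves-rhs a b) c) L r) ⟩
    ⟦ X (suc c) ⟧ L
  ≡⟨ sym (trans (cong (λ p → ⟦ X (suc c) ⟧ L ℤ.+ ⟦ p ⟧ L) (B-v 2 (suc a) b c)) (ℤₚ.+-identityʳ _)) ⟩
    ⟦ X (suc c) ⟧ L ℤ.+ ⟦ BU 2 (suc a) b (suc c) ⟧ L ∎
  where
  open ≡-Reasoning
  X : ℕ → Poly
  X = rhsCoeff tauCoeff a b

Γ≋RHS : ∀ a b c → Γ⁽¹⁾ a b c ≋ RHS a b c
eval (Γ≋RHS zero b c) L r = trans (cong (λ p → ⟦ p ⟧ L) (Γ-no-x 2 b c))
  (sym (trans (⟦+⟧ (rhsSeries tauCoeff 0 b c) (B⁽¹⁾ 0 b c) {L})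
  (cong₂ ℤ._+_ (eval (rhs-0 tauCoeff b c) L r) (cong (λ p → ⟦ p ⟧ L) (B-no-x 2 b c)))))
eval (Γ≋RHS (suc a) b c) L r = trans (Γ-rhs a b c r) (sym
  (trans (⟦+⟧ (rhsSeries tauCoeff (suc a) b c) (B⁽¹⁾ (suc a) b c) {L})
  (cong (ℤ._+ ⟦ BU 2 (suc a) b c ⟧ L) (eval (rhs-suc tauCoeff a b c) L r))))

mainTheorem11 : Γ⁽¹⁾ ≈S RHS
mainTheorem11 a b c = ≋⇒≈P (Γ≋RHS a b c)
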